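{- For $n,k\ge1$ let $p(n,k)$ be the number of genus $2$ partitions of $\{1,\ldots,n\}$ with $k$ parts, and let $P(x,y)=\sum_{n,k}p(n,k)x^ny^k$. Then $$P(x,y)=\frac{x^6y^2\cdot p(x,y)}{(x^2-2x^2y-2x+x^2y^2-2xy+1)^{11/2}},$$ where $$\begin{aligned}p(x,y)={}&x^4(8y^4-4y^3-15y^2+10y+1)+x^3(-4y^3+39y^2-10y-4)\\&+x^2(-15y^2-10y+6)+x(10y-4)+1.\end{aligned}$$
   Context: Identities are between formal power series; the $11/2$-th power of a series with constant term $1$ is the one with constant term $1$. For $n\ge1$ let $\zeta_n=(1,2,\ldots,n)$, and let $z(\cdot)$ be the number of cycles of a permutation (fixed points included). Products of permutations are composed right to left, i.e. $(\alpha^{ -1}\zeta_n)(i)=\alpha^{ -1}(\zeta_n(i))$. The genus $g(\alpha)$ of a permutation $\alpha$ of $\{1,\ldots,n\}$ is the nonnegative integer defined by $n+1-2g(\alpha)=z(\alpha)+z(\alpha^{ -1}\zeta_n)$. A permutation is called a partition if each of its cycles, listed beginning with its least element, is an increasing list; thus partitions correspond bijectively to set partitions of $\{1,\ldots,n\}$, the parts being the cycles. -}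

module Defs where

open import Algebra.Bundles.Raw using (RawRing)
import Algebra.Definitions.RawSemiring
import Algebra.Properties.Semiring.Sum
open import Data.Bool using (if_then_else_; _∧_)
open import Data.Fin using (Fin; zero; suc; toℕ; fromℕ; punchIn; _≤_; _<_)
open import Data.Fin.Permutation as Perm
  using (Permutation′; insert; remove; flip; _∘ₚ_; _⟨$⟩ʳ_)
open import Data.Fin.Properties
  using (_≟_; _≤?_; _<?_; punchIn-injective)
open import Data.Integer as ℤ using (ℤ; +_; 0ℤ; 1ℤ)
import Data.Integer.Properties as ℤ
open import Data.List.Base
  using (List; []; _∷_; length; map; filter; allFin; iterate; takeWhile;
         cartesianProductWith)
import Data.List.Membership.Setoid as Membership
import Data.List.Membership.Setoid.Properties as Membership
open import Data.List.Membership.Propositional.Properties using (∈-allFin)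
open import Data.List.Relation.Unary.All using (All; all?; [])
open import Data.List.Relation.Unary.AllPairs using ([]; _∷_)
open import Data.List.Relation.Unary.Any using (here)
open import Data.List.Relation.Unary.Linked using (Linked; linked?)
import Data.List.Relation.Unary.Unique.Propositional.Properties as Unique≡
import Data.List.Relation.Unary.Unique.Setoid as UniqueSetoid
import Data.List.Relation.Unary.Unique.Setoid.Properties as Unique
open import Data.Nat as ℕ using (ℕ; zero; suc; _∸_)
import Data.Nat.Properties as ℕ
open import Data.Product using (∃; _×_; _,_)
open import Level using (0ℓ)
open import Relation.Binary using (Setoid)
open import Relation.Binary.PropositionalEquality
  using (_≡_; refl; sym; trans; cong; setoid)
open import Relation.Nullary using (Dec; ¬?; _×-dec_)

------------------------------------------------------------------------
-- Permutations of {1,…,n}; the label i + 1 is the element i of Fin n.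

Permutationₛ : ℕ → Setoid 0ℓ 0ℓ
Permutationₛ n = record
  { Carrier       = Permutation′ n
  ; _≈_           = Perm._≈_
  ; isEquivalence = record
    { refl  = λ _ → refl
    ; sym   = λ p i → sym (p i)
    ; trans = λ p q i → trans (p i) (q i)
    }
  }

-- ζ n is the cycle (1,2,…,n): the last element goes to the first, and
-- every other element to its successor.

ζ : ∀ n → Permutation′ n
ζ zero    = Perm.id
ζ (suc n) = insert (fromℕ n) zero Perm.id

-- The cycle of π through i, listed beginning with i:  i, π i, π² i, …
-- up to (not including) the first return to i, which occurs within n steps.

cycle : ∀ {n} → Permutation′ n → Fin n → List (Fin n)
cycle {n} π i =
  i ∷ takeWhile (λ j → ¬? (j ≟ i)) (iterate (π ⟨$⟩ʳ_) (π ⟨$⟩ʳ i) n)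

LeastInCycle : ∀ {n} → Permutation′ n → Fin n → Set
LeastInCycle π i = All (i ≤_) (cycle π i)

leastInCycle? : ∀ {n} (π : Permutation′ n) (i : Fin n) → Dec (LeastInCycle π i)
leastInCycle? π i = all? (i ≤?_) (cycle π i)

-- Every cycle of π exactly once, listed beginning with its least element.

cycles : ∀ {n} → Permutation′ n → List (List (Fin n))
cycles {n} π = map (cycle π) (filter (leastInCycle? π) (allFin n))

z : ∀ {n} → Permutation′ n → ℕ
z π = length (cycles π)

-- n + 1 - 2g = z(α) + z(α⁻¹ζₙ).  Note that  π ∘ₚ ρ  applies π first.

HasGenus : ∀ {n} → Permutation′ n → ℕ → Set
HasGenus {n} α g =
  + (n ℕ.+ 1) ℤ.- + (2 ℕ.* g) ≡ + (z α ℕ.+ z (ζ n ∘ₚ flip α))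

hasGenus? : ∀ {n} (α : Permutation′ n) g → Dec (HasGenus α g)
hasGenus? {n} α g =
  + (n ℕ.+ 1) ℤ.- + (2 ℕ.* g) ℤ.≟ + (z α ℕ.+ z (ζ n ∘ₚ flip α))

IsPartition : ∀ {n} → Permutation′ n → Set
IsPartition α = All (Linked _<_) (cycles α)

isPartition? : ∀ {n} (α : Permutation′ n) → Dec (IsPartition α)
isPartition? α = all? (linked? _<?_) (cycles α)

------------------------------------------------------------------------
-- Counting

-- A permutation of Fin (suc n) is given by the image of zero and a
-- permutation of the remaining n elements.

permutations : ∀ n → List (Permutation′ n)
permutations zero    = Perm.id ∷ []
permutations (suc n) =
  cartesianProductWith (insert zero) (allFin (suc n)) (permutations n)

-- permutations n contains every permutation, up to pointwise equality,
-- exactly once.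

private
  insert-cong : ∀ {n} {i j : Fin (suc n)} {π ρ : Permutation′ n} →
                i ≡ j → π Perm.≈ ρ → insert zero i π Perm.≈ insert zero j ρ
  insert-cong refl p zero    = refl
  insert-cong {i = i} {π = π} {ρ} refl p (suc k) =
    trans (Perm.insert-punchIn zero i π k)
      (trans (cong (punchIn i) (p k))
        (sym (Perm.insert-punchIn zero i ρ k)))

  insert-injective : ∀ {n} {i j : Fin (suc n)} {π ρ : Permutation′ n} →
                     insert zero i π Perm.≈ insert zero j ρ →
                     i ≡ j × π Perm.≈ ρ
  insert-injective {i = i} {π = π} {ρ} p with p zero
  ... | refl = refl , λ k → punchIn-injective i _ _
    (trans (sym (Perm.insert-punchIn zero i π k))
      (trans (p (suc k)) (Perm.insert-punchIn zero i ρ k)))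

permutations-complete : ∀ {n} (π : Permutation′ n) →
  Membership._∈_ (Permutationₛ n) π (permutations n)
permutations-complete {zero}  π = here λ ()
permutations-complete {suc n} π =
  Membership.∈-resp-≈ (Permutationₛ (suc n))
    {x = insert zero (π ⟨$⟩ʳ zero) (remove zero π)} {y = π}
    (Perm.insert-remove zero π)
    (Membership.∈-cartesianProductWith⁺
      (setoid (Fin (suc n))) (Permutationₛ n) (Permutationₛ (suc n))
      (λ {i} {j} {π} {ρ} → insert-cong {i = i} {j} {π} {ρ})
      (∈-allFin (π ⟨$⟩ʳ zero)) (permutations-complete (remove zero π)))

permutations-unique : ∀ n → UniqueSetoid.Unique (Permutationₛ n) (permutations n)
permutations-unique zero    = [] ∷ []
permutations-unique (suc n) =
  Unique.cartesianProductWith⁺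
    (setoid (Fin (suc n))) (Permutationₛ n) (Permutationₛ (suc n))
    (insert zero) (λ {i} {j} {π} {ρ} → insert-injective)
    (Unique≡.allFin⁺ (suc n)) (permutations-unique n)

-- The number of genus 2 partitions of {1,…,n} with k parts.

p : ℕ → ℕ → ℕ
p n k = length (filter genus2Partition? (permutations n))
  where
  genus2Partition? : (α : Permutation′ n) →
                     Dec (IsPartition α × HasGenus α 2 × z α ≡ k)
  genus2Partition? α = isPartition? α ×-dec hasGenus? α 2 ×-dec z α ℕ.≟ k

------------------------------------------------------------------------
-- Formal power series in x and y over ℤ;  F i j  is the coefficient of
-- xⁱyʲ.

open Algebra.Properties.Semiring.Sum ℤ.+-*-semiring using (sum)

Series : Set
Series = ℕ → ℕ → ℤ

monomial : ℕ → ℕ → Series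
monomial a b i j = if (i ℕ.≡ᵇ a) ∧ (j ℕ.≡ᵇ b) then 1ℤ else 0ℤ

seriesRawRing : RawRing 0ℓ 0ℓ
seriesRawRing = record
  { Carrier = Series
  ; _≈_     = λ F G → ∀ i j → F i j ≡ G i j
  ; _+_     = λ F G i j → F i j ℤ.+ G i j
  ; _*_     = λ F G i j →
      sum {suc i} λ a → sum {suc j} λ b →
        F (toℕ a) (toℕ b) ℤ.* G (i ∸ toℕ a) (j ∸ toℕ b)
  ; -_      = λ F i j → ℤ.- F i j
  ; 0#      = λ _ _ → 0ℤ
  ; 1#      = monomial 0 0
  }

open RawRing seriesRawRing public
  using (_≈_; _+_; _*_; -_; 1#)
open Algebra.Definitions.RawSemiring (RawRing.rawSemiring seriesRawRing) public
  using (_^_) renaming (_×_ to _·_)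

infixl 6 _-_
_-_ : Series → Series → Series
F - G = F + (- G)

x y : Series
x = monomial 1 0
y = monomial 0 1

-- S is the power F^(m/2), for F with constant term 1: the square root of
-- F^m with constant term 1.  There is at most one, ℤ[[x,y]] being an
-- integral domain.

IsHalfPower : Series → ℕ → Series → Set
IsHalfPower F m S = S 0 0 ≡ 1ℤ × S * S ≈ F ^ m

-- Q = N / S, with S invertible.

IsQuotient : Series → Series → Series → Set
IsQuotient Q N S = ∃ λ S⁻¹ → S * S⁻¹ ≈ 1# × Q ≈ N * S⁻¹

------------------------------------------------------------------------

-- The sum is over n, k ≥ 1 only.

P : Series
P (suc n) (suc k) = + p (suc n) (suc k)
P _       _       = 0ℤ

-- The polynomial p(x,y), not to be confused with the numbers p n k.

polyₚ : Series
polyₚ =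
    x ^ 4 * (8 · y ^ 4 - 4 · y ^ 3 - 15 · y ^ 2 + 10 · y + 1#)
  + x ^ 3 * (- (4 · y ^ 3) + 39 · y ^ 2 - 10 · y - 4 · 1#)
  + x ^ 2 * (- (15 · y ^ 2) - 10 · y + 6 · 1#)
  + x * (10 · y - 4 · 1#)
  + 1#

D : Series
D =
  x ^ 2 - 2 · x ^ 2 * y - 2 · x + x ^ 2 * y ^ 2 - 2 · x * y + 1#

{-# OPTIONS --safe #-}
-- A partition of {1,…,n} is built by inserting 1,…,n in this order, each
-- element either as a new part or behind the maximum of an existing part.
-- Of the cycles of α⁻¹ζₙ (the faces) it suffices to record how often they
-- pass maxima of parts: l times for the face through n, a stack, and
-- c₁, c₂, … times for the other faces.  A new part pushes onto the stack;
-- joining the part at height j of the stack cuts off a face with l - j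
-- maxima; joining a part of another face merges that face into the stack,
-- l ↦ l + c, and exactly this raises the genus, by 1.  So p n k counts walks
-- with k pushes and two merges.
--
-- The generating functions of the walks from (l; c₁, c₂, …) are the unique
-- solution of a linear system that is contractive for the x-adic topology.
-- With x = w (1 - u) and x y = u (1 - w), so that D = (1 - u - w)², the
-- solution is (1 - w)^-(l + c₁ + c₂ + ⋯) times a polynomial in l, c₁, c₂, ….
-- It is computed in Newton's basis, where only the initial values and the
-- iterated differences of these polynomials matter; the value at l = 0
-- without other faces is the quotient in the theorem.

module Submission where

open import Algebra.Bundles using (CommutativeMonoid; CommutativeRing)
open import Algebra.Bundles.Raw using (RawRing)
import Algebra.Properties.AbelianGroup
import Algebra.Properties.CommutativeSemigroup
import Algebra.Properties.CommutativeSemiring.Exp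
import Algebra.Properties.Group
import Algebra.Properties.Ring
import Algebra.Properties.Semiring.Exp
import Algebra.Properties.Semiring.Mult
import Algebra.Properties.Semiring.Mult.TCOptimised
import Algebra.Properties.Semiring.Sum
import Algebra.Solver.Ring
open import Algebra.Solver.Ring.AlmostCommutativeRing
  using (fromCommutativeRing; _-Raw-AlmostCommutative⟶_)
open import Data.Fin.Base using (Fin; zero; suc; toℕ)
open import Data.Integer as ℤ using (ℤ; 0ℤ; 1ℤ)
import Data.Integer.Properties as ℤ
open import Data.List.Base using (List; []; _∷_; map; drop)
open import Data.Maybe.Base using (Maybe; just; nothing; from-just)
open import Data.Nat as ℕ using (ℕ; zero; suc; _∸_)
import Data.Nat.Properties as ℕ
open import Data.Product using (_,_; ∃; _×_)
import Data.Sign as Sign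
open import Data.Vec.Base using (Vec; []; _∷_; lookup)
open import Defs using (monomial)
open import Function using (_∘_; _⟨_⟩_)
open import Level using (0ℓ; _⊔_)
import Relation.Binary.PropositionalEquality as ≡
open ≡ using (_≡_; cong; cong₂)
open import Relation.Nullary using (yes; no)

-- Sums over the splittings of a number and over the elements of a list

-- With merges and newly cut off faces left out, the equations in `l` become a linear recurrence
-- with characteristic equation r - 1 = x y (r² - r) + x r. Its roots are 1/(1 - w) and 1/u; only
-- the first is a power series, hence the factor in front of the polynomials. A face contributes
-- only if some merge takes it, so two merges call for a constant term, a term for each face and a
-- term for each pair of faces.
--
-- The variables U = u/s and W = w/s with s = 1 - u - w are chosen because 1/s = 1 + U + W: up to
-- powers of s all polynomials then have coefficients in ℤ[U,W], no division occurs, and the closed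
-- form becomes an equation between two explicit elements of ℤ[U,W], decided by normal forms. No
-- square root of D is given beforehand: u and w come from a fixed point, and D = s² is a
-- consequence. Uniqueness of the solution is not a separate statement; it is the induction on the
-- exponent of x by which coefficients of any solution are compared with the numbers of walks.

module Splittings {c ℓ} (M : CommutativeMonoid c ℓ) where
  open CommutativeMonoid M renaming (_∙_ to _+_; ε to 0#; ∙-cong to +-cong; ∙-congˡ to +-congˡ;
    ∙-congʳ to +-congʳ; assoc to +-assoc; comm to +-comm)
  open import Relation.Binary.Reasoning.Setoid setoid
  open Algebra.Properties.CommutativeSemigroup commutativeSemigroup using (interchange)

  -- The sum of f j (n - j) over 1 ≤ j ≤ n.
  splitSum : (ℕ → ℕ → Carrier) → ℕ → Carrier
  splitSum f zero    = 0#
  splitSum f (suc n) = f 1 n + splitSum (f ∘ suc) n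

  removeSum : (ℕ → List ℕ → Carrier) → List ℕ → Carrier
  removeSum f []       = 0#
  removeSum f (c ∷ cs) = f c cs + removeSum (λ c′ → f c′ ∘ (c ∷_)) cs

  splitSum-cong : ∀ {f g} n → (∀ j c → j ℕ.+ c ≡ n → f j c ≈ g j c) → splitSum f n ≈ splitSum g n
  splitSum-cong zero    f≈g = refl
  splitSum-cong (suc n) f≈g = +-cong (f≈g 1 n ≡.refl)
    (splitSum-cong n (λ j c j+c≡n → f≈g (suc j) c (≡.cong suc j+c≡n)))

  splitSum-zero : ∀ n → splitSum (λ _ _ → 0#) n ≈ 0#
  splitSum-zero zero    = refl
  splitSum-zero (suc n) = trans (identityˡ _) (splitSum-zero n)

  splitSum-+ : ∀ f g n → splitSum (λ j c → f j c + g j c) n ≈ splitSum f n + splitSum g n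
  splitSum-+ f g zero    = sym (identityˡ 0#)
  splitSum-+ f g (suc n) = trans (+-congˡ (splitSum-+ (f ∘ suc) (g ∘ suc) n)) (interchange _ _ _ _)

  -- The definition peels off `j = 1`. Peeling off the largest `j` keeps the remaining first
  -- arguments and raises only the second ones, which is the form needed for differences in `n`.
  splitSum-last : ∀ f n → splitSum f (suc n) ≈ f (suc n) 0 + splitSum (λ j → f j ∘ suc) n
  splitSum-last f zero    = refl
  splitSum-last f (suc n) = begin
    f 1 (suc n) + splitSum (f ∘ suc) (suc n)           ≈⟨ +-congˡ (splitSum-last (f ∘ suc) n) ⟩
    f 1 (suc n) + (f (2 ℕ.+ n) 0 + rest)               ≈⟨ +-assoc _ _ _ ⟨
    f 1 (suc n) + f (2 ℕ.+ n) 0 + rest                 ≈⟨ +-congʳ (+-comm _ _) ⟩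
    f (2 ℕ.+ n) 0 + f 1 (suc n) + rest                 ≈⟨ +-assoc _ _ _ ⟩
    f (2 ℕ.+ n) 0 + (f 1 (suc n) + rest)               ∎
    where rest = splitSum (λ j → f (suc j) ∘ suc) n

  removeSum-cong : ∀ {f g} cs → (∀ c r → f c r ≈ g c r) → removeSum f cs ≈ removeSum g cs
  removeSum-cong []       f≈g = refl
  removeSum-cong (c ∷ cs) f≈g = +-cong (f≈g c cs) (removeSum-cong cs (λ c′ → f≈g c′ ∘ (c ∷_)))

  removeSum-zero : ∀ cs → removeSum (λ _ _ → 0#) cs ≈ 0#
  removeSum-zero []       = refl
  removeSum-zero (c ∷ cs) = trans (identityˡ _) (removeSum-zero cs)

  removeSum-+ : ∀ f g cs → removeSum (λ c r → f c r + g c r) cs ≈ removeSum f cs + removeSum g cs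
  removeSum-+ f g []       = sym (identityˡ 0#)
  removeSum-+ f g (c ∷ cs) = trans (+-congˡ (removeSum-+ (λ c′ → f c′ ∘ (c ∷_))
    (λ c′ → g c′ ∘ (c ∷_)) cs)) (interchange _ _ _ _)

-- The ring solver with integer coefficients

module IntegerCoefficients {c ℓ} (R : CommutativeRing c ℓ) where
  open CommutativeRing R
  open import Data.Integer using (+_; -[1+_]; _⊖_; _◃_)
  open Algebra.Properties.Ring ring using (-‿distribˡ-*; -‿distribʳ-*; -0#≈0#; -‿involutive)
  open Algebra.Properties.AbelianGroup +-abelianGroup using () renaming (⁻¹-∙-comm to -‿+-comm)
  open Algebra.Properties.Semiring.Mult.TCOptimised semiring
    using (1+×; ×-homo-+; ×1-homo-*) renaming (_×_ to _·_)
  open import Relation.Binary.Reasoning.Setoid setoid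

  coeffℕ : ℕ → Carrier
  coeffℕ n = n · 1#

  coeffℤ : ℤ → Carrier
  coeffℤ (+ n)    = coeffℕ n
  coeffℤ -[1+ n ] = - coeffℕ (suc n)

  coeffℤ-⊖ : ∀ m n → coeffℤ (m ⊖ n) ≈ coeffℕ m + - coeffℕ n
  coeffℤ-⊖ m zero = begin
    coeffℕ m         ≈⟨ +-identityʳ _ ⟨
    coeffℕ m + 0#    ≈⟨ +-congˡ -0#≈0# ⟨
    coeffℕ m + - 0#  ∎
  coeffℤ-⊖ zero (suc n) = sym (+-identityˡ _)
  coeffℤ-⊖ (suc m) (suc n) = begin
    coeffℤ (suc m ⊖ suc n)                       ≡⟨ ≡.cong coeffℤ (ℤ.[1+m]⊖[1+n]≡m⊖n m n) ⟩
    coeffℤ (m ⊖ n)                               ≈⟨ coeffℤ-⊖ m n ⟩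
    a - b                                       ≈⟨ +-congʳ (+-identityʳ a) ⟨
    (a + 0#) - b                                ≈⟨ +-congʳ (+-congˡ (-‿inverseʳ 1#)) ⟨
    (a + (1# - 1#)) - b                         ≈⟨ +-congʳ (+-assoc a 1# (- 1#)) ⟨
    (a + 1# - 1#) - b                           ≈⟨ +-assoc (a + 1#) (- 1#) (- b) ⟩
    (a + 1#) + (- 1# - b)                       ≈⟨ +-cong (+-comm a 1#) (-‿+-comm 1# b) ⟩
    (1# + a) - (1# + b)                         ≈⟨ +-cong (1+× m 1#) (-‿cong (1+× n 1#)) ⟨
    coeffℕ (suc m) - coeffℕ (suc n)               ∎
    where a = coeffℕ m; b = coeffℕ n

  coeffℤ-+ : ∀ i j → coeffℤ (i ℤ.+ j) ≈ coeffℤ i + coeffℤ j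
  coeffℤ-+ (+ m)    (+ n)    = ×-homo-+ 1# m n
  coeffℤ-+ (+ m)    -[1+ n ] = coeffℤ-⊖ m (suc n)
  coeffℤ-+ -[1+ m ] (+ n)    = trans (coeffℤ-⊖ n (suc m)) (+-comm _ _)
  coeffℤ-+ -[1+ m ] -[1+ n ] = begin
    - coeffℕ (suc (suc (m ℕ.+ n)))       ≡⟨ ≡.cong (λ k → - coeffℕ (suc k)) (ℕ.+-suc m n) ⟨
    - coeffℕ (suc m ℕ.+ suc n)           ≈⟨ -‿cong (×-homo-+ 1# (suc m) (suc n)) ⟩
    - (coeffℕ (suc m) + coeffℕ (suc n))   ≈⟨ -‿+-comm _ _ ⟨
    - coeffℕ (suc m) + - coeffℕ (suc n)   ∎

  coeffℤ-neg : ∀ i → coeffℤ (ℤ.- i) ≈ - coeffℤ i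
  coeffℤ-neg (+ zero)  = sym -0#≈0#
  coeffℤ-neg (+ suc n) = refl
  coeffℤ-neg -[1+ n ]  = sym (-‿involutive _)

  coeffℤ-◃- : ∀ n → coeffℤ (Sign.- ◃ n) ≈ - coeffℕ n
  coeffℤ-◃- zero    = sym -0#≈0#
  coeffℤ-◃- (suc n) = refl

  coeffℤ-* : ∀ i j → coeffℤ (i ℤ.* j) ≈ coeffℤ i * coeffℤ j
  coeffℤ-* (+ m) (+ n) = begin
    coeffℤ (Sign.+ ◃ (m ℕ.* n))  ≡⟨ ≡.cong coeffℤ (ℤ.+◃n≡+n (m ℕ.* n)) ⟩
    coeffℕ (m ℕ.* n)             ≈⟨ ×1-homo-* m n ⟩
    coeffℕ m * coeffℕ n           ∎
  coeffℤ-* (+ m) -[1+ n ] = begin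
    coeffℤ (Sign.- ◃ (m ℕ.* suc n))  ≈⟨ coeffℤ-◃- (m ℕ.* suc n) ⟩
    - coeffℕ (m ℕ.* suc n)           ≈⟨ -‿cong (×1-homo-* m (suc n)) ⟩
    - (coeffℕ m * coeffℕ (suc n))     ≈⟨ -‿distribʳ-* _ _ ⟩
    coeffℕ m * - coeffℕ (suc n)       ∎
  coeffℤ-* -[1+ m ] (+ n) = begin
    coeffℤ (Sign.- ◃ (suc m ℕ.* n))  ≈⟨ coeffℤ-◃- (suc m ℕ.* n) ⟩
    - coeffℕ (suc m ℕ.* n)           ≈⟨ -‿cong (×1-homo-* (suc m) n) ⟩
    - (coeffℕ (suc m) * coeffℕ n)     ≈⟨ -‿distribˡ-* _ _ ⟩
    - coeffℕ (suc m) * coeffℕ n       ∎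
  coeffℤ-* -[1+ m ] -[1+ n ] = begin
    coeffℕ (suc m ℕ.* suc n)                 ≈⟨ ×1-homo-* (suc m) (suc n) ⟩
    coeffℕ (suc m) * coeffℕ (suc n)           ≈⟨ -‿involutive _ ⟨
    - - (coeffℕ (suc m) * coeffℕ (suc n))     ≈⟨ -‿cong (-‿distribˡ-* _ _) ⟩
    - (- coeffℕ (suc m) * coeffℕ (suc n))     ≈⟨ -‿distribʳ-* _ _ ⟩
    - coeffℕ (suc m) * - coeffℕ (suc n)       ∎

  coeffℤ-morphism : ℤ.+-*-rawRing -Raw-AlmostCommutative⟶ fromCommutativeRing R
  coeffℤ-morphism = record
    { ⟦_⟧    = coeffℤ
    ; +-homo = coeffℤ-+
    ; *-homo = coeffℤ-*
    ; -‿homo = coeffℤ-neg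
    ; 0-homo = refl
    ; 1-homo = refl
    }

  coeffℤ-≟ : ∀ i j → Maybe (coeffℤ i ≈ coeffℤ j)
  coeffℤ-≟ i j with i ℤ.≟ j
  ... | yes i≡j = just (reflexive (≡.cong coeffℤ i≡j))
  ... | no  _   = nothing

  open Algebra.Solver.Ring ℤ.+-*-rawRing (fromCommutativeRing R) coeffℤ-morphism coeffℤ-≟ public
    using (solve; op; [+]; [*]; _:×_; _:=_; _:+_; _:*_; _:-_; :-_; _:^_; con; var; Polynomial;
      Normal; ⟦_⟧; ⟦_⟧N;
           normalise; correct; _+N_; _*N_; -N_; 0N; 1N; +N-homo; *N-homo; 0N-homo; 1N-homo; _≈N_;
             _≟N_; ⟦_⟧N-cong)

-- A list a₀ ∷ a₁ ∷ ⋯ stands for the function n ↦ Σ aᵢ (n choose i), and a list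
-- of lists b₀ ∷ b₁ ∷ ⋯ for the function (n , c) ↦ Σ bᵢ n (c choose i).

module NewtonSeries {a ℓ} (A : RawRing a ℓ) (U W : RawRing.Carrier A) where
  open RawRing A

  T : Carrier
  T = (1# + U) + W

  head₀ : List Carrier → Carrier
  head₀ []      = 0#
  head₀ (a ∷ _) = a

  infixl 6 _⊞_ _⊞₂_
  _⊞_ : List Carrier → List Carrier → List Carrier
  []       ⊞ bs       = bs
  as       ⊞ []       = as
  (a ∷ as) ⊞ (b ∷ bs) = (a + b) ∷ (as ⊞ bs)

  _⊞₂_ : List (List Carrier) → List (List Carrier) → List (List Carrier)
  []       ⊞₂ bs       = bs
  as       ⊞₂ []       = as
  (a ∷ as) ⊞₂ (b ∷ bs) = (a ⊞ b) ∷ (as ⊞₂ bs)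

  -- Newton's forward formula: the tails of a coefficient list are the iterated differences of its
  -- function, and taken as coefficients of c choose i they represent the value at `n + c`.
  tails₁ : List Carrier → List (List Carrier)
  tails₁ []       = []
  tails₁ (a ∷ as) = (a ∷ as) ∷ tails₁ as

  -- If x = s² W (1 + W), z = s² U (1 + U) and 1 = s T = r s (1 + U), then
  -- f n = rⁿ s² W (green b) n is the solution of
  -- f n = x rⁿ b n + z f (n + 1) + x (f 1 + ⋯ + f n),
  -- and slope b is the difference of green b, divided by 1 + W.

  slope : List Carrier → List Carrier
  slope []       = []
  slope (b ∷ bs) = (U * head₀ (slope bs) + (W * b + T * head₀ bs)) ∷ slope bs

  green : List Carrier → List Carrier
  green b = (T * head₀ b + U * head₀ (slope b)) ∷ map ((1# + W) *_) (slope b)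

  -- The Newton series of the sum of F (j , c) over j + c = n with j ≥ 1, where F is the function of
  -- the argument. The head is the empty sum at n = 0. The tail is the difference in n: the new
  -- summand F (n + 1 , 0), and the sum for the difference of F in c.
  conv : List (List Carrier) → List Carrier
  conv []       = []
  conv (b ∷ bs) = 0# ∷ ((b ⊞ drop 1 b) ⊞ conv bs)

  -- The same sum with the additional weight c, the number of maxima at which the cut off face can
  -- be merged. With F′ the difference of F in c, the tail comes from (c + 1) (F + F′) = c F + (F +
  -- F′) + c F′.
  conv′ : List (List Carrier) → List Carrier
  conv′ []       = []
  conv′ (b ∷ bs) = 0# ∷ ((conv (b ∷ bs) ⊞ conv bs) ⊞ conv′ bs)

  -- The polynomials in Φ₁ and Φ₂ of the module Solutions below.

  k₁ a₂ b₂ h₁ h₂ : List Carrier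
  κ₂ : List (List Carrier)
  k₁ = (1# + U) ∷ W ∷ []
  a₂ = green k₁
  b₂ = green (W ∷ [])
  h₁ = green (conv′ (k₁ ∷ []))
  κ₂ = map green (tails₁ h₁ ⊞₂ (conv′ ((a₂ ⊞ a₂) ∷ b₂ ∷ []) ∷ conv′ (b₂ ∷ []) ∷ []))
  h₂ = green (conv′ κ₂)

  start : Carrier
  start = head₀ h₂

-- The linear system for the walks

module WalkEquations {c ℓ} (R : CommutativeRing c ℓ) where
  open CommutativeRing R
  open Splittings +-commutativeMonoid
  open Algebra.Properties.Semiring.Mult semiring using () renaming (_×_ to _·_)

  -- Φ_g l cs stands for the generating function of the walks from (l; cs) with
  -- g merges.  A step contributes x, a push x y, which is z.

  record WalkSeries (x z start : Carrier) : Set (c ⊔ ℓ) where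
    field
      Φ₀    : ℕ → Carrier
      Φ₁ Φ₂ : ℕ → List ℕ → Carrier
      Φ₀-equation : ∀ l → Φ₀ l ≈ 1# + (z * Φ₀ (suc l) + x * splitSum (λ j _ → Φ₀ j) l)
      Φ₁-equation : ∀ l cs → Φ₁ l cs ≈ z * Φ₁ (suc l) cs +
        x * (splitSum (λ j c → Φ₁ j (c ∷ cs)) l + removeSum (λ c _ → (c · 1#) * Φ₀ (l ℕ.+ c)) cs)
      Φ₂-equation : ∀ l cs → Φ₂ l cs ≈ z * Φ₂ (suc l) cs +
        x * (splitSum (λ j c → Φ₂ j (c ∷ cs)) l + removeSum
          (λ c cs′ → (c · 1#) * Φ₁ (l ℕ.+ c) cs′) cs)
      Φ₂-start : Φ₂ 0 [] ≈ start

  start-resp : ∀ {x z a b} → a ≈ b → WalkSeries x z a → WalkSeries x z b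
  start-resp a≈b F = record { WalkSeries F hiding (Φ₂-start) ; Φ₂-start = trans
    (WalkSeries.Φ₂-start F) a≈b }

-- Correctness of the operations on Newton series

module NewtonSolutions {a a′ ℓ ℓ′} (A : RawRing a ℓ) (R : CommutativeRing a′ ℓ′) where
  open CommutativeRing R renaming (zero to *-zero)
  open import Data.Integer using (+_)
  open IntegerCoefficients R using (solve; _:=_; _:+_; _:*_; _:-_; _:^_; con)
  open Splittings +-commutativeMonoid
  open WalkEquations R using (WalkSeries)
  open Algebra.Properties.Semiring.Exp semiring using (_^_; ^-homo-*)
  open Algebra.Properties.Semiring.Mult semiring using () renaming (_×_ to _·_)
  open Algebra.Properties.Group +-group using () renaming (∙-cancelʳ to +-cancelʳ)
  open import Relation.Binary.Reasoning.Setoid setoid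

  fromℕ : ℕ → Carrier
  fromℕ n = n · 1#

  splitSum-*ˡ : ∀ a f n → splitSum (λ j c → a * f j c) n ≈ a * splitSum f n
  splitSum-*ˡ a f zero    = sym (zeroʳ a)
  splitSum-*ˡ a f (suc n) = trans (+-congˡ (splitSum-*ˡ a (f ∘ suc) n)) (sym (distribˡ a _ _))

  removeSum-*ˡ : ∀ a f cs → removeSum (λ c r → a * f c r) cs ≈ a * removeSum f cs
  removeSum-*ˡ a f []       = sym (zeroʳ a)
  removeSum-*ˡ a f (c ∷ cs) = trans (+-congˡ (removeSum-*ˡ a (λ c′ → f c′ ∘ (c ∷_)) cs))
    (sym (distribˡ a _ _))

  private module A = RawRing A

  module Evaluation (𝐔 𝐖 : A.Carrier) (η : A.Carrier → Carrier)
    (η-+ : ∀ p q → η (p A.+ q) ≈ η p + η q) (η-* : ∀ p q → η (p A.* q) ≈ η p * η q)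
    (η-0 : η A.0# ≈ 0#) (η-1 : η A.1# ≈ 1#) where

    open NewtonSeries A 𝐔 𝐖 renaming (T to 𝐓)

    U W T : Carrier
    U = η 𝐔
    W = η 𝐖
    T = (1# + U) + W

    η-T : η 𝐓 ≈ T
    η-T = trans (η-+ _ _) (+-congʳ (trans (η-+ _ _) (+-congʳ η-1)))

    -- In Newton's basis the difference is the tail of the list, so values are reached by recursion
    -- on the argument, without binomial coefficients.
    ev : List A.Carrier → ℕ → Carrier
    ev []       _       = 0#
    ev (a ∷ as) zero    = η a
    ev (a ∷ as) (suc n) = ev (a ∷ as) n + ev as n

    ev₂ : List (List A.Carrier) → ℕ → ℕ → Carrier
    ev₂ []       n c       = 0#
    ev₂ (b ∷ bs) n zero    = ev b n
    ev₂ (b ∷ bs) n (suc c) = ev₂ (b ∷ bs) n c + ev₂ bs n c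

    ev-zero : ∀ b → ev b 0 ≈ η (head₀ b)
    ev-zero []      = sym η-0
    ev-zero (_ ∷ _) = refl

    ev-suc : ∀ b n → ev b (suc n) ≈ ev b n + ev (drop 1 b) n
    ev-suc []      n = sym (+-identityˡ 0#)
    ev-suc (_ ∷ _) n = refl

    ev-⊞ : ∀ as bs n → ev (as ⊞ bs) n ≈ ev as n + ev bs n
    ev-⊞ []       bs       n       = sym (+-identityˡ _)
    ev-⊞ (a ∷ as) []       n       = sym (+-identityʳ _)
    ev-⊞ (a ∷ as) (b ∷ bs) zero    = η-+ a b
    ev-⊞ (a ∷ as) (b ∷ bs) (suc n) = begin
      ev ((a ∷ as) ⊞ (b ∷ bs)) n + ev (as ⊞ bs) n
        ≈⟨ +-cong (ev-⊞ (a ∷ as) (b ∷ bs) n) (ev-⊞ as bs n) ⟩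
      (ev (a ∷ as) n + ev (b ∷ bs) n) + (ev as n + ev bs n)
        ≈⟨ solve 4 (λ x y z w → (x :+ y) :+ (z :+ w) := (x :+ z) :+ (y :+ w)) refl _ _ _ _ ⟩
      (ev (a ∷ as) n + ev as n) + (ev (b ∷ bs) n + ev bs n) ∎

    ev₂-⊞₂ : ∀ as bs n c → ev₂ (as ⊞₂ bs) n c ≈ ev₂ as n c + ev₂ bs n c
    ev₂-⊞₂ []       bs       n c       = sym (+-identityˡ _)
    ev₂-⊞₂ (a ∷ as) []       n c       = sym (+-identityʳ _)
    ev₂-⊞₂ (a ∷ as) (b ∷ bs) n zero    = ev-⊞ a b n
    ev₂-⊞₂ (a ∷ as) (b ∷ bs) n (suc c) = trans
      (+-cong (ev₂-⊞₂ (a ∷ as) (b ∷ bs) n c) (ev₂-⊞₂ as bs n c))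
      (solve 4 (λ x y z w → (x :+ y) :+ (z :+ w) := (x :+ z) :+ (y :+ w)) refl _ _ _ _)

    ev₂-tails₁ : ∀ b n c → ev₂ (tails₁ b) n c ≈ ev b (n ℕ.+ c)
    ev₂-tails₁ []       n c       = refl
    ev₂-tails₁ (a ∷ as) n zero    = reflexive (≡.cong (ev (a ∷ as)) (≡.sym (ℕ.+-identityʳ n)))
    ev₂-tails₁ (a ∷ as) n (suc c) = trans
      (+-cong (ev₂-tails₁ (a ∷ as) n c) (ev₂-tails₁ as n c))
      (reflexive (≡.cong (ev (a ∷ as)) (≡.sym (ℕ.+-suc n c))))

    conv-correct : ∀ b n → splitSum (ev₂ b) n ≈ ev (conv b) n
    conv-correct []       n       = splitSum-zero n
    conv-correct (b ∷ bs) zero    = sym η-0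
    conv-correct (b ∷ bs) (suc n) = begin
      splitSum (ev₂ (b ∷ bs)) (suc n)
        ≈⟨ splitSum-last (ev₂ (b ∷ bs)) n ⟩
      ev b (suc n) + splitSum (λ j c → ev₂ (b ∷ bs) j c + ev₂ bs j c) n
        ≈⟨ +-cong (ev-suc b n) (splitSum-+ (ev₂ (b ∷ bs)) (ev₂ bs) n) ⟩
      (ev b n + ev (drop 1 b) n) + (splitSum (ev₂ (b ∷ bs)) n + splitSum (ev₂ bs) n)
        ≈⟨ +-cong (ev-⊞ b (drop 1 b) n) (+-cong (sym (conv-correct (b ∷ bs) n))
          (sym (conv-correct bs n))) ⟨
      ev (b ⊞ drop 1 b) n + (ev (conv (b ∷ bs)) n + ev (conv bs) n)
        ≈⟨ solve 3 (λ x y z → x :+ (y :+ z) := y :+ (x :+ z)) refl _ _ _ ⟩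
      ev (conv (b ∷ bs)) n + (ev (b ⊞ drop 1 b) n + ev (conv bs) n)
        ≈⟨ +-congˡ (ev-⊞ (b ⊞ drop 1 b) (conv bs) n) ⟨
      ev (conv (b ∷ bs)) (suc n) ∎

    conv′-correct : ∀ b n → splitSum (λ j c → fromℕ c * ev₂ b j c) n ≈ ev (conv′ b) n
    conv′-correct [] n = trans (splitSum-cong n (λ _ _ _ → zeroʳ _)) (splitSum-zero n)
    conv′-correct (b ∷ bs) zero    = sym η-0
    conv′-correct (b ∷ bs) (suc n) = begin
      splitSum (λ j c → fromℕ c * ev₂ (b ∷ bs) j c) (suc n)
        ≈⟨ splitSum-last (λ j c → fromℕ c * ev₂ (b ∷ bs) j c) n ⟩
      0# * ev b (suc n) + splitSum (λ j c → (1# + fromℕ c) * (ev₂ (b ∷ bs) j c + ev₂ bs j c)) n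
        ≈⟨ +-cong (zeroˡ _) (splitSum-cong n (λ j c _ → solve 3
          (λ i x y → (con (+ 1) :+ i) :* (x :+ y) := ((x :+ y) :+ i :* y) :+ i :* x) refl
          (fromℕ c) (ev₂ (b ∷ bs) j c) (ev₂ bs j c))) ⟩
      0# + splitSum (λ j c → ((ev₂ (b ∷ bs) j c + ev₂ bs j c) + fromℕ c * ev₂ bs j c) + fromℕ c *
        ev₂ (b ∷ bs) j c) n
        ≈⟨ +-identityˡ _ ⟩
      splitSum (λ j c → ((ev₂ (b ∷ bs) j c + ev₂ bs j c) + fromℕ c * ev₂ bs j c) + fromℕ c * ev₂
        (b ∷ bs) j c) n
        ≈⟨ trans (splitSum-+ _ _ n) (+-congʳ (trans (splitSum-+ _ _ n)
          (+-congʳ (splitSum-+ _ _ n)))) ⟩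
      ((splitSum (ev₂ (b ∷ bs)) n + splitSum (ev₂ bs) n) + splitSum (λ j c → fromℕ c * ev₂ bs j c)
        n) + splitSum (λ j c → fromℕ c * ev₂ (b ∷ bs) j c) n
        ≈⟨ +-cong (+-cong (+-cong (conv-correct (b ∷ bs) n) (conv-correct bs n))
          (conv′-correct bs n)) (conv′-correct (b ∷ bs) n) ⟩
      ((ev (conv (b ∷ bs)) n + ev (conv bs) n) + ev (conv′ bs) n) + ev (conv′ (b ∷ bs)) n
        ≈⟨ +-comm _ _ ⟩
      ev (conv′ (b ∷ bs)) n + ((ev (conv (b ∷ bs)) n + ev (conv bs) n) + ev (conv′ bs) n)
        ≈⟨ +-congˡ (trans (ev-⊞ (conv (b ∷ bs) ⊞ conv bs) (conv′ bs) n)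
          (+-congʳ (ev-⊞ (conv (b ∷ bs)) (conv bs) n))) ⟨
      ev (conv′ (b ∷ bs)) (suc n) ∎

    ev-map-* : ∀ p b n → ev (map (p A.*_) b) n ≈ η p * ev b n
    ev-map-* p []       n       = sym (zeroʳ _)
    ev-map-* p (b ∷ bs) zero    = η-* p b
    ev-map-* p (b ∷ bs) (suc n) =
      trans (+-cong (ev-map-* p (b ∷ bs) n) (ev-map-* p bs n)) (sym (distribˡ (η p) _ _))

    -- By definition the recursion of `slope` holds at 0 for the list and all its tails. Both sides
    -- are linear and compatible with differences, so it passes from each argument to the next.
    ev-slope : ∀ b n →
      ev (slope b) n ≈ U * ev (drop 1 (slope b)) n + (W * ev b n + T * ev (drop 1 b) n)
    ev-slope [] n = solve 3 (λ x y z → con (+ 0) := x :* con (+ 0) :+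
      (y :* con (+ 0) :+ z :* con (+ 0))) refl U W T
    ev-slope (b ∷ bs) zero = begin
      η (𝐔 A.* head₀ (slope bs) A.+ (𝐖 A.* b A.+ 𝐓 A.* head₀ bs))
        ≈⟨ trans (η-+ _ _) (+-cong (η-* _ _) (trans (η-+ _ _) (+-cong (η-* _ _) (η-* _ _)))) ⟩
      U * η (head₀ (slope bs)) + (W * η b + η 𝐓 * η (head₀ bs))
        ≈⟨ +-cong (*-congˡ (sym (ev-zero (slope bs)))) (+-congˡ (*-cong η-T (sym (ev-zero bs)))) ⟩
      U * ev (slope bs) 0 + (W * η b + T * ev bs 0) ∎
    ev-slope (b ∷ bs) (suc n) = begin
      ev (slope (b ∷ bs)) n + ev (slope bs) n
        ≈⟨ +-cong (ev-slope (b ∷ bs) n) (ev-slope bs n) ⟩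
      (U * ev (slope bs) n + (W * ev (b ∷ bs) n + T * ev bs n))
        + (U * ev (drop 1 (slope bs)) n + (W * ev bs n + T * ev (drop 1 bs) n))
        ≈⟨ solve 9 (λ u w t x x′ y y′ z z′ → (u :* x :+ (w :* y :+ t :* z)) :+
          (u :* x′ :+ (w :* y′ :+ t :* z′))
              := u :* (x :+ x′) :+ (w :* (y :+ y′) :+ t :* (z :+ z′))) refl _ _ _ _ _ _ _ _ _ ⟩
      U * (ev (slope bs) n + ev (drop 1 (slope bs)) n)
        + (W * (ev (b ∷ bs) n + ev bs n) + T * (ev bs n + ev (drop 1 bs) n))
        ≈⟨ +-cong (*-congˡ (ev-suc (slope bs) n)) (+-congˡ (*-congˡ (ev-suc bs n))) ⟨
      U * ev (slope bs) (suc n) + (W * ev (b ∷ bs) (suc n) + T * ev bs (suc n)) ∎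

    ev-green-zero : ∀ b → ev (green b) 0 ≈ T * ev b 0 + U * ev (slope b) 0
    ev-green-zero b = trans (η-+ _ _) (+-cong
      (trans (η-* _ _) (*-cong η-T (sym (ev-zero b))))
      (trans (η-* _ _) (*-congˡ (sym (ev-zero (slope b))))))

    ev-green-suc : ∀ b n → ev (green b) (suc n) ≈ ev (green b) n + (1# + W) * ev (slope b) n
    ev-green-suc b n = +-congˡ (trans (ev-map-* _ (slope b) n)
      (*-congʳ (trans (η-+ _ _) (+-congʳ η-1))))

    ev₂-pair : ∀ p q n c → ev₂ (p ∷ q ∷ []) n c ≈ ev p n + fromℕ c * ev q n
    ev₂-pair p q n zero    = solve 2 (λ x y → x := x :+ con (+ 0) :* y) refl _ _
    ev₂-pair p q n (suc c) = trans (+-cong (ev₂-pair p q n c) (ev₂-single c))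
      (solve 3 (λ x y i → (x :+ i :* y) :+ y := x :+ (con (+ 1) :+ i) :* y) refl _ _ _)
      where
      ev₂-single : ∀ c → ev₂ (q ∷ []) n c ≈ ev q n
      ev₂-single zero    = refl
      ev₂-single (suc c) = trans (+-identityʳ _) (ev₂-single c)

    -- The explicit solution of the linear system

    module Solutions (s r v : Carrier) (sT≈1 : s * T ≈ 1#)
      (r-inverse : r * (s * (1# + U)) ≈ 1#) (v-inverse : v * (s * (1# + W)) ≈ 1#) where

      -- With u = s U and w = s W the hypotheses say s = 1 - u - w, r = 1/(1 - w) and v = 1/(1 - u),
      -- so that these four are w (1 - u), u (1 - w), s w and w.
      X Z ω σ : Carrier
      X = (s * s) * (W * (1# + W))
      Z = (s * s) * (U * (1# + U))
      ω = (s * s) * W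
      σ = s * W

      -- The system for one fixed list of other faces: the source `g` collects what newly cut off
      -- faces and merges contribute, and the rest is an equation in the level alone.
      Solves : (ℕ → Carrier) → (ℕ → Carrier) → Set _
      Solves f g = ∀ n → f n ≈ g n + (Z * f (suc n) + X * splitSum (λ j _ → f j) n)

      -- Subtracting the equations for `n` and `n + 1` leaves a single summand of the sum. The
      -- hypothesis is this difference with all terms moved to the positive side.
      solves-from-differences : ∀ {f g} → f 0 ≈ g 0 + Z * f 1 →
        (∀ n → f (suc n) + (g n + Z * f (suc n)) ≈ (g (suc n) + (Z * f (2 ℕ.+ n) + X * f (suc n)))
          + f n) →
        Solves f g
      solves-from-differences {f} {g} base step zero    =
        trans base (+-congˡ (trans (sym (+-identityʳ _)) (+-congˡ (sym (zeroʳ X)))))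
      solves-from-differences {f} {g} base step (suc n) = +-cancelʳ (g n + Z * f (suc n)) _ _ (begin
        f (suc n) + (g n + Z * f (suc n))
          ≈⟨ step n ⟩
        (g (suc n) + (Z * f (2 ℕ.+ n) + X * f (suc n))) + f n
          ≈⟨ +-congˡ (solves-from-differences base step n) ⟩
        (g (suc n) + (Z * f (2 ℕ.+ n) + X * f (suc n))) + (g n + (Z * f (suc n) + X * S))
          ≈⟨ solve 7 (λ a b x f c d S → (a :+ (b :+ x :* f)) :+ (c :+ (d :+ x :* S)) :=
               (a :+ (b :+ x :* (f :+ S))) :+ (c :+ d)) refl _ _ _ _ _ _ _ ⟩
        (g (suc n) + (Z * f (2 ℕ.+ n) + X * (f (suc n) + S))) + (g n + Z * f (suc n))
          ≈⟨ +-congʳ (+-congˡ (+-congˡ (*-congˡ (splitSum-last (λ j _ → f j) n)))) ⟨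
        (g (suc n) + (Z * f (2 ℕ.+ n) + X * splitSum (λ j _ → f j) (suc n))) +
          (g n + Z * f (suc n)) ∎)
        where S = splitSum (λ j _ → f j) n

      solves-cong : ∀ {f f′ g g′} → (∀ n → f n ≈ f′ n) → (∀ n → g n ≈ g′ n) → Solves f g →
        Solves f′ g′
      solves-cong f≈f′ g≈g′ sol n = trans (sym (f≈f′ n)) (trans (sol n) (+-cong (g≈g′ n)
        (+-cong (*-congˡ (f≈f′ (suc n))) (*-congˡ (splitSum-cong n (λ j _ _ → f≈f′ j))))))

      solves-+ : ∀ {f f′ g g′} → Solves f g → Solves f′ g′ → Solves (λ n → f n + f′ n)
        (λ n → g n + g′ n)
      solves-+ {f} {f′} sol sol′ n = trans (+-cong (sol n) (sol′ n)) (trans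
        (solve 8 (λ a b x y z p q S → (a :+ (z :* p :+ x :* y)) :+ (b :+ (z :* q :+ x :* S)) :=
          (a :+ b) :+ (z :* (p :+ q) :+ x :* (y :+ S))) refl _ _ _ _ _ _ _ _)
        (+-congˡ (+-congˡ (*-congˡ (sym (splitSum-+ (λ j _ → f j) (λ j _ → f′ j) n))))))

      solves-* : ∀ t {f g} → Solves f g → Solves (λ n → t * f n) (λ n → t * g n)
      solves-* t {f} sol n = trans (*-congˡ (sol n)) (trans
        (solve 6 (λ t a z b x S → t :* (a :+ (z :* b :+ x :* S)) := t :* a :+
          (z :* (t :* b) :+ x :* (t :* S))) refl _ _ _ _ _ _)
        (+-congˡ (+-congˡ (*-congˡ (sym (splitSum-*ˡ t (λ j _ → f j) n))))))

      r-cancel : ∀ n → r ^ n ≈ r ^ suc n * (s * (1# + U))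
      r-cancel n = sym (trans (solve 3 (λ r p t → (r :* p) :* t := (r :* t) :* p) refl r (r ^ n)
        (s * (1# + U)))
        (trans (*-congʳ r-inverse) (*-identityˡ _)))

      Zr : Z * r ≈ s * U
      Zr = trans (solve 3 (λ s u r → ((s :* s) :* (u :* (con (+ 1) :+ u))) :* r :=
        (r :* (s :* (con (+ 1) :+ u))) :* (s :* u)) refl s U r)
        (trans (*-congʳ r-inverse) (*-identityˡ _))

      -- A unit factor for the ring solver, which cannot use `s * T ≈ 1#`. Multiplying terms by `τ`
      -- until all have the same degree in `s` turns the identities below into polynomial identities
      -- with `T` spelled out as 1 + U + W.
      τ : Carrier
      τ = s * T

      *τ : ∀ t → t * τ ≈ t
      *τ t = trans (*-congˡ sT≈1) (*-identityʳ t)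

      -- Since `r` is a root of the characteristic equation, substituting `r ^ n * (ω * q n)` into
      -- the differences leaves an equation of first order for the difference of `q`; divided by 1 +
      -- W it is the recursion of `slope`. The equation at 0 fixes `q 0`. Functions take the place
      -- of lists because the source is once the constant `v`, which is not given as a coefficient
      -- of a list.
      green-solves : ∀ {q e e′ b b′ : ℕ → Carrier} →
        (∀ n → b (suc n) ≈ b n + b′ n) → (∀ n → e (suc n) ≈ e n + e′ n) →
        (∀ n → e n ≈ U * e′ n + (W * b n + T * b′ n)) →
        q 0 ≈ T * b 0 + U * e 0 → (∀ n → q (suc n) ≈ q n + (1# + W) * e n) →
        Solves (λ n → r ^ n * (ω * q n)) (λ n → X * (r ^ n * b n))
      green-solves {q} {e} {e′} {b} {b′} Δb Δe slope-e q₀ Δq = solves-from-differences base step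
        where
        base : 1# * (ω * q 0) ≈ X * (1# * b 0) + Z * (r * 1# * (ω * q 1))
        base = begin
          1# * (ω * q 0)
            ≈⟨ *-identityˡ _ ⟩
          ω * q 0
            ≈⟨ *τ _ ⟨
          (ω * q 0) * τ
            ≈⟨ *-congʳ (*-congˡ q₀) ⟩
          (ω * (T * b 0 + U * e 0)) * τ
            ≈⟨ solve 5 (λ s u w b e → let t = (con (+ 1) :+ u) :+ w in
                 (((s :* s) :* w) :* (t :* b :+ u :* e)) :* (s :* t) :=
                 (((s :* s) :* (w :* (con (+ 1) :+ w))) :* b) :* (s :* t)
                 :+ (s :* u) :* (((s :* s) :* w) :*
                   ((t :* b :+ u :* e) :+ (con (+ 1) :+ w) :* e))) refl s U W (b 0) (e 0) ⟩
          (X * b 0) * τ + (s * U) * (ω * ((T * b 0 + U * e 0) + (1# + W) * e 0))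
            ≈⟨ +-cong (*τ _) (*-cong (sym Zr) (*-congˡ (trans (+-congʳ (sym q₀)) (sym (Δq 0))))) ⟩
          X * b 0 + (Z * r) * (ω * q 1)
            ≈⟨ solve 5 (λ x b z r p → x :* b :+ (z :* r) :* p := x :* (con (+ 1) :* b) :+ z :*
              (r :* con (+ 1) :* p)) refl _ _ _ _ _ ⟩
          X * (1# * b 0) + Z * (r * 1# * (ω * q 1)) ∎
        step : ∀ n →
          r ^ suc n * (ω * q (suc n)) + (X * (r ^ n * b n) + Z * (r ^ suc n * (ω * q (suc n)))) ≈
          (X * (r ^ suc n * b (suc n)) + (Z * (r ^ (2 ℕ.+ n) * (ω * q (2 ℕ.+ n))) + X *
            (r ^ suc n * (ω * q (suc n)))))
            + r ^ n * (ω * q n)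
        step n = begin
          P * (ω * q (suc n)) + (X * (r ^ n * b n) + Z * (P * (ω * q (suc n))))
            ≈⟨ +-cong (sym (trans (*τ _) (*τ _))) (+-congʳ
              (*-congˡ (*-congʳ (trans (r-cancel n) (sym (*τ _)))))) ⟩
          ((P * (ω * q (suc n))) * τ) * τ
            + (X * (((P * (s * (1# + U))) * τ) * b n) + Z * (P * (ω * q (suc n))))
            ≈⟨ +-cong (*-congʳ (*-congʳ (*-congˡ (*-congˡ q₁))))
              (+-congˡ (*-congˡ (*-congˡ (*-congˡ q₁)))) ⟩
          ((P * (ω * Q)) * τ) * τ + (X * (((P * (s * (1# + U))) * τ) * b n) + Z * (P * (ω * Q)))
            ≈⟨ solve 8 (λ s u w p q e b b′ →
                 let t  = (con (+ 1) :+ u) :+ w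
                     k  = s :* t
                     om = (s :* s) :* w
                     x  = (s :* s) :* (w :* (con (+ 1) :+ w))
                     z  = (s :* s) :* (u :* (con (+ 1) :+ u))
                     Q  = q :+ (con (+ 1) :+ w) :* (u :* e :+ (w :* b :+ t :* b′))
                     Q₂ = Q :+ (con (+ 1) :+ w) :* ((u :* e :+ (w :* b :+ t :* b′)) :+ e)
                 in
                 ((p :* (om :* Q)) :* k) :* k :+ (x :*
                   (((p :* (s :* (con (+ 1) :+ u))) :* k) :* b) :+ z :* (p :* (om :* Q))) :=
                 (((x :* (p :* (b :+ b′))) :* k) :* k :+
                   (((s :* u) :* (p :* (om :* Q₂))) :* k :+ x :* (p :* (om :* Q))))
                 :+ ((p :* (s :* (con (+ 1) :+ u))) :* (om :* q)) :* k)
                 refl s U W P (q n) (e′ n) (b n) (b′ n) ⟩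
          (((X * (P * (b n + b′ n))) * τ) * τ + (((s * U) * (P * (ω * Q₂))) * τ + X *
            (P * (ω * Q))))
            + ((P * (s * (1# + U))) * (ω * q n)) * τ
            ≈⟨ +-cong (+-cong (trans (*τ _) (*τ _)) (+-congʳ (*τ _))) (*τ _) ⟩
          (X * (P * (b n + b′ n)) + ((s * U) * (P * (ω * Q₂)) + X * (P * (ω * Q))))
            + (P * (s * (1# + U))) * (ω * q n)
            ≈⟨ +-cong (+-cong (*-congˡ (*-congˡ (sym (Δb n))))
                 (+-cong (*-cong (sym Zr) (*-congˡ (*-congˡ (sym q₂))))
                   (*-congˡ (*-congˡ (*-congˡ (sym q₁))))))
                 (*-congʳ (sym (r-cancel n))) ⟩
          (X * (P * b (suc n)) + ((Z * r) * (P * (ω * q (2 ℕ.+ n))) + X * (P * (ω * q (suc n)))))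
            + r ^ n * (ω * q n)
            ≈⟨ +-congʳ (+-congˡ (+-congʳ (solve 4 (λ z r p y → (z :* r) :* (p :* y) := z :*
              ((r :* p) :* y)) refl Z r P _))) ⟩
          (X * (P * b (suc n)) + (Z * (r * P * (ω * q (2 ℕ.+ n))) + X * (P * (ω * q (suc n)))))
            + r ^ n * (ω * q n) ∎
          where
          P  = r ^ suc n
          E  = U * e′ n + (W * b n + T * b′ n)
          Q  = q n + (1# + W) * E
          Q₂ = Q + (1# + W) * (E + e′ n)
          q₁ : q (suc n) ≈ Q
          q₁ = trans (Δq n) (+-congˡ (*-congˡ (slope-e n)))
          q₂ : q (2 ℕ.+ n) ≈ Q₂
          q₂ = trans (Δq (suc n)) (+-cong q₁ (*-congˡ (trans (Δe n) (+-congʳ (slope-e n)))))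

      ev-green-solves : ∀ t b → Solves (λ n → r ^ n * ((ω * t) * ev (green b) n))
        (λ n → X * (r ^ n * (t * ev b n)))
      ev-green-solves t b = solves-cong
        (λ n → solve 4 (λ t p w q → t :* (p :* (w :* q)) := p :* ((w :* t) :* q)) refl t (r ^ n) ω
          _)
        (λ n → solve 4 (λ t x p b → t :* (x :* (p :* b)) := x :* (p :* (t :* b))) refl t X (r ^ n)
          _)
        (solves-* t (green-solves (ev-suc b) (ev-suc (slope b)) (ev-slope b) (ev-green-zero b)
          (ev-green-suc b)))

      -- The equation concerns `n` only and is linear, so it can be solved separately for each
      -- coefficient of c choose i.
      ev₂-map-solves : ∀ t bs c →
        Solves (λ n → r ^ n * ((ω * t) * ev₂ (map green bs) n c))
          (λ n → X * (r ^ n * (t * ev₂ bs n c)))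
      ev₂-map-solves t []       c       n = solve 6
        (λ t x p z p′ w → p :* ((w :* t) :* con (+ 0)) :=
        x :* (p :* (t :* con (+ 0))) :+ (z :* (p′ :* ((w :* t) :* con (+ 0))) :+ x :* con (+ 0)))
          refl t X (r ^ n) Z (r ^ suc n) ω ⟨ trans ⟩
        +-congˡ (+-congˡ (*-congˡ
          (sym (trans (splitSum-cong n (λ j _ _ → trans (*-congˡ (zeroʳ _)) (zeroʳ _)))
          (splitSum-zero n)))))
      ev₂-map-solves t (b ∷ bs) zero    = ev-green-solves t b
      ev₂-map-solves t (b ∷ bs) (suc c) = solves-cong
        (λ n → solve 4 (λ p t y z → p :* (t :* y) :+ p :* (t :* z) := p :* (t :* (y :+ z))) refl
          (r ^ n) (ω * t) _ _)
        (λ n → solve 5 (λ x p t y z → x :* (p :* (t :* y)) :+ x :* (p :* (t :* z)) := x :*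
          (p :* (t :* (y :+ z)))) refl X (r ^ n) t _ _)
        (solves-+ (ev₂-map-solves t (b ∷ bs) c) (ev₂-map-solves t bs c))

      -- The exponents of `r` at the level left and at the face cut off add up to `n` for every
      -- splitting: a pop does not change the total number of maxima, and the sum becomes one of
      -- polynomials.
      splitSum-r^ : ∀ f n → splitSum (λ j c → r ^ c * (r ^ j * f j c)) n ≈ r ^ n * splitSum f n
      splitSum-r^ f n = trans
        (splitSum-cong n (λ { j c ≡.refl → trans (solve 3
          (λ x y z → x :* (y :* z) := (y :* x) :* z) refl (r ^ c) (r ^ j) _)
          (*-congʳ (sym (^-homo-* r j c))) }))
        (splitSum-*ˡ (r ^ n) f n)

      κ : ℕ → ℕ → Carrier
      K A₂ B₂ H₁ H₂ : ℕ → Carrier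
      K  = ev k₁
      A₂ = ev a₂
      B₂ = ev b₂
      H₁ = ev h₁
      H₂ = ev h₂
      κ  = ev₂ κ₂

      ev-single : ∀ w n → ev (w ∷ []) n ≈ η w
      ev-single w zero    = refl
      ev-single w (suc n) = trans (+-identityʳ _) (ev-single w n)

      K-linear : ∀ n c → K (n ℕ.+ c) ≈ K n + fromℕ c * W
      K-linear n zero    = trans (reflexive (≡.cong K (ℕ.+-identityʳ n)))
        (sym (trans (+-congˡ (zeroˡ W)) (+-identityʳ _)))
      K-linear n (suc c) = trans (reflexive (≡.cong K (ℕ.+-suc n c))) (trans
        (+-cong (K-linear n c) (ev-single 𝐖 (n ℕ.+ c)))
        (solve 3 (λ k c w → (k :+ c :* w) :+ w := k :+ (con (+ 1) :+ c) :* w) refl (K n) (fromℕ c)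
          W))

      K-zero : K 0 ≈ 1# + U
      K-zero = trans (η-+ _ _) (+-congʳ η-1)

      -- The case of genus 0: `Φ₀ 0` is v = 1/(1 - u), the generating function of the noncrossing
      -- partitions, the empty one included.
      Φ₀ : ℕ → Carrier
      Φ₀ n = v * r ^ n

      v-cancel : ∀ t → t * (v * (s * (1# + W))) ≈ t
      v-cancel t = trans (*-congˡ v-inverse) (*-identityʳ t)

      Φ₀-solves : Solves Φ₀ (λ _ → 1#)
      Φ₀-solves = solves-from-differences
        (begin
          v * 1#
            ≈⟨ trans (*-identityʳ v) (sym (*τ v)) ⟩
          v * τ
            ≈⟨ solve 4 (λ v s u w → v :* (s :* ((con (+ 1) :+ u) :+ w)) := v :*
              (s :* (con (+ 1) :+ w)) :+ (s :* u) :* v) refl v s U W ⟩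
          v * (s * (1# + W)) + (s * U) * v
            ≈⟨ +-cong v-inverse (trans (*-congʳ (sym Zr))
              (solve 3 (λ z r v → (z :* r) :* v := z :* (v :* (r :* con (+ 1)))) refl Z r v)) ⟩
          1# + Z * (v * (r * 1#)) ∎)
        (λ n → let P = r ^ suc n in begin
          v * P + (1# + Z * (v * P))
            ≈⟨ +-congʳ (sym (trans (*τ _) (*τ _))) ⟩
          ((v * P) * τ) * τ + (1# + Z * (v * P))
            ≈⟨ solve 5 (λ s u w v p →
                 let k = s :* ((con (+ 1) :+ u) :+ w)
                     x  = (s :* s) :* (w :* (con (+ 1) :+ w))
                     z  = (s :* s) :* (u :* (con (+ 1) :+ u))
                 in ((v :* p) :* k) :* k :+ (con (+ 1) :+ z :* (v :* p)) :=
                    (con (+ 1) :+ (((s :* u) :* (v :* p)) :* k :+ x :* (v :* p))) :+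
                      (v :* (p :* (s :* (con (+ 1) :+ u)))) :* k)
                 refl s U W v P ⟩
          (1# + (((s * U) * (v * P)) * τ + X * (v * P))) + (v * (P * (s * (1# + U)))) * τ
            ≈⟨ +-cong (+-congˡ (+-congʳ (trans (*τ _) (trans (*-congʳ (sym Zr))
                 (solve 4 (λ z r v p → (z :* r) :* (v :* p) := z :* (v :* (r :* p))) refl Z r v
                   P)))))
                 (trans (*τ _) (*-congˡ (sym (r-cancel n)))) ⟩
          (1# + (Z * (v * (r * P)) + X * (v * P))) + v * r ^ n ∎)

      -- The Green's function of the constant `v` is v (1 + W) K, by T + U W = (1 + U) (1 + W), and
      -- ω v (1 + W) is `σ`.
      K-solves : Solves (λ n → r ^ n * (σ * K n)) (λ n → X * (r ^ n * v))
      K-solves = solves-cong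
        (λ n → *-congˡ (trans
          (solve 4 (λ s w v k → ((s :* s) :* w) :* ((v :* (con (+ 1) :+ w)) :* k) :=
            ((s :* w) :* k) :* (v :* (s :* (con (+ 1) :+ w)))) refl s W v (K n))
          (v-cancel _)))
        (λ n → refl)
        (green-solves {e = λ _ → W * v} {e′ = λ _ → 0#} {b = λ _ → v} {b′ = λ _ → 0#}
          (λ _ → sym (+-identityʳ _)) (λ _ → sym (+-identityʳ _))
          (λ _ → solve 4 (λ u w v t → w :* v := u :* con (+ 0) :+ (w :* v :+ t :* con (+ 0))) refl
            U W v T)
          (trans (*-congˡ K-zero) (solve 3 (λ u w v → (v :* (con (+ 1) :+ w)) :* (con (+ 1) :+ u)
            := ((con (+ 1) :+ u) :+ w) :* v :+ u :* (w :* v)) refl U W v))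
          (λ n → trans (*-congˡ (+-congˡ (ev-single 𝐖 n)))
            (solve 3 (λ w v k → (v :* (con (+ 1) :+ w)) :* (k :+ w) := (v :* (con (+ 1) :+ w)) :*
              k :+ (con (+ 1) :+ w) :* (w :* v)) refl W v (K n))))

      -- A merge with a face of c maxima has c choices and raises the level by c, whence the weight
      -- `c r ^ c`. The further factor c in `m₁` stems from the linear growth of `K` with the level.
      m₀ m₁ : List ℕ → Carrier
      m₀ = removeSum (λ c _ → fromℕ c * r ^ c)
      m₁ = removeSum (λ c _ → fromℕ c * (fromℕ c * r ^ c))

      -- In the second summand the merge takes one of the faces `cs`; in the first it takes a face
      -- that is cut off later.
      Φ₁ : ℕ → List ℕ → Carrier
      Φ₁ n cs = r ^ n * ((ω * σ) * H₁ n) + m₀ cs * (r ^ n * (σ * K n))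

      Equation : (ℕ → List ℕ → Carrier) → (ℕ → List ℕ → Carrier) → Set _
      Equation Φ M = ∀ cs n → Φ n cs ≈ Z * Φ (suc n) cs + X *
        (splitSum (λ j c → Φ j (c ∷ cs)) n + removeSum (λ c r → fromℕ c * M (n ℕ.+ c) r) cs)

      Φ₁-equation : Equation Φ₁ (λ n _ → Φ₀ n)
      Φ₁-equation cs n = begin
        Φ₁ n cs
          ≈⟨ solves-+ (ev-green-solves σ (conv′ (k₁ ∷ []))) (solves-* (m₀ cs) K-solves) n ⟩
        (X * (r ^ n * (σ * ev (conv′ (k₁ ∷ [])) n)) + m₀ cs * (X * (r ^ n * v)))
          + (Z * Φ₁ (suc n) cs + X * splitSum (λ j _ → Φ₁ j cs) n)
          ≈⟨ solve 8 (λ x a m p v z f S → (x :* a :+ m :* (x :* (p :* v))) :+ (z :* f :+ x :* S) :=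
               z :* f :+ x :* ((S :+ a) :+ (p :* v) :* m)) refl X _ (m₀ cs) (r ^ n) v Z _ _ ⟩
        Z * Φ₁ (suc n) cs + X * ((splitSum (λ j _ → Φ₁ j cs) n + r ^ n *
          (σ * ev (conv′ (k₁ ∷ [])) n)) + (r ^ n * v) * m₀ cs)
          ≈⟨ +-congˡ (*-congˡ (+-cong split remove)) ⟨
        Z * Φ₁ (suc n) cs + X * (splitSum (λ j c → Φ₁ j (c ∷ cs)) n + removeSum
          (λ c _ → fromℕ c * Φ₀ (n ℕ.+ c)) cs) ∎
        where
        ev₂-k : ∀ j c → ev₂ (k₁ ∷ []) j c ≈ K j
        ev₂-k j zero    = refl
        ev₂-k j (suc c) = trans (+-identityʳ _) (ev₂-k j c)
        split : splitSum (λ j c → Φ₁ j (c ∷ cs)) n ≈ splitSum (λ j _ → Φ₁ j cs) n + r ^ n *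
          (σ * ev (conv′ (k₁ ∷ [])) n)
        split = begin
          splitSum (λ j c → Φ₁ j (c ∷ cs)) n
            ≈⟨ splitSum-cong n (λ j c _ → solve 7 (λ h i q m p t k → h :+ (i :* q :+ m) :*
              (p :* (t :* k)) :=
                 (h :+ m :* (p :* (t :* k))) :+ q :* (p :* (t :* (i :* k)))) refl _ (fromℕ c)
                   (r ^ c) (m₀ cs) (r ^ j) σ (K j)) ⟩
          splitSum (λ j c → Φ₁ j cs + r ^ c * (r ^ j * (σ * (fromℕ c * K j)))) n
            ≈⟨ splitSum-+ _ _ n ⟩
          splitSum (λ j c → Φ₁ j cs) n + splitSum (λ j c → r ^ c *
            (r ^ j * (σ * (fromℕ c * K j)))) n
            ≈⟨ +-congˡ (trans (splitSum-r^ _ n) (*-congˡ (trans (splitSum-*ˡ σ _ n) (*-congˡ (trans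
                 (splitSum-cong n (λ j c _ → *-congˡ (sym (ev₂-k j c))))
                   (conv′-correct (k₁ ∷ []) n)))))) ⟩
          splitSum (λ j c → Φ₁ j cs) n + r ^ n * (σ * ev (conv′ (k₁ ∷ [])) n) ∎
        remove : removeSum (λ c _ → fromℕ c * Φ₀ (n ℕ.+ c)) cs ≈ (r ^ n * v) * m₀ cs
        remove = trans
          (removeSum-cong cs (λ c _ → trans (*-congˡ (*-congˡ (^-homo-* r n c)))
            (solve 4 (λ i v p q → i :* (v :* (p :* q)) := (p :* v) :* (i :* q)) refl (fromℕ c) v
              (r ^ n) (r ^ c))))
          (removeSum-*ˡ (r ^ n * v) _ cs)

      -- The walks in which a merge takes the face `c`. In the term with `κ` the other merge takes a
      -- face cut off later. Otherwise it takes a face d of `cs`; the two orders of merging have the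
      -- sources K (n + c) and K (n + d), together 2 K n + (c + d) W, which gives 2 A₂ + (c + d) B₂
      -- with weight d r^d.
      Ψ : ℕ → ℕ → List ℕ → Carrier
      Ψ n c cs = (fromℕ c * r ^ c) *
        (r ^ n * ((ω * (ω * σ)) * κ n c)
          + (m₀ cs * (r ^ n * ((ω * σ) * A₂ n) + r ^ n * ((ω * σ) * A₂ n))
            + (m₀ cs * fromℕ c + m₁ cs) * (r ^ n * ((ω * σ) * B₂ n))))

      Φ₂ : ℕ → List ℕ → Carrier
      Φ₂ n []       = r ^ n * ((ω * (ω * (ω * σ))) * H₂ n)
      Φ₂ n (c ∷ cs) = Φ₂ n cs + Ψ n c cs

      -- The source for `κ`. Merging with `c` leaves the first part of `Φ₁` at level n + c, which is
      -- the shifted `h₁`. Cutting off a face d leaves the pair of c and d, with 2 A₂ + (c + d) B₂;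
      -- summed with weight d this is linear in c, hence a list of two entries.
      β : List (List A.Carrier)
      β = tails₁ h₁ ⊞₂ (conv′ ((a₂ ⊞ a₂) ∷ b₂ ∷ []) ∷ conv′ (b₂ ∷ []) ∷ [])

      Ψ-source : ℕ → ℕ → List ℕ → Carrier
      Ψ-source n c cs = (fromℕ c * r ^ c) *
        (r ^ n * ((ω * σ) * ev₂ β n c)
          + (m₀ cs * (r ^ n * (σ * K n) + r ^ n * (σ * K n))
            + (m₀ cs * fromℕ c + m₁ cs) * (r ^ n * (σ * W))))

      Ψ-solves : ∀ c cs → Solves (λ n → Ψ n c cs) (λ n → X * Ψ-source n c cs)
      Ψ-solves c cs = solves-cong (λ _ → refl)
        (λ n → trans
          (solve 6 (λ i x a m k l → i :* (x :* a :+ (m :* (x :* k :+ x :* k) :+ l)) := i :*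
            (x :* a :+ (x :* (m :* (k :+ k)) :+ l)))
            refl (fromℕ c * r ^ c) X _ (m₀ cs) _ _ ⟨ trans ⟩
           solve 6 (λ i x a m l b → i :* (x :* a :+ (x :* m :+ l :* (x :* b))) := x :*
             (i :* (a :+ (m :+ l :* b))))
            refl (fromℕ c * r ^ c) X _ _ _ _)
          (*-congˡ (*-congˡ (+-congˡ (+-congˡ (*-congˡ (*-congˡ (*-congˡ (ev-single 𝐖 n)))))))))
        (solves-* (fromℕ c * r ^ c)
          (solves-+ (ev₂-map-solves (ω * σ) β c)
            (solves-+ (solves-* (m₀ cs) (solves-+ (ev-green-solves σ k₁) (ev-green-solves σ k₁)))
              (solves-* (m₀ cs * fromℕ c + m₁ cs) (ev-green-solves σ (𝐖 ∷ []))))))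

      ev₂-β : ∀ n c → ev₂ β n c ≈
        H₁ (n ℕ.+ c) + (ev (conv′ ((a₂ ⊞ a₂) ∷ b₂ ∷ [])) n + fromℕ c * ev (conv′ (b₂ ∷ [])) n)
      ev₂-β n c = trans (ev₂-⊞₂ (tails₁ h₁) (p ∷ q ∷ []) n c)
        (+-cong (ev₂-tails₁ h₁ n c) (ev₂-pair p q n c))
        where
        p = conv′ ((a₂ ⊞ a₂) ∷ b₂ ∷ [])
        q = conv′ (b₂ ∷ [])

      pops merges : ℕ → List ℕ → Carrier
      pops   n cs = splitSum (λ j c → Ψ j c cs) n
      merges n cs = removeSum (λ c r → fromℕ c * Φ₁ (n ℕ.+ c) r) cs

      pops-[] : ∀ n → pops n [] ≈ r ^ n * ((ω * (ω * σ)) * ev (conv′ κ₂) n)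
      pops-[] n = begin
        splitSum (λ j c → Ψ j c []) n
          ≈⟨ splitSum-cong n (λ j c _ → solve 7 (λ i q p t k a b →
               (i :* q) :* (p :* (t :* k) :+ (con (+ 0) :* a :+ (con (+ 0) :* i :+ con (+ 0)) :*
                 b)) := q :* (p :* (t :* (i :* k))))
               refl (fromℕ c) (r ^ c) (r ^ j) (ω * (ω * σ)) (κ j c) _ _) ⟩
        splitSum (λ j c → r ^ c * (r ^ j * ((ω * (ω * σ)) * (fromℕ c * κ j c)))) n
          ≈⟨ splitSum-r^ _ n ⟩
        r ^ n * splitSum (λ j c → (ω * (ω * σ)) * (fromℕ c * κ j c)) n
          ≈⟨ *-congˡ (trans (splitSum-*ˡ (ω * (ω * σ)) _ n) (*-congˡ (conv′-correct κ₂ n))) ⟩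
        r ^ n * ((ω * (ω * σ)) * ev (conv′ κ₂) n) ∎

      -- A further face `c` enters `Ψ j d` only through `m₀` and `m₁`, that is, through the pair
      -- formed by `c` and the cut off face `d`.
      pops-∷ : ∀ n c cs → pops n (c ∷ cs) ≈ pops n cs + (fromℕ c * r ^ c) *
        (r ^ n * ((ω * σ) * (ev (conv′ ((a₂ ⊞ a₂) ∷ b₂ ∷ [])) n + fromℕ c * ev (conv′ (b₂ ∷ []))
          n)))
      pops-∷ n c cs = begin
        splitSum (λ j d → Ψ j d (c ∷ cs)) n
          ≈⟨ splitSum-cong n (λ j d _ → solve 11 (λ i c q₀ q m m′ k₀ p t a b →
               (i :* q) :* (k₀ :+ ((c :* q₀ :+ m) :* (p :* (t :* a) :+ p :* (t :* a))
                 :+ ((c :* q₀ :+ m) :* i :+ (c :* (c :* q₀) :+ m′)) :* (p :* (t :* b)))) :=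
               (i :* q) :* (k₀ :+ (m :* (p :* (t :* a) :+ p :* (t :* a)) :+ (m :* i :+ m′) :*
                 (p :* (t :* b))))
               :+ (c :* q₀) :* (q :* (p :* (t :* (i :* ((a :+ a) :+ i :* b) :+ c :* (i :* b))))))
               refl (fromℕ d) (fromℕ c) (r ^ c) (r ^ d) (m₀ cs) (m₁ cs) _ (r ^ j) (ω * σ) (A₂ j)
                 (B₂ j)) ⟩
        splitSum (λ j d → Ψ j d cs + (fromℕ c * r ^ c) * (r ^ d * (r ^ j * ((ω * σ) *
          (fromℕ d * ((A₂ j + A₂ j) + fromℕ d * B₂ j) + fromℕ c * (fromℕ d * B₂ j)))))) n
          ≈⟨ splitSum-+ _ _ n ⟩
        pops n cs + splitSum (λ j d → (fromℕ c * r ^ c) * (r ^ d * (r ^ j * ((ω * σ) *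
          (fromℕ d * ((A₂ j + A₂ j) + fromℕ d * B₂ j) + fromℕ c * (fromℕ d * B₂ j)))))) n
          ≈⟨ +-congˡ (trans (splitSum-*ˡ (fromℕ c * r ^ c) _ n) (*-congˡ (trans (splitSum-r^ _ n)
               (*-congˡ (trans (splitSum-*ˡ (ω * σ) _ n) (*-congˡ (trans (splitSum-+ _ _ n) (+-cong
                 (trans (splitSum-cong n (λ j d _ → *-congˡ
                   (sym (trans (ev₂-pair (a₂ ⊞ a₂) b₂ j d) (+-congʳ (ev-⊞ a₂ a₂ j))))))
                   (conv′-correct ((a₂ ⊞ a₂) ∷ b₂ ∷ []) n))
                 (trans (splitSum-*ˡ (fromℕ c) _ n) (*-congˡ (trans
                   (splitSum-cong n (λ j d _ → *-congˡ (sym (ev₂-b j d))))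
                   (conv′-correct (b₂ ∷ []) n)))))))))))) ⟩
        pops n cs + (fromℕ c * r ^ c) *
          (r ^ n * ((ω * σ) * (ev (conv′ ((a₂ ⊞ a₂) ∷ b₂ ∷ [])) n + fromℕ c * ev (conv′ (b₂ ∷ []))
            n))) ∎
        where
        ev₂-b : ∀ j d → ev₂ (b₂ ∷ []) j d ≈ B₂ j
        ev₂-b j zero    = refl
        ev₂-b j (suc d) = trans (+-identityʳ _) (ev₂-b j d)

      -- The walk merges either with `c`, at level n + c and with the old faces left, or with an old
      -- face d while `c` stays available. The linearity of `K` makes the two contributions of a
      -- pair symmetric in c and d.
      merges-∷ : ∀ n c cs → merges n (c ∷ cs) ≈ merges n cs + (fromℕ c * r ^ c) *
        (r ^ n * ((ω * σ) * H₁ (n ℕ.+ c))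
          + (m₀ cs * (r ^ n * (σ * K n) + r ^ n * (σ * K n))
            + (m₀ cs * fromℕ c + m₁ cs) * (r ^ n * (σ * W))))
      merges-∷ n c cs = begin
        fromℕ c * Φ₁ (n ℕ.+ c) cs + removeSum (λ d r′ → fromℕ d * Φ₁ (n ℕ.+ d) (c ∷ r′)) cs
          ≈⟨ +-cong first rest ⟩
        (fromℕ c * r ^ c) * (r ^ n * ((ω * σ) * H₁ (n ℕ.+ c)) + m₀ cs *
          (r ^ n * (σ * (K n + fromℕ c * W))))
          + (merges n cs + ((fromℕ c * r ^ c) * (r ^ n * σ)) * (K n * m₀ cs + W * m₁ cs))
          ≈⟨ solve 10 (λ M q h m p t k c w m′ →
                (q :* (h :+ m :* (p :* (t :* (k :+ c :* w))))) :+
                  (M :+ (q :* (p :* t)) :* (k :* m :+ w :* m′)) :=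
                M :+ q :* (h :+ (m :* (p :* (t :* k) :+ p :* (t :* k)) :+ (m :* c :+ m′) :*
                  (p :* (t :* w)))))
                refl _ _ _ _ _ _ _ _ _ _ ⟩
        merges n cs + (fromℕ c * r ^ c) *
          (r ^ n * ((ω * σ) * H₁ (n ℕ.+ c))
            + (m₀ cs * (r ^ n * (σ * K n) + r ^ n * (σ * K n))
              + (m₀ cs * fromℕ c + m₁ cs) * (r ^ n * (σ * W)))) ∎
        where
        first : fromℕ c * Φ₁ (n ℕ.+ c) cs ≈
          (fromℕ c * r ^ c) * (r ^ n * ((ω * σ) * H₁ (n ℕ.+ c)) + m₀ cs *
            (r ^ n * (σ * (K n + fromℕ c * W))))
        first = trans
          (*-congˡ (+-cong (*-congʳ (^-homo-* r n c))
            (*-congˡ (*-cong (^-homo-* r n c) (*-congˡ (K-linear n c))))))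
          (solve 6 (λ i p q h m k → i :* ((p :* q) :* h :+ m :* ((p :* q) :* k)) := (i :* q) :*
            (p :* h :+ m :* (p :* k)))
            refl (fromℕ c) (r ^ n) (r ^ c) _ (m₀ cs) _)
        rest : removeSum (λ d r′ → fromℕ d * Φ₁ (n ℕ.+ d) (c ∷ r′)) cs ≈
          merges n cs + ((fromℕ c * r ^ c) * (r ^ n * σ)) * (K n * m₀ cs + W * m₁ cs)
        rest = begin
          removeSum (λ d r′ → fromℕ d * Φ₁ (n ℕ.+ d) (c ∷ r′)) cs
            ≈⟨ removeSum-cong cs (λ d r′ → trans
                 (solve 6 (λ d h a m p k → d :* (h :+ (a :+ m) :* (p :* k)) := d :*
                   (h :+ m :* (p :* k)) :+ d :* (a :* (p :* k))) refl _ _ _ _ _ _)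
                 (+-congˡ (trans (*-congˡ (*-congˡ (*-cong (^-homo-* r n d)
                   (*-congˡ (K-linear n d)))))
                   (solve 7 (λ d a p q t k w → d :* (a :* ((p :* q) :* (t :* (k :+ d :* w)))) :=
                      (a :* (p :* t)) :* (k :* (d :* q) :+ w :* (d :* (d :* q)))) refl _ _ _ _ _ _
                        _)))) ⟩
          removeSum (λ d r′ → fromℕ d * Φ₁ (n ℕ.+ d) r′
            + ((fromℕ c * r ^ c) * (r ^ n * σ)) * (K n * (fromℕ d * r ^ d) + W *
              (fromℕ d * (fromℕ d * r ^ d)))) cs
            ≈⟨ trans (removeSum-+ _ _ cs) (+-congˡ (trans (removeSum-*ˡ _ _ cs)
                 (*-congˡ (trans (removeSum-+ _ _ cs)
                   (+-cong (removeSum-*ˡ (K n) _ cs) (removeSum-*ˡ W _ cs)))))) ⟩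
          merges n cs + ((fromℕ c * r ^ c) * (r ^ n * σ)) * (K n * m₀ cs + W * m₁ cs) ∎

      Φ₂-solves : ∀ cs → Solves (λ n → Φ₂ n cs) (λ n → X * (pops n cs + merges n cs))
      Φ₂-solves [] = solves-cong (λ _ → refl)
        (λ n → *-congˡ (trans (sym (pops-[] n)) (sym (+-identityʳ _))))
        (ev-green-solves (ω * (ω * σ)) (conv′ κ₂))
      Φ₂-solves (c ∷ cs) = solves-cong (λ _ → refl) source (solves-+ (Φ₂-solves cs) (Ψ-solves c cs))
        where
        source : ∀ n → X * (pops n cs + merges n cs) + X * Ψ-source n c cs ≈ X *
          (pops n (c ∷ cs) + merges n (c ∷ cs))
        source n = begin
          X * (pops n cs + merges n cs) + X * Ψ-source n c cs
            ≈⟨ +-congˡ (*-congˡ (*-congˡ (+-congʳ (*-congˡ (*-congˡ (ev₂-β n c)))))) ⟩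
          X * (pops n cs + merges n cs) + X * ((fromℕ c * r ^ c) *
            (r ^ n * ((ω * σ) * (H₁ (n ℕ.+ c) + conv-part n)) + linear-part n))
            ≈⟨ solve 9 (λ x P M q p t h k l → x :* (P :+ M) :+ x :*
              (q :* (p :* (t :* (h :+ k)) :+ l)) :=
                 x :* ((P :+ q :* (p :* (t :* k))) :+ (M :+ q :* (p :* (t :* h) :+ l)))) refl _ _
                   _ _ _ _ _ _ _ ⟩
          X * ((pops n cs + (fromℕ c * r ^ c) * (r ^ n * ((ω * σ) * conv-part n)))
            + (merges n cs + (fromℕ c * r ^ c) * (r ^ n * ((ω * σ) * H₁ (n ℕ.+ c)) + linear-part
              n)))
            ≈⟨ *-congˡ (+-cong (pops-∷ n c cs) (merges-∷ n c cs)) ⟨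
          X * (pops n (c ∷ cs) + merges n (c ∷ cs)) ∎
          where
          conv-part linear-part : ℕ → Carrier
          conv-part n = ev (conv′ ((a₂ ⊞ a₂) ∷ b₂ ∷ [])) n + fromℕ c * ev (conv′ (b₂ ∷ [])) n
          linear-part n = m₀ cs * (r ^ n * (σ * K n) + r ^ n * (σ * K n))
            + (m₀ cs * fromℕ c + m₁ cs) * (r ^ n * (σ * W))

      Φ₂-equation : Equation Φ₂ Φ₁
      Φ₂-equation cs n = begin
        Φ₂ n cs
          ≈⟨ Φ₂-solves cs n ⟩
        X * (pops n cs + merges n cs) + (Z * Φ₂ (suc n) cs + X * splitSum (λ j _ → Φ₂ j cs) n)
          ≈⟨ solve 6 (λ x p m z f S → x :* (p :+ m) :+ (z :* f :+ x :* S) := z :* f :+ x :*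
            ((S :+ p) :+ m)) refl _ _ _ _ _ _ ⟩
        Z * Φ₂ (suc n) cs + X * ((splitSum (λ j _ → Φ₂ j cs) n + pops n cs) + merges n cs)
          ≈⟨ +-congˡ (*-congˡ (+-congʳ (splitSum-+ _ _ n))) ⟨
        Z * Φ₂ (suc n) cs + X * (splitSum (λ j c → Φ₂ j (c ∷ cs)) n + merges n cs) ∎

      walkSeries : ∀ {x z} → X ≈ x → Z ≈ z → WalkSeries x z
        (s ^ 7 * (W ^ 4 * η (NewtonSeries.start A 𝐔 𝐖)))
      walkSeries X≈x Z≈z = record
        { Φ₀ = Φ₀
        ; Φ₁ = Φ₁
        ; Φ₂ = Φ₂
        ; Φ₀-equation = λ n → trans (Φ₀-solves n) (+-congˡ (+-cong (*-congʳ Z≈z) (*-congʳ X≈x)))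
        ; Φ₁-equation = λ n cs → trans (Φ₁-equation cs n) (+-cong (*-congʳ Z≈z) (*-congʳ X≈x))
        ; Φ₂-equation = λ n cs → trans (Φ₂-equation cs n) (+-cong (*-congʳ Z≈z) (*-congʳ X≈x))
        -- The prefactor consists of three factors `ω` = s² W, one for each Green's function applied
        -- after `K`, and of `σ` = s W.
        ; Φ₂-start = trans (*-congˡ (*-congˡ (ev-zero h₂)))
            (solve 3 (λ s w a → let ω = s :* s :* w in con (+ 1) :* ((ω :* (ω :* (ω :* (s :* w)))) :* a) := s :^ 7 :* (w :^ 4 :* a)) refl s W _)
        }

-- The closed form

module Quotient {c ℓ} (R : CommutativeRing c ℓ) where
  open CommutativeRing R
  open WalkEquations R using (WalkSeries)
  open Algebra.Properties.CommutativeSemiring.Exp commutativeSemiring using (^-congˡ; ^-distrib-*)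
  open Algebra.Properties.CommutativeSemiring.Exp commutativeSemiring public using (_^_)
  open Algebra.Properties.Semiring.Mult semiring using () renaming (_×_ to _·_)

  -- The expressions of the theorem over an arbitrary commutative ring, spelled exactly as there, so
  -- that for power series both versions agree by definition.
  numerator discriminant : Carrier → Carrier → Carrier
  numerator x y = x ^ 6 * y ^ 2 *
    ( x ^ 4 * (8 · y ^ 4 - 4 · y ^ 3 - 15 · y ^ 2 + 10 · y + 1#)
    + x ^ 3 * (- (4 · y ^ 3) + 39 · y ^ 2 - 10 · y - 4 · 1#)
    + x ^ 2 * (- (15 · y ^ 2) - 10 · y + 6 · 1#)
    + x * (10 · y - 4 · 1#)
    + 1#)
  discriminant x y =
    x ^ 2 - 2 · x ^ 2 * y - 2 · x + x ^ 2 * y ^ 2 - 2 · x * y + 1#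

  -- Here `s` is the square root of the denominator polynomial and `T` its inverse; the form 1 - x f
  -- shows that the constant term of `s` is 1.
  record QuotientForm (x y : Carrier) : Set (c ⊔ ℓ) where
    field
      f s T          : Carrier
      s≈1-xf         : s ≈ 1# - x * f
      sT≈1           : s * T ≈ 1#
      discriminant≈  : discriminant x y ≈ s * s
      walkSeries     : WalkSeries x (x * y) (numerator x y * T ^ 11)

    inverse-powers : ∀ n → s ^ n * T ^ n ≈ 1#
    inverse-powers n = trans (sym (^-distrib-* s T n)) (trans (^-congˡ n sT≈1) (1^ n))
      where
      1^ : ∀ n → 1# ^ n ≈ 1#
      1^ zero    = refl
      1^ (suc n) = trans (*-identityˡ _) (1^ n)

    square-power : ∀ {d} → d ≡ discriminant x y → ∀ n → s ^ n * s ^ n ≈ d ^ n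
    square-power ≡.refl n = trans (sym (^-distrib-* s s n)) (sym (^-congˡ n discriminant≈))

module ClosedForm {c ℓ} (R : CommutativeRing c ℓ) where
  open CommutativeRing R renaming (zero to *-zero)
  open import Data.Integer using (+_; -[1+_])
  open IntegerCoefficients R
  open Algebra.Properties.Semiring.Exp semiring using (_^_; ^-cong)
  open Algebra.Properties.Semiring.Mult semiring using () renaming (_×_ to _·_)
  open WalkEquations R using (WalkSeries; start-resp)
  open Quotient R using (numerator; discriminant)
  open import Relation.Binary.Reasoning.Setoid setoid

  -- The ring ℤ[U,W] in normal form: `start` can be computed in it, and equality is decidable.
  polynomials : RawRing _ _
  polynomials = record
    { Carrier = Normal 2 ; _≈_ = _≡_ ; _+_ = _+N_ ; _*_ = _*N_ ; -_ = -N_ ; 0# = 0N ; 1# = 1N }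

  -- The polynomial p(x,y) of the theorem in terms of x and z = x y, homogenized
  -- by t; likewise δ̂ for D.

  q̂ : ∀ {n} (x z t : Polynomial n) → Polynomial n
  q̂ x z t =
       ((((con (+ 8) :* z :^ 4 :- con (+ 4) :* (x :* z :^ 3)) :- con (+ 15) :* (x :^ 2 :* z :^ 2))
         :+ con (+ 10) :* (x :^ 3 :* z)) :+ x :^ 4)
    :+ (((con -[1+ 3 ] :* z :^ 3 :+ con (+ 39) :* (x :* z :^ 2)) :- con (+ 10) :* (x :^ 2 :* z))
      :- con (+ 4) :* x :^ 3) :* t
    :+ ((con -[1+ 14 ] :* z :^ 2 :- con (+ 10) :* (x :* z)) :+ con (+ 6) :* x :^ 2) :* t :^ 2
    :+ (con (+ 10) :* z :- con (+ 4) :* x) :* t :^ 3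
    :+ t :^ 4

  u̇ ẇ ṫ x̂ ẑ : Polynomial 2
  u̇ = var zero
  ẇ = var (suc zero)
  ṫ = (con (+ 1) :+ u̇) :+ ẇ
  x̂ = ẇ :* (con (+ 1) :+ ẇ)
  ẑ = u̇ :* (con (+ 1) :+ u̇)

  startClosed : Polynomial 2
  startClosed = (con (+ 1) :+ ẇ) :^ 4 :* (ẑ :^ 2 :* q̂ x̂ ẑ (ṫ :^ 2))

  -- The computation on which the closed form rests. The theorem's numerator is x⁴ z² q(x,z,1) with
  -- x = x̂/T² and z = ẑ/T², so T¹¹ times it equals s⁹ x̂⁴ ẑ² q(x̂,ẑ,T²), while the solution at 0 is
  -- s⁷ W⁴ `start`. Comparing powers of s gives the factor T² on the left.
  start-closed : NewtonSeries.start polynomials (normalise u̇) (normalise ẇ) *N normalise (ṫ :^ 2)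
    ≈N normalise startClosed
  start-closed = from-just
    (NewtonSeries.start polynomials (normalise u̇) (normalise ẇ) *N normalise (ṫ :^ 2) ≟N
      normalise startClosed)

  ⟦⟧-cong : ∀ {n} (p : Polynomial n) {ρ ρ′} → (∀ i → lookup ρ i ≈ lookup ρ′ i) → ⟦ p ⟧ ρ ≈ ⟦ p ⟧ ρ′
  ⟦⟧-cong (op [+] p₁ p₂) ρ≈ρ′ = +-cong (⟦⟧-cong p₁ ρ≈ρ′) (⟦⟧-cong p₂ ρ≈ρ′)
  ⟦⟧-cong (op [*] p₁ p₂) ρ≈ρ′ = *-cong (⟦⟧-cong p₁ ρ≈ρ′) (⟦⟧-cong p₂ ρ≈ρ′)
  ⟦⟧-cong (con c)    ρ≈ρ′ = refl
  ⟦⟧-cong (var i)    ρ≈ρ′ = ρ≈ρ′ i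
  ⟦⟧-cong (p :^ n)   ρ≈ρ′ = ^-cong (⟦⟧-cong p ρ≈ρ′) (≡.refl {x = n})
  ⟦⟧-cong (:- p)     ρ≈ρ′ = -‿cong (⟦⟧-cong p ρ≈ρ′)

  pattern v₀ = var zero
  pattern v₁ = var (suc zero)
  pattern v₂ = var (suc (suc zero))

  q : Carrier → Carrier → Carrier → Carrier
  q x z t = ⟦ q̂ v₀ v₁ v₂ ⟧ (x ∷ z ∷ t ∷ [])

  q-cong : ∀ {x x′ z z′ t t′} → x ≈ x′ → z ≈ z′ → t ≈ t′ → q x z t ≈ q x′ z′ t′
  q-cong {x} {x′} {z} {z′} {t} {t′} x≈ z≈ t≈ = ⟦⟧-cong (q̂ v₀ v₁ v₂) {x ∷ z ∷ t ∷ []}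
    {x′ ∷ z′ ∷ t′ ∷ []} λ
    { zero → x≈ ; (suc zero) → z≈ ; (suc (suc zero)) → t≈ }

  q-scale : ∀ x z t → q (x * t) (z * t) t ≈ q x z 1# * t ^ 4
  q-scale = solve 3 (λ x z t → q̂ (x :* t) (z :* t) t := q̂ x z (con (+ 1)) :* t :^ 4) refl

  δ̂ : ∀ {n} (x z t : Polynomial n) → Polynomial n
  δ̂ x z t = ((x :^ 2 :- con (+ 2) :* (x :* z)) :+ z :^ 2) :- con (+ 2) :* ((x :+ z) :* t) :+ t :^ 2

  δ : Carrier → Carrier → Carrier → Carrier
  δ x z t = ⟦ δ̂ v₀ v₁ v₂ ⟧ (x ∷ z ∷ t ∷ [])

  δ-cong : ∀ {x x′ z z′ t t′} → x ≈ x′ → z ≈ z′ → t ≈ t′ → δ x z t ≈ δ x′ z′ t′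
  δ-cong {x} {x′} {z} {z′} {t} {t′} x≈ z≈ t≈ = ⟦⟧-cong (δ̂ v₀ v₁ v₂) {x ∷ z ∷ t ∷ []}
    {x′ ∷ z′ ∷ t′ ∷ []} λ
    { zero → x≈ ; (suc zero) → z≈ ; (suc (suc zero)) → t≈ }

  numerator-q : ∀ x y → numerator x y ≈ x ^ 4 * ((x * y) ^ 2 * q x (x * y) 1#)
  numerator-q = solve 2 (λ x y →
    x :^ 6 :* y :^ 2 :*
    ( x :^ 4 :* (8 :× (y :^ 4) :- 4 :× (y :^ 3) :- 15 :× (y :^ 2) :+ 10 :× y :+ con (+ 1))
    :+ x :^ 3 :* (:- (4 :× (y :^ 3)) :+ 39 :× (y :^ 2) :- 10 :× y :- 4 :× con (+ 1))
    :+ x :^ 2 :* (:- (15 :× (y :^ 2)) :- 10 :× y :+ 6 :× con (+ 1))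
    :+ x :* (10 :× y :- 4 :× con (+ 1))
    :+ con (+ 1))
    := x :^ 4 :* ((x :* y) :^ 2 :* q̂ x (x :* y) (con (+ 1)))) refl

  discriminant-δ : ∀ x y → discriminant x y ≈ δ x (x * y) 1#
  discriminant-δ = solve 2 (λ x y →
    x :^ 2 :- 2 :× (x :^ 2) :* y :- 2 :× x :+ x :^ 2 :* y :^ 2 :- 2 :× x :* y :+ con (+ 1)
    := δ̂ x (x :* y) (con (+ 1))) refl

  module _ (U W : Carrier) where
    private
      ρ : Vec Carrier 2
      ρ = U ∷ W ∷ []
      T : Carrier
      T = (1# + U) + W

    -- Abstract, lest Agda evaluate NewtonSeries.start when it compares types.

    abstract
      value : Normal 2 → Carrier
      value p = ⟦ p ⟧N ρ

      value-+ : ∀ p p′ → value (p +N p′) ≈ value p + value p′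
      value-+ p p′ = +N-homo p p′ ρ

      value-* : ∀ p p′ → value (p *N p′) ≈ value p * value p′
      value-* p p′ = *N-homo p p′ ρ

      value-0 : value 0N ≈ 0#
      value-0 = 0N-homo {2} ρ

      value-1 : value 1N ≈ 1#
      value-1 = 1N-homo {2} ρ

      value-normalise : ∀ p → value (normalise p) ≈ ⟦ p ⟧ ρ
      value-normalise p = correct p ρ

      value-≈N : ∀ p p′ → p ≈N p′ → value p ≈ value p′
      value-≈N p p′ p≈p′ = ⟦ p≈p′ ⟧N-cong ρ

    value-start : ∀ h → h *N normalise (ṫ :^ 2) ≈N normalise startClosed → value h * T ^ 2 ≈
      (1# + W) ^ 4 * ((U * (1# + U)) ^ 2 * q (W * (1# + W)) (U * (1# + U)) (T ^ 2))
    value-start h hT²≈ = begin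
      value h * T ^ 2                       ≈⟨ *-congˡ (value-normalise (ṫ :^ 2)) ⟨
      value h * value (normalise (ṫ :^ 2))  ≈⟨ value-* h (normalise (ṫ :^ 2)) ⟨
      value (h *N normalise (ṫ :^ 2))       ≈⟨ value-≈N (h *N normalise (ṫ :^ 2))
        (normalise startClosed) hT²≈ ⟩
      value (normalise startClosed)                ≈⟨ value-normalise startClosed ⟩
      ⟦ startClosed ⟧ ρ                            ∎

  module Specialization (x y s U W r v : Carrier) (sT≈1 : s * ((1# + U) + W) ≈ 1#)
    (r-inverse : r * (s * (1# + U)) ≈ 1#) (v-inverse : v * (s * (1# + W)) ≈ 1#)
    (x≈ : x ≈ (s * s) * (W * (1# + W))) (xy≈ : x * y ≈ (s * s) * (U * (1# + U))) where

    private
      T : Carrier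
      T = (1# + U) + W
      η : Normal 2 → Carrier
      η = value U W

    x̂′ ẑ′ : Carrier
    x̂′ = W * (1# + W)
    ẑ′ = U * (1# + U)

    *sT : ∀ t → t * (s * T) ≈ t
    *sT t = trans (*-congˡ sT≈1) (*-identityʳ t)

    scale : ∀ t → (s * s * t) * T ^ 2 ≈ t
    scale t = trans
      (solve 3 (λ s t T → (s :* s :* t) :* T :^ 2 := (t :* (s :* T)) :* (s :* T)) refl s t T)
      (trans (*sT _) (*sT t))

    -- With x = w (1 - u) and z = u (1 - w) one has x - z = w - u and x + z = u + w - 2 u w, so (x -
    -- z)² - 2 (x + z) + 1 = (1 - u - w)². Factors `k`, equal to 1, balance the powers of `s` for
    -- the solver.
    discriminant≈s² : discriminant x y ≈ s * s
    discriminant≈s² = begin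
      discriminant x y
        ≈⟨ discriminant-δ x y ⟩
      δ x (x * y) 1#
        ≈⟨ δ-cong x≈ xy≈ refl ⟩
      δ X Z 1#
        ≈⟨ trans (*sT _) (trans (*sT _) (trans (*sT _) (*sT _))) ⟨
      δ X Z 1# * k * k * k * k
        ≈⟨ solve 4 (λ x z s t → let k = s :* t in
             δ̂ x z (con (+ 1)) :* k :* k :* k :* k := s :^ 4 :* δ̂ (x :* t :^ 2) (z :* t :^ 2)
               (t :^ 2)) refl X Z s T ⟩
      s ^ 4 * δ (X * T ^ 2) (Z * T ^ 2) (T ^ 2)
        ≈⟨ *-congˡ (δ-cong (scale x̂′) (scale ẑ′) refl) ⟩
      s ^ 4 * δ x̂′ ẑ′ (T ^ 2)
        ≈⟨ solve 3 (λ s u w → let t = (con (+ 1) :+ u) :+ w; k = s :* t in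
             s :^ 4 :* δ̂ (w :* (con (+ 1) :+ w)) (u :* (con (+ 1) :+ u)) (t :^ 2) := s :* s :* k
               :* k) refl s U W ⟩
      s * s * k * k
        ≈⟨ trans (*sT _) (*sT _) ⟩
      s * s ∎
      where
      k = s * T
      X = s * s * x̂′
      Z = s * s * ẑ′

    -- The origin of the exponent 11: two factors `k` raise s⁷ to s⁹ and supply the T² of the
    -- hypothesis; three more raise it to s¹², which `X ^ 4` and `Z ^ 2` absorb, and leave T³;
    -- undoing the scaling by T² in `q`, homogeneous of degree 4, adds T⁸.
    numerator≈ : ∀ a → a * T ^ 2 ≈ (1# + W) ^ 4 * (ẑ′ ^ 2 * q x̂′ ẑ′ (T ^ 2)) →
      s ^ 7 * (W ^ 4 * a) ≈ numerator x y * T ^ 11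
    numerator≈ a aT²≈ = begin
      s ^ 7 * (W ^ 4 * a)
        ≈⟨ trans (*sT _) (*sT _) ⟨
      s ^ 7 * (W ^ 4 * a) * k * k
        ≈⟨ solve 4 (λ s w a t → let k = s :* t in s :^ 7 :* (w :^ 4 :* a) :* k :* k := s :^ 9 :* (w :^ 4 :* (a :* t :^ 2))) refl s W a T ⟩
      s ^ 9 * (W ^ 4 * (a * T ^ 2))
        ≈⟨ *-congˡ (*-congˡ aT²≈) ⟩
      s ^ 9 * (W ^ 4 * ((1# + W) ^ 4 * (ẑ′ ^ 2 * q x̂′ ẑ′ (T ^ 2))))
        ≈⟨ trans (*sT _) (trans (*sT _) (*sT _)) ⟨
      s ^ 9 * (W ^ 4 * ((1# + W) ^ 4 * (ẑ′ ^ 2 * q x̂′ ẑ′ (T ^ 2)))) * k * k * k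
        ≈⟨ solve 5 (λ s w z t q → let k = s :* t; o = con (+ 1) :+ w in
             s :^ 9 :* (w :^ 4 :* (o :^ 4 :* (z :^ 2 :* q))) :* k :* k :* k :=
             (s :* s :* (w :* o)) :^ 4 :* ((s :* s :* z) :^ 2 :* q) :* t :^ 3) refl s W ẑ′ T _ ⟩
      X ^ 4 * (Z ^ 2 * q x̂′ ẑ′ (T ^ 2)) * T ^ 3
        ≈⟨ *-congʳ (*-congˡ (*-congˡ (q-cong (scale x̂′) (scale ẑ′) refl))) ⟨
      X ^ 4 * (Z ^ 2 * q (X * T ^ 2) (Z * T ^ 2) (T ^ 2)) * T ^ 3
        ≈⟨ *-congʳ (*-congˡ (*-congˡ (q-scale X Z (T ^ 2)))) ⟩
      X ^ 4 * (Z ^ 2 * (q X Z 1# * (T ^ 2) ^ 4)) * T ^ 3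
        ≈⟨ solve 4 (λ x z q t → x :* (z :* (q :* (t :^ 2) :^ 4)) :* t :^ 3 := x :* (z :* q) :* t
          :^ 11) refl (X ^ 4) (Z ^ 2) (q X Z 1#) T ⟩
      X ^ 4 * (Z ^ 2 * q X Z 1#) * T ^ 11
        ≈⟨ *-congʳ (*-cong (^-cong x≈ (≡.refl {x = 4}))
          (*-cong (^-cong xy≈ (≡.refl {x = 2})) (q-cong x≈ xy≈ refl))) ⟨
      x ^ 4 * ((x * y) ^ 2 * q x (x * y) 1#) * T ^ 11
        ≈⟨ *-congʳ (numerator-q x y) ⟨
      numerator x y * T ^ 11 ∎
      where
      k = s * T
      X = s * s * x̂′
      Z = s * s * ẑ′

    private
      U≈ : η (normalise u̇) ≈ U
      U≈ = value-normalise U W u̇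
      W≈ : η (normalise ẇ) ≈ W
      W≈ = value-normalise U W ẇ

      conclude : ∀ w a → w ≈ W → a * T ^ 2 ≈ (1# + W) ^ 4 * (ẑ′ ^ 2 * q x̂′ ẑ′ (T ^ 2)) →
        WalkSeries x (x * y) (s ^ 7 * (w ^ 4 * a)) → WalkSeries x (x * y) (numerator x y * T ^ 11)
      conclude w a w≈W aT²≈ = start-resp (trans (*-congˡ (*-congʳ (^-cong w≈W (≡.refl {x = 4}))))
        (numerator≈ a aT²≈))

    walkSeries : WalkSeries x (x * y) (numerator x y * T ^ 11)
    walkSeries = conclude (η (normalise ẇ)) (η (NewtonSeries.start polynomials (normalise u̇)
      (normalise ẇ))) W≈
      (value-start U W (NewtonSeries.start polynomials (normalise u̇) (normalise ẇ)) start-closed)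
      (NewtonSolutions.Evaluation.Solutions.walkSeries polynomials R (normalise u̇) (normalise ẇ)
        η (value-+ U W) (value-* U W) (value-0 U W) (value-1 U W) s r v
        (trans (*-congˡ (+-cong (+-congˡ U≈) W≈)) sT≈1)
        (trans (*-congˡ (*-congˡ (+-congˡ U≈))) r-inverse)
        (trans (*-congˡ (*-congˡ (+-congˡ W≈))) v-inverse)
        (trans (*-congˡ (*-cong W≈ (+-congˡ W≈))) (sym x≈))
        (trans (*-congˡ (*-cong U≈ (+-congˡ U≈))) (sym xy≈)))

-- The parameters u and w

module Parametrization {c ℓ} (R : CommutativeRing c ℓ) where
  open CommutativeRing R renaming (zero to *-zero)
  open import Data.Integer using (+_)
  open IntegerCoefficients R
  open Quotient R using (QuotientForm)
  open import Relation.Binary.Reasoning.Setoid setoid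

  -- u = x η and w = x ω satisfy u = x y + u w and w = x + u w.

  module Solution (x y N T r v : Carrier)
    (N≈ : N ≈ (1# + x * N) * (y + x * N))
    (T≈ : T ≈ 1# + x * (((y + x * N) + (1# + x * N)) * T))
    (r≈ : r ≈ 1# + x * ((1# + x * N) * r)) (v≈ : v ≈ 1# + x * ((y + x * N) * v)) where

    private
      ω η : Carrier
      ω = 1# + x * N
      η = y + x * N

    u w s U W : Carrier
    u = x * η
    w = x * ω
    s = 1# - (u + w)
    U = u * T
    W = w * T

    private
      inverse : ∀ {f g} → g ≈ 1# + x * (f * g) → (1# - x * f) * g ≈ 1#
      inverse {f} {g} g≈ = begin
        (1# - x * f) * g                     ≈⟨ solve 3
          (λ x f g → (con (+ 1) :- x :* f) :* g := g :- x :* (f :* g)) refl x f g ⟩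
        g - x * (f * g)                      ≈⟨ +-congʳ g≈ ⟩
        1# + x * (f * g) - x * (f * g)       ≈⟨ solve 1 (λ a → con (+ 1) :+ a :- a := con (+ 1))
          refl _ ⟩
        1#                                   ∎

      s*T≈1 : s * T ≈ 1#
      s*T≈1 = trans (*-congʳ (+-congˡ (-‿cong (sym (distribˡ x η ω))))) (inverse T≈)

    sT≈1 : s * ((1# + U) + W) ≈ 1#
    sT≈1 = trans (*-congˡ (trans
      (solve 4 (λ x e o t → con (+ 1) :+ (x :* e) :* t :+ (x :* o) :* t := con (+ 1) :+ x :*
        ((e :+ o) :* t)) refl x η ω T)
      (sym T≈))) s*T≈1

    private
      collapse : ∀ a → a * (s * T) ≈ a
      collapse a = trans (*-congˡ s*T≈1) (*-identityʳ a)

    r-inverse : r * (s * (1# + U)) ≈ 1#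
    r-inverse = begin
      r * (s * (1# + u * T))    ≈⟨ solve 4 (λ r s u t → r :* (s :* (con (+ 1) :+ u :* t)) := r :*
        (s :+ u :* (s :* t))) refl r s u T ⟩
      r * (s + u * (s * T))     ≈⟨ *-congˡ (+-congˡ (collapse u)) ⟩
      r * (s + u)               ≈⟨ solve 3 (λ r u w → r :* ((con (+ 1) :- (u :+ w)) :+ u) :=
        (con (+ 1) :- w) :* r) refl r u w ⟩
      (1# - w) * r              ≈⟨ inverse r≈ ⟩
      1#                        ∎

    v-inverse : v * (s * (1# + W)) ≈ 1#
    v-inverse = begin
      v * (s * (1# + w * T))    ≈⟨ solve 4 (λ v s w t → v :* (s :* (con (+ 1) :+ w :* t)) := v :*
        (s :+ w :* (s :* t))) refl v s w T ⟩
      v * (s + w * (s * T))     ≈⟨ *-congˡ (+-congˡ (collapse w)) ⟩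
      v * (s + w)               ≈⟨ solve 3 (λ v u w → v :* ((con (+ 1) :- (u :+ w)) :+ w) :=
        (con (+ 1) :- u) :* v) refl v u w ⟩
      (1# - u) * v              ≈⟨ inverse v≈ ⟩
      1#                        ∎

    private
      expand : ∀ a → (s * s) * ((a * T) * (1# + a * T)) ≈ a * (s + a)
      expand a = begin
        (s * s) * ((a * T) * (1# + a * T))       ≈⟨ solve 3
          (λ s a t → (s :* s) :* ((a :* t) :* (con (+ 1) :+ a :* t)) := (a :* (s :* t)) :*
          (s :+ a :* (s :* t))) refl s a T ⟩
        (a * (s * T)) * (s + a * (s * T))        ≈⟨ *-cong (collapse a) (+-congˡ (collapse a)) ⟩
        a * (s + a)                              ∎

    x≈ : x ≈ (s * s) * (W * (1# + W))
    x≈ = sym (begin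
      (s * s) * (W * (1# + W))        ≈⟨ expand w ⟩
      w * (s + w)                     ≈⟨ solve 3 (λ x o e → (x :* o) :*
        ((con (+ 1) :- (x :* e :+ x :* o)) :+ x :* o) := x :* (o :- x :* (o :* e))) refl x ω η ⟩
      x * (ω - x * (ω * η))           ≈⟨ *-congˡ (+-congˡ (-‿cong (*-congˡ (sym N≈)))) ⟩
      x * (ω - x * N)                 ≈⟨ solve 2 (λ x n → x :* (con (+ 1) :+ x :* n :- x :* n) :=
        x) refl x N ⟩
      x                               ∎)

    xy≈ : x * y ≈ (s * s) * (U * (1# + U))
    xy≈ = sym (begin
      (s * s) * (U * (1# + U))        ≈⟨ expand u ⟩
      u * (s + u)                     ≈⟨ solve 3 (λ x o e → (x :* e) :*
        ((con (+ 1) :- (x :* e :+ x :* o)) :+ x :* e) := x :* (e :- x :* (o :* e))) refl x ω η ⟩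
      x * (η - x * (ω * η))           ≈⟨ *-congˡ (+-congˡ (-‿cong (*-congˡ (sym N≈)))) ⟩
      x * (η - x * N)                 ≈⟨ solve 3 (λ x y n → x :* (y :+ x :* n :- x :* n) := x :*
        y) refl x y N ⟩
      x * y                           ∎)

    quotientForm : QuotientForm x y
    quotientForm = record
      { f = η + ω
      ; s = s
      ; T = (1# + U) + W
      ; s≈1-xf = +-congˡ (-‿cong (sym (distribˡ x η ω)))
      ; sT≈1 = sT≈1
      ; discriminant≈ = ClosedForm.Specialization.discriminant≈s² R x y s U W r v sT≈1 r-inverse
        v-inverse x≈ xy≈
      ; walkSeries = ClosedForm.Specialization.walkSeries R x y s U W r v sT≈1 r-inverse v-inverse
        x≈ xy≈
      }

-- Walks and their generating functions

private module Σℕ = Splittings ℕ.+-0-commutativeMonoid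

-- The number of walks of n steps from (l; cs) with g merges and k pushes.  A
-- merge with a face can take place at each of its c maxima.

mutual
  walkCount : (n g k : ℕ) → ℕ → List ℕ → ℕ
  walkCount zero    zero    zero    l cs = 1
  walkCount zero    zero    (suc _) l cs = 0
  walkCount zero    (suc _) _       l cs = 0
  walkCount (suc n) g       k       l cs = pushes n g k l cs ℕ.+
    (Σℕ.splitSum (λ j c → walkCount n g k j (c ∷ cs)) l ℕ.+ merges n g k l cs)

  pushes : (n g k : ℕ) → ℕ → List ℕ → ℕ
  pushes n g zero    l cs = 0
  pushes n g (suc k) l cs = walkCount n g k (suc l) cs

  merges : (n g k : ℕ) → ℕ → List ℕ → ℕ
  merges n zero    k l cs = 0
  merges n (suc g) k l cs = Σℕ.removeSum (λ c cs′ → c ℕ.* walkCount n g k (l ℕ.+ c) cs′) cs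

-- Numbers of walks as coefficients of a solution

module Coefficients {c ℓ} (R : CommutativeRing c ℓ) where
  open CommutativeRing R renaming (zero to *-zero)
  open import Data.Integer using (+_)
  open WalkEquations R using (WalkSeries)
  open Quotient R using (QuotientForm; numerator; _^_)

  module Extraction (x y : Carrier)
    (coeff : Carrier → ℕ → ℕ → ℤ)
    (coeff-cong : ∀ {F G} → F ≈ G → ∀ n k → coeff F n k ≡ coeff G n k)
    (coeff-+ : ∀ F G n k → coeff (F + G) n k ≡ coeff F n k ℤ.+ coeff G n k)
    (coeff-0 : ∀ n k → coeff 0# n k ≡ 0ℤ)
    (coeff-1 : ∀ n k → coeff 1# n k ≡ monomial 0 0 n k)
    (x*-zero : ∀ F k → coeff (x * F) 0 k ≡ 0ℤ) (x*-suc : ∀ F n k → coeff (x * F) (suc n) k ≡ coeff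
      F n k)
    (y*-zero : ∀ F n → coeff (y * F) n 0 ≡ 0ℤ) (y*-suc : ∀ F n k → coeff (y * F) n (suc k) ≡ coeff
      F n k) where

    open Splittings +-commutativeMonoid
    open Algebra.Properties.Semiring.Mult semiring using (×-assoc-*; ×-congʳ) renaming (_×_ to _·_)

    +splitSum : ∀ {f F} n k → (∀ j c → + f j c ≡ coeff (F j c) n k) → ∀ l → + Σℕ.splitSum f l ≡
      coeff (splitSum F l) n k
    +splitSum n k eq zero    = ≡.sym (coeff-0 n k)
    +splitSum n k eq (suc l) = ≡.trans (cong₂ ℤ._+_ (eq 1 l) (+splitSum n k (eq ∘ suc) l))
      (≡.sym (coeff-+ _ _ n k))

    +removeSum : ∀ {f F} n k → (∀ c cs → + f c cs ≡ coeff (F c cs) n k) → ∀ cs → + Σℕ.removeSum f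
      cs ≡ coeff (removeSum F cs) n k
    +removeSum n k eq []       = ≡.sym (coeff-0 n k)
    +removeSum n k eq (c ∷ cs) = ≡.trans (cong₂ ℤ._+_ (eq c cs)
      (+removeSum n k (λ c′ → eq c′ ∘ (c ∷_)) cs)) (≡.sym (coeff-+ _ _ n k))

    fromℕ-* : ∀ c F n k → coeff ((c · 1#) * F) n k ≡ + c ℤ.* coeff F n k
    fromℕ-* c F n k = ≡.trans (coeff-cong (trans (×-assoc-* c 1# F) (×-congʳ c (*-identityˡ F))) n
      k) (go c)
      where
      go : ∀ c → coeff (c · F) n k ≡ + c ℤ.* coeff F n k
      go zero    = ≡.trans (coeff-0 n k) (≡.sym (ℤ.*-zeroˡ (coeff F n k)))
      go (suc c) = ≡.trans (coeff-+ F (c · F) n k) (≡.trans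
        (cong (λ t → coeff F n k ℤ.+ t) (go c)) (≡.sym (ℤ.suc-* (+ c) (coeff F n k))))

    xy*-suc-zero : ∀ F n → coeff ((x * y) * F) (suc n) 0 ≡ 0ℤ
    xy*-suc-zero F n = ≡.trans (coeff-cong (*-assoc x y F) (suc n) 0)
      (≡.trans (x*-suc (y * F) n 0) (y*-zero F n))

    xy*-suc-suc : ∀ F n k → coeff ((x * y) * F) (suc n) (suc k) ≡ coeff F n k
    xy*-suc-suc F n k = ≡.trans (coeff-cong (*-assoc x y F) (suc n) (suc k))
      (≡.trans (x*-suc (y * F) n (suc k)) (y*-suc F n k))

    xy*-zero : ∀ F k → coeff ((x * y) * F) 0 k ≡ 0ℤ
    xy*-zero F k = ≡.trans (coeff-cong (*-assoc x y F) 0 k) (x*-zero (y * F) k)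

    module _ {start} (F : WalkSeries x (x * y) start) where
      open WalkSeries F

      -- On the right of the equation every unknown series has a factor x, so its coefficients at
      -- smaller exponents of x determine those on the left: induction on `n`. With no merge to come
      -- the other faces are inert, so `cs` is arbitrary.
      walkCount-Φ₀ : ∀ n k l cs → + walkCount n 0 k l cs ≡ coeff (Φ₀ l) n k
      walkCount-Φ₀ n k l cs = ≡.sym (≡.trans (coeff-cong (Φ₀-equation l) n k)
        (≡.trans (coeff-+ _ _ n k)
        (≡.trans (cong₂ ℤ._+_ (coeff-1 n k) (coeff-+ _ _ n k)) (go n k))))
        where
        push : ∀ n k → coeff ((x * y) * Φ₀ (suc l)) (suc n) k ≡ + pushes n 0 k l cs
        push n zero    = xy*-suc-zero (Φ₀ (suc l)) n
        push n (suc k) = ≡.trans (xy*-suc-suc (Φ₀ (suc l)) n k)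
          (≡.sym (walkCount-Φ₀ n k (suc l) cs))
        go : ∀ n k → monomial 0 0 n k ℤ.+ (coeff ((x * y) * Φ₀ (suc l)) n k ℤ.+ coeff
          (x * splitSum (λ j _ → Φ₀ j) l) n k)
          ≡ + walkCount n 0 k l cs
        go zero    zero    = cong₂ (λ a b → 1ℤ ℤ.+ (a ℤ.+ b)) (xy*-zero _ _) (x*-zero _ _)
        go zero    (suc k) = cong₂ (λ a b → 0ℤ ℤ.+ (a ℤ.+ b)) (xy*-zero _ _) (x*-zero _ _)
        go (suc n) k       = ≡.trans (ℤ.+-identityˡ _)
          (cong₂ ℤ._+_ (push n k) (≡.trans (x*-suc _ n k)
          (≡.trans (≡.sym (+splitSum n k (λ j c → walkCount-Φ₀ n k j (c ∷ cs)) l))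
            (cong +_ (≡.sym (ℕ.+-identityʳ _))))))

      private
        -- The same induction for one merge more, with the series for `g` merges given; it is
        -- applied twice, from `Φ₀` to `Φ₁` and from `Φ₁` to `Φ₂`.
        coefficient-equation : ∀ {g} (M Φ : ℕ → List ℕ → Carrier) →
          (∀ l cs → Φ l cs ≈ (x * y) * Φ (suc l) cs +
            x * (splitSum (λ j c → Φ j (c ∷ cs)) l + removeSum
              (λ c cs′ → (c · 1#) * M (l ℕ.+ c) cs′) cs)) →
          (∀ n k l cs → + walkCount n g k l cs ≡ coeff (M l cs) n k) →
          ∀ n k l cs → + walkCount n (suc g) k l cs ≡ coeff (Φ l cs) n k
        coefficient-equation {g} M Φ equation walkCount-M n k l cs =
          ≡.sym (≡.trans (coeff-cong (equation l cs) n k) (≡.trans (coeff-+ _ _ n k) (go n k)))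
          where
          tail : Carrier
          tail = splitSum (λ j c → Φ j (c ∷ cs)) l + removeSum
            (λ c cs′ → (c · 1#) * M (l ℕ.+ c) cs′) cs
          push : ∀ n k → coeff ((x * y) * Φ (suc l) cs) (suc n) k ≡ + pushes n (suc g) k l cs
          push n zero    = xy*-suc-zero (Φ (suc l) cs) n
          push n (suc k) = ≡.trans (xy*-suc-suc (Φ (suc l) cs) n k)
            (≡.sym (coefficient-equation M Φ equation walkCount-M n k (suc l) cs))
          go : ∀ n k → coeff ((x * y) * Φ (suc l) cs) n k ℤ.+ coeff (x * tail) n k ≡ + walkCount n
            (suc g) k l cs
          go zero    k = cong₂ ℤ._+_ (xy*-zero (Φ (suc l) cs) k) (x*-zero tail k)
          go (suc n) k = cong₂ ℤ._+_ (push n k) (≡.trans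
            (≡.trans (x*-suc tail n k) (coeff-+ _ _ n k))
            (≡.sym (cong₂ ℤ._+_
              (+splitSum n k (λ j c → coefficient-equation M Φ equation walkCount-M n k j
                (c ∷ cs)) l)
              (+removeSum n k (λ c cs′ → ≡.trans (ℤ.pos-* c _)
                (≡.trans (cong (λ t → + c ℤ.* t) (walkCount-M n k (l ℕ.+ c) cs′))
                (≡.sym (fromℕ-* c (M (l ℕ.+ c) cs′) n k)))) cs))))

      walkCount-Φ₂ : ∀ n k l cs → + walkCount n 2 k l cs ≡ coeff (Φ₂ l cs) n k
      walkCount-Φ₂ = coefficient-equation Φ₁ Φ₂ Φ₂-equation
        (coefficient-equation (λ l _ → Φ₀ l) Φ₁ Φ₁-equation walkCount-Φ₀)

    walkCount-quotient : (Q : QuotientForm x y) → let open QuotientForm Q in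
      ∀ {m t e} → e ≡ 11 → numerator x y ≡ m → t ≡ T ^ e → ∀ n k → + walkCount n 2 k 0 [] ≡ coeff
        (m * t) n k
    walkCount-quotient Q ≡.refl ≡.refl ≡.refl n k = ≡.trans (walkCount-Φ₂ walkSeries n k 0 [])
      (coeff-cong (WalkSeries.Φ₂-start walkSeries) n k)
      where open QuotientForm Q

-- Power series

module PowerSeries {c ℓ} (A : CommutativeRing c ℓ) where
  open CommutativeRing A renaming (zero to *-zero)
  open Algebra.Properties.CommutativeSemigroup +-commutativeSemigroup using (interchange; x∙yz≈y∙xz)
  open import Relation.Binary.Reasoning.Setoid setoid
  open import Algebra.Properties.Semiring.Sum semiring using (sum; sum-cong-≋)

  PS : Set c
  PS = ℕ → Carrier

  infixl 7 _⊛_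
  _⊛_ : PS → PS → PS
  (F ⊛ G) n = sum {suc n} λ i → F (toℕ i) * G (n ∸ toℕ i)

  const : Carrier → PS
  const x zero    = x
  const x (suc _) = 0#

  -- (F ⊛ G) (suc n) unfolds to F 0 * G (suc n) + (F ∘ suc ⊛ G) n.

  ⊛-cong : ∀ {F F′ G G′} → (∀ n → F n ≈ F′ n) → (∀ n → G n ≈ G′ n) → ∀ n → (F ⊛ G) n ≈ (F′ ⊛ G′) n
  ⊛-cong {F} {F′} {G} {G′} F≈ G≈ n = sum-cong-≋ {suc n}
    {λ i → F (toℕ i) * G (n ∸ toℕ i)} {λ i → F′ (toℕ i) * G′ (n ∸ toℕ i)}
    λ i → *-cong (F≈ (toℕ i)) (G≈ (n ∸ toℕ i))

  -- The product unfolds at the first coefficient of its left factor; doing the same on the right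
  -- makes commutativity an induction.
  ⊛-sucʳ : ∀ F G n → (F ⊛ G) (suc n) ≈ F (suc n) * G 0 + (F ⊛ (G ∘ suc)) n
  ⊛-sucʳ F G zero    = begin
    F 0 * G 1 + (F 1 * G 0 + 0#)  ≈⟨ x∙yz≈y∙xz _ _ _ ⟩
    F 1 * G 0 + (F 0 * G 1 + 0#)  ∎
  ⊛-sucʳ F G (suc n) = begin
    F 0 * G (2 ℕ.+ n) + (F ∘ suc ⊛ G) (suc n)
      ≈⟨ +-congˡ (⊛-sucʳ (F ∘ suc) G n) ⟩
    F 0 * G (2 ℕ.+ n) + (F (2 ℕ.+ n) * G 0 + (F ∘ suc ⊛ G ∘ suc) n)           ≈⟨ x∙yz≈y∙xz _ _ _ ⟩
    F (2 ℕ.+ n) * G 0 + (F 0 * G (2 ℕ.+ n) + (F ∘ suc ⊛ G ∘ suc) n)           ∎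

  ⊛-comm : ∀ F G n → (F ⊛ G) n ≈ (G ⊛ F) n
  ⊛-comm F G zero    = +-congʳ (*-comm _ _)
  ⊛-comm F G (suc n) = begin
    F 0 * G (suc n) + (F ∘ suc ⊛ G) n    ≈⟨ +-cong (*-comm _ _) (⊛-comm (F ∘ suc) G n) ⟩
    G (suc n) * F 0 + (G ⊛ F ∘ suc) n    ≈⟨ ⊛-sucʳ G F n ⟨
    (G ⊛ F) (suc n)                      ∎

  ⊛-distribʳ : ∀ F G H n → ((λ m → G m + H m) ⊛ F) n ≈ (G ⊛ F) n + (H ⊛ F) n
  ⊛-distribʳ F G H zero    = trans (+-congʳ (distribʳ _ _ _))
    (trans (+-congˡ (sym (+-identityˡ 0#))) (interchange _ _ _ _))
  ⊛-distribʳ F G H (suc n) = trans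
    (+-cong (distribʳ _ _ _) (⊛-distribʳ F (G ∘ suc) (H ∘ suc) n)) (interchange _ _ _ _)

  ⊛-*ˡ : ∀ x F G n → ((λ m → x * F m) ⊛ G) n ≈ x * (F ⊛ G) n
  ⊛-*ˡ x F G zero    = trans (+-cong (*-assoc _ _ _) (sym (zeroʳ x))) (sym (distribˡ _ _ _))
  ⊛-*ˡ x F G (suc n) = trans (+-cong (*-assoc _ _ _) (⊛-*ˡ x (F ∘ suc) G n)) (sym (distribˡ _ _ _))

  ⊛-assoc : ∀ F G H n → ((F ⊛ G) ⊛ H) n ≈ (F ⊛ (G ⊛ H)) n
  ⊛-assoc F G H zero    = +-congʳ (begin
    (F 0 * G 0 + 0#) * H 0   ≈⟨ *-congʳ (+-identityʳ _) ⟩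
    F 0 * G 0 * H 0          ≈⟨ *-assoc _ _ _ ⟩
    F 0 * (G 0 * H 0)        ≈⟨ *-congˡ (+-identityʳ _) ⟨
    F 0 * (G 0 * H 0 + 0#)   ∎)
  ⊛-assoc F G H (suc n) = begin
    (F 0 * G 0 + 0#) * H (suc n) + ((λ m → F 0 * G (suc m) + (F ∘ suc ⊛ G) m) ⊛ H) n
      ≈⟨ +-cong (trans (*-congʳ (+-identityʳ _)) (*-assoc _ _ _))
           (trans (⊛-distribʳ H (λ m → F 0 * G (suc m)) (F ∘ suc ⊛ G) n)
             (+-cong (⊛-*ˡ (F 0) (G ∘ suc) H n) (⊛-assoc (F ∘ suc) G H n))) ⟩
    F 0 * (G 0 * H (suc n)) + (F 0 * (G ∘ suc ⊛ H) n + (F ∘ suc ⊛ (G ⊛ H)) n)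
      ≈⟨ +-assoc _ _ _ ⟨
    (F 0 * (G 0 * H (suc n)) + F 0 * (G ∘ suc ⊛ H) n) + (F ∘ suc ⊛ (G ⊛ H)) n
      ≈⟨ +-congʳ (distribˡ _ _ _) ⟨
    F 0 * (G ⊛ H) (suc n) + (F ∘ suc ⊛ (G ⊛ H)) n ∎

  ⊛-zeroˡ : ∀ F n → ((λ _ → 0#) ⊛ F) n ≈ 0#
  ⊛-zeroˡ F zero    = trans (+-identityʳ _) (zeroˡ _)
  ⊛-zeroˡ F (suc n) = trans (+-cong (zeroˡ _) (⊛-zeroˡ F n)) (+-identityˡ 0#)

  const-⊛ : ∀ x F n → (const x ⊛ F) n ≈ x * F n
  const-⊛ x F zero    = +-identityʳ _
  const-⊛ x F (suc n) = trans (+-congˡ (⊛-zeroˡ F n)) (+-identityʳ _)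

  commutativeRing : CommutativeRing c ℓ
  commutativeRing = record
    { Carrier = PS
    ; _≈_ = λ F G → ∀ n → F n ≈ G n
    ; _+_ = λ F G n → F n + G n
    ; _*_ = _⊛_
    ; -_  = λ F n → - F n
    ; 0#  = λ _ → 0#
    ; 1#  = const 1#
    ; isCommutativeRing = record
      { isRing = record
        { +-isAbelianGroup = record
          { isGroup = record
            { isMonoid = record
              { isSemigroup = record
                { isMagma = record
                  { isEquivalence = record
                    { refl = λ _ → refl ; sym = λ p n → sym (p n) ; trans = λ p q n → trans (p n)
                      (q n) }
                  ; ∙-cong = λ p q n → +-cong (p n) (q n)
                  }
                ; assoc = λ F G H n → +-assoc _ _ _
                }
              ; identity = (λ _ _ → +-identityˡ _) , (λ _ _ → +-identityʳ _)
              }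
            ; inverse = (λ _ _ → -‿inverseˡ _) , (λ _ _ → -‿inverseʳ _)
            ; ⁻¹-cong = λ p n → -‿cong (p n)
            }
          ; comm = λ _ _ _ → +-comm _ _
          }
        ; *-cong = ⊛-cong
        ; *-assoc = ⊛-assoc
        ; *-identity = (λ F n → trans (const-⊛ 1# F n) (*-identityˡ _))
          , (λ F n → trans (⊛-comm F (const 1#) n) (trans (const-⊛ 1# F n) (*-identityˡ _)))
        ; distrib = (λ F G H n → trans (⊛-comm F (λ m → G m + H m) n)
          (trans (⊛-distribʳ F G H n) (+-cong (⊛-comm G F n) (⊛-comm H F n))))
          , ⊛-distribʳ
        }
      ; *-comm = ⊛-comm
      }
    }

-- Genus 2 partitions correspond to walks

module GenusCount where
  open import Defs hiding (_+_; _*_; -_; _-_; x; y; _≈_; _^_; _·_; 1#)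
  open import Data.Bool using (Bool; T; false; if_then_else_; true)
  open import Data.Bool.Properties using (T-≡)
  open import Data.Empty using (⊥; ⊥-elim)
  open import Data.Fin using (_<_; _≤_; fromℕ; inject₁; punchIn)
  open import Data.Fin.Permutation as Perm using (Permutation′; _∘ₚ_; _⟨$⟩ʳ_; _⟨$⟩ˡ_; flip; insert;
    remove; transpose)
  import Data.Fin.Permutation.Components as PC
  open import Data.Fin.Properties using (_≟_; fromℕ≢inject₁; inject₁-injective; toℕ-fromℕ;
    toℕ-inject₁; toℕ<n; ≤-antisym; ≤-refl; ≤-reflexive; ≤-total; ≤-trans; ≤fromℕ)
  open import Data.Fin.Relation.Unary.Top using (view; ‵fromℕ; ‵inject₁)
  open import Data.List.Base using (_++_; _∷ʳ′_; allFin; cartesianProductWith; concat; filter;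
    initLast; iterate; length; tabulate; takeWhile)
  open import Data.List.Membership.Propositional using (_∈_; _∉_)
  open import Data.List.Membership.Propositional.Properties using (∈-++⁺ʳ; ∈-++⁺ˡ; ∈-++⁻; ∈-allFin;
    ∈-concat⁺′; ∈-concat⁻′; ∈-filter⁺; ∈-map⁺; ∈-∃++)
  import Data.List.Membership.Setoid as Membershipₛ
  import Data.List.Membership.Setoid.Properties as Membership
  open import Data.List.Properties using (++-assoc; ++-identityʳ; concat-++; concat-map; filter-++;
    filter-accept; filter-none; filter-≐; length-++; length-map; length-tabulate; map-++; map-cong;
    map-cong-local; map-tabulate; map-∘; ∷ʳ-injective)
  open import Data.List.Relation.Binary.Permutation.Propositional using (_↭_; prep; swap; ↭-refl;
    ↭-reflexive; ↭-sym; ↭-trans; ↭⇒↭ₛ)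
  open import Data.List.Relation.Binary.Permutation.Propositional.Properties using (++-comm; ++⁺ʳ;
    ++⁺ˡ; All-resp-↭; filter-↭; map⁺; shift; shifts; ↭-length; ∈-resp-↭)
  import Data.List.Relation.Binary.Permutation.Setoid.Properties as Permutationₛ′
  open import Data.List.Relation.Unary.All as All using (All; []; _∷_)
  open import Data.List.Relation.Unary.All.Properties using (All¬⇒¬Any)
  import Data.List.Relation.Unary.All.Properties as All
  open import Data.List.Relation.Unary.AllPairs using ([]; _∷_)
  open import Data.List.Relation.Unary.Any using (here; there)
  open import Data.List.Relation.Unary.Linked using (Linked; [-]; []; _∷_)
  open import Data.List.Relation.Unary.Unique.Propositional using (Unique)
  open import Data.List.Relation.Unary.Unique.Propositional.Properties using (allFin⁺)
  import Data.List.Relation.Unary.Unique.Propositional.Properties as Unique≡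
  import Data.List.Relation.Unary.Unique.Setoid as UniqueSetoid
  import Data.List.Relation.Unary.Unique.Setoid.Properties as Unique
  open import Data.Nat as ℕ using (_*_; _+_; _≤ᵇ_)
  open import Data.Nat.ListAction using (sum)
  open import Data.Nat.ListAction.Properties using (sum-++; sum-↭)
  open import Data.Nat.Tactic.RingSolver using (solve-∀)
  open import Data.Product using (proj₁; proj₂; ∃₂)
  open import Data.Sum using ([_,_]′; _⊎_; inj₁; inj₂; map₁; map₂)
  open import Function using (case_of_; mk⇔)
  open import Function.Bundles using (Equivalence; Injection)
  open import Function.Properties.Inverse using (↔⇒↣)
  open import Relation.Binary using (Setoid)
  open ≡ using (_≢_; refl; sym; trans; subst; subst₂; setoid; module ≡-Reasoning)
  open import Relation.Nullary using (Dec; _×-dec_; contradiction; does; ¬?; ¬_)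
  open import Relation.Nullary.Decidable using (dec-false; dec-true; does-⇔)
  open import Relation.Unary using (Decidable; Pred)

  open Σℕ

  -- Enumerating the permutations by inserting the largest element

  perm-injective : ∀ {n} (π : Permutation′ n) {i j} → π ⟨$⟩ʳ i ≡ π ⟨$⟩ʳ j → i ≡ j
  perm-injective π = Injection.injective (↔⇒↣ π)

  transpose-first : ∀ {n} (i j : Fin n) → PC.transpose i j i ≡ j
  transpose-first i j rewrite dec-true (i ≟ i) refl = refl

  transpose-second : ∀ {n} (i j : Fin n) → PC.transpose i j j ≡ i
  transpose-second i j with j ≟ i
  ... | yes j≡i = j≡i
  ... | no  _   rewrite dec-true (j ≟ j) refl = refl

  transpose-other : ∀ {n} (i j k : Fin n) → k ≢ i → k ≢ j → PC.transpose i j k ≡ k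
  transpose-other i j k k≢i k≢j rewrite dec-false (k ≟ i) k≢i | dec-false (k ≟ j) k≢j = refl

  punchIn-fromℕ : ∀ {n} (i : Fin n) → punchIn (fromℕ n) i ≡ inject₁ i
  punchIn-fromℕ zero    = refl
  punchIn-fromℕ (suc i) = cong suc (punchIn-fromℕ i)

  insert-at : ∀ {n} (i j : Fin (suc n)) (π : Permutation′ n) → insert i j π ⟨$⟩ʳ i ≡ j
  insert-at i j π with i ≟ i
  ... | yes _   = refl
  ... | no  i≢i = contradiction refl i≢i

  insert-last : ∀ {n} (π : Permutation′ n) i → insert (fromℕ n) (fromℕ n) π ⟨$⟩ʳ inject₁ i ≡
    inject₁ (π ⟨$⟩ʳ i)
  insert-last {n} π i = trans (cong (insert (fromℕ n) (fromℕ n) π ⟨$⟩ʳ_) (sym (punchIn-fromℕ i)))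
    (trans (Perm.insert-punchIn (fromℕ n) (fromℕ n) π i) (punchIn-fromℕ (π ⟨$⟩ʳ i)))

  -- α with the new largest element inserted into a cycle, directly after m
  -- (as a fixed point if m is the new element itself).

  extend : ∀ {n} → Permutation′ n → Fin (suc n) → Permutation′ (suc n)
  extend {n} α m = transpose m (fromℕ n) ∘ₚ insert (fromℕ n) (fromℕ n) α

  module _ {n} (α : Permutation′ n) where

    extend-at : ∀ m → extend α m ⟨$⟩ʳ m ≡ fromℕ n
    extend-at m = trans (cong (insert (fromℕ n) (fromℕ n) α ⟨$⟩ʳ_) (transpose-first m (fromℕ n)))
      (insert-at (fromℕ n) (fromℕ n) α)

    extend-last : ∀ m → extend α (inject₁ m) ⟨$⟩ʳ fromℕ n ≡ inject₁ (α ⟨$⟩ʳ m)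
    extend-last m = trans (cong (insert (fromℕ n) (fromℕ n) α ⟨$⟩ʳ_)
      (transpose-second (inject₁ m) (fromℕ n)))
      (insert-last α m)

    extend-other : ∀ m i → inject₁ i ≢ m → extend α m ⟨$⟩ʳ inject₁ i ≡ inject₁ (α ⟨$⟩ʳ i)
    extend-other m i i≢m = trans
      (cong (insert (fromℕ n) (fromℕ n) α ⟨$⟩ʳ_) (transpose-other m (fromℕ n) (inject₁ i) i≢m
        (fromℕ≢inject₁ ∘ sym)))
      (insert-last α i)

  extend-cong : ∀ {n} {m m′ : Fin (suc n)} {α β : Permutation′ n} → α Perm.≈ β → m ≡ m′ → extend α
    m Perm.≈ extend β m′
  extend-cong {n} {m} {α = α} {β} α≈β refl i = go (PC.transpose m (fromℕ n) i)
    where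
    go : ∀ j → insert (fromℕ n) (fromℕ n) α ⟨$⟩ʳ j ≡ insert (fromℕ n) (fromℕ n) β ⟨$⟩ʳ j
    go j with fromℕ n ≟ j
    ... | yes _ = refl
    ... | no  _ = cong (punchIn (fromℕ n)) (α≈β _)

  extend-injective : ∀ {n} {m m′ : Fin (suc n)} {α β : Permutation′ n} →
    extend α m Perm.≈ extend β m′ → α Perm.≈ β × m ≡ m′
  extend-injective {n} {m} {m′} {α} {β} p with perm-injective (extend β m′) {m} {m′}
    (trans (sym (p m)) (trans (extend-at α m) (sym (extend-at β m′))))
  ... | refl = (λ i → inject₁-injective (trans (sym (value α i))
    (trans (p (PC.transpose (fromℕ n) m (inject₁ i))) (value β i)))) , refl
    where
    value : ∀ γ i → extend γ m ⟨$⟩ʳ PC.transpose (fromℕ n) m (inject₁ i) ≡ inject₁ (γ ⟨$⟩ʳ i)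
    value γ i = trans (cong (insert (fromℕ n) (fromℕ n) γ ⟨$⟩ʳ_)
      (PC.transpose-inverse m (fromℕ n))) (insert-last γ i)

  -- The place `m` is the preimage of the largest element. Exchanging the values of `β` at `m` and
  -- at the largest element makes the latter a fixed point, which can be removed.
  extend-surjective : ∀ {n} (β : Permutation′ (suc n)) → ∃ λ α → ∃ λ m → extend α m Perm.≈ β
  extend-surjective {n} β = remove (fromℕ n) γ , m , λ i → trans
    (cong (λ j → insert (fromℕ n) j (remove (fromℕ n) γ) ⟨$⟩ʳ PC.transpose m (fromℕ n) i)
      (sym γ-last))
    (trans (Perm.insert-remove (fromℕ n) γ _) (cong (β ⟨$⟩ʳ_) (PC.transpose-inverse (fromℕ n) m)))
    where
    m = β ⟨$⟩ˡ fromℕ n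
    γ = transpose (fromℕ n) m ∘ₚ β
    γ-last : γ ⟨$⟩ʳ fromℕ n ≡ fromℕ n
    γ-last = trans (cong (β ⟨$⟩ʳ_) (transpose-first (fromℕ n) m)) (Perm.inverseʳ β)

  -- The permutations are enumerated anew because the given enumeration inserts at the smallest
  -- element, whereas the faces change in a controlled way when the largest one is added.
  extensions : ∀ n → List (Permutation′ n)
  extensions zero    = Perm.id ∷ []
  extensions (suc n) = cartesianProductWith extend (extensions n) (allFin (suc n))

  extensions-complete : ∀ {n} (π : Permutation′ n) → Membershipₛ._∈_ (Permutationₛ n) π
    (extensions n)
  extensions-complete {zero}  π = here λ ()
  extensions-complete {suc n} β =
    let α , m , α∷m≈β = extend-surjective β in
    Membership.∈-resp-≈ (Permutationₛ (suc n)) {x = extend α m} {y = β} α∷m≈β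
      (Membership.∈-cartesianProductWith⁺ (Permutationₛ n) (setoid (Fin (suc n)))
        (Permutationₛ (suc n))
        (λ {α} {β} {m} {m′} → extend-cong {n} {m} {m′} {α} {β})
        (extensions-complete α) (∈-allFin m))

  extensions-unique : ∀ n → UniqueSetoid.Unique (Permutationₛ n) (extensions n)
  extensions-unique zero    = [] ∷ []
  extensions-unique (suc n) = Unique.cartesianProductWith⁺
    (Permutationₛ n) (setoid (Fin (suc n))) (Permutationₛ (suc n))
    extend (λ {α} {β} {m} {m′} → extend-injective {n} {m} {m′} {α} {β}) (extensions-unique n)
      (Unique≡.allFin⁺ (suc n))

  -- Complete enumerations without repetition give equal counts

  module _ {a ℓ} (S : Setoid a ℓ) where
    open Setoid S using (Carrier; _≈_; _≉_) renaming
      (refl to ≈-refl; sym to ≈-sym; trans to ≈-trans)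
    open Membershipₛ S using () renaming (_∈_ to _∈ₛ_)
    open UniqueSetoid S using () renaming (Unique to Uniqueₛ)

    excise : ∀ {x ys} → x ∈ₛ ys → ∃ λ ys′ → length ys ≡ suc (length ys′) ×
      (∀ {z} → z ≉ x → z ∈ₛ ys → z ∈ₛ ys′)
    excise {ys = y ∷ ys} (here x≈y) = ys , refl , λ
      { z≉x (here z≈y)   → contradiction (≈-trans z≈y (≈-sym x≈y)) z≉x
      ; z≉x (there z∈ys) → z∈ys }
    excise {ys = y ∷ ys} (there x∈ys) =
      let ys′ , eq , keep = excise x∈ys in y ∷ ys′ , cong suc eq , λ
      { z≉x (here z≈y)   → here z≈y
      ; z≉x (there z∈ys) → there (keep z≉x z∈ys) }

    unique-⊆-length : ∀ {xs ys} → Uniqueₛ xs → (∀ {x} → x ∈ₛ xs → x ∈ₛ ys) → length xs ℕ.≤ length ys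
    unique-⊆-length {[]} [] ⊆ = ℕ.z≤n
    unique-⊆-length {x ∷ xs} (x∉xs ∷ unique) ⊆ =
      let ys′ , eq , keep = excise (⊆ (here ≈-refl)) in
      subst (suc (length xs) ℕ.≤_) (sym eq) (ℕ.s≤s (unique-⊆-length unique λ z∈xs →
        keep (λ z≈x → All¬⇒¬Any x∉xs (Membership.∈-resp-≈ S z≈x z∈xs)) (⊆ (there z∈xs))))

    module _ {p} {P : Pred Carrier p} (P? : Decidable P) (resp : ∀ {x y} → x ≈ y → P x → P y) where

      filter-length-≤ : ∀ {xs ys} → Uniqueₛ xs → (∀ x → x ∈ₛ ys) → length (filter P? xs) ℕ.≤
        length (filter P? ys)
      filter-length-≤ {xs} unique complete = unique-⊆-length (Unique.filter⁺ S P? unique) λ x∈ →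
        Membership.∈-filter⁺ S P? resp (complete _)
          (proj₂ (Membership.∈-filter⁻ S P? resp {xs = xs} x∈))

      filter-length-≡ : ∀ {xs ys} → Uniqueₛ xs → Uniqueₛ ys → (∀ x → x ∈ₛ xs) → (∀ x → x ∈ₛ ys) →
        length (filter P? xs) ≡ length (filter P? ys)
      filter-length-≡ uxs uys cxs cys = ℕ.≤-antisym (filter-length-≤ uxs cys)
        (filter-length-≤ uys cxs)

  module _ {n} {π ρ : Permutation′ n} (π≈ρ : π Perm.≈ ρ) where

    iterate-cong : ∀ i k → iterate (π ⟨$⟩ʳ_) i k ≡ iterate (ρ ⟨$⟩ʳ_) i k
    iterate-cong i zero    = refl
    iterate-cong i (suc k) = cong (i ∷_) (trans (iterate-cong _ k)
      (cong (λ j → iterate (ρ ⟨$⟩ʳ_) j k) (π≈ρ i)))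

    cycle-cong : ∀ i → cycle π i ≡ cycle ρ i
    cycle-cong i = cong (λ js → i ∷ takeWhile (λ j → ¬? (j ≟ i)) js)
      (trans (iterate-cong _ n) (cong (λ j → iterate (ρ ⟨$⟩ʳ_) j n) (π≈ρ i)))

    cycles-cong : cycles π ≡ cycles ρ
    cycles-cong = trans (map-cong cycle-cong _) (cong (map (cycle ρ))
      (filter-≐ (leastInCycle? π) (leastInCycle? ρ)
        ((λ {i} → subst (All (i ≤_)) (cycle-cong i)) ,
          (λ {i} → subst (All (i ≤_)) (sym (cycle-cong i)))) (allFin n)))

    z-cong : z π ≡ z ρ
    z-cong = cong length cycles-cong

    flip-cong : flip π Perm.≈ flip ρ
    flip-cong i = perm-injective π (trans (Perm.inverseʳ π) (sym (trans (π≈ρ _) (Perm.inverseʳ ρ))))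

  Genus2Partition : ℕ → ∀ {n} → Permutation′ n → Set
  Genus2Partition k α = IsPartition α × HasGenus α 2 × z α ≡ k

  genus2Partition? : ∀ k {n} (α : Permutation′ n) → Dec (Genus2Partition k α)
  genus2Partition? k α = isPartition? α ×-dec hasGenus? α 2 ×-dec z α ℕ.≟ k

  Genus2Partition-resp : ∀ {k n} {α β : Permutation′ n} → α Perm.≈ β → Genus2Partition k α →
    Genus2Partition k β
  Genus2Partition-resp {k} {n} {α} {β} α≈β (partition , genus , zα≡k) =
      subst (All (Linked _<_)) (cycles-cong {π = α} {β} α≈β) partition
    , trans genus (cong ℤ.+_ (cong₂ ℕ._+_ (z-cong {π = α} {β} α≈β)
      (z-cong {π = ζ n ∘ₚ flip α} {ζ n ∘ₚ flip β} (λ i → flip-cong {π = α} {β} α≈β (ζ n ⟨$⟩ʳ i)))))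
    , trans (sym (z-cong {π = α} {β} α≈β)) zα≡k

  module _ (k : ℕ) where

    indicator : ∀ {n} → Permutation′ n → ℕ
    indicator α = if does (genus2Partition? k α) then 1 else 0

    -- The tree of insertions is searched through all permutations, partitions or not; summed over
    -- one level it counts the genus 2 partitions of a later level.
    descendants : ℕ → ∀ {n} → Permutation′ n → ℕ
    descendants zero    α = indicator α
    descendants (suc N) {n} α = sum (map (λ m → descendants N (extend α m)) (allFin (suc n)))

    private
      length-filter : ∀ {n} (αs : List (Permutation′ n)) → length (filter (genus2Partition? k) αs)
        ≡ sum (map indicator αs)
      length-filter []       = refl
      length-filter (α ∷ αs) with does (genus2Partition? k α)
      ... | true  = cong suc (length-filter αs)
      ... | false = length-filter αs

      sum-product : ∀ {n} (f : Permutation′ (suc n) → ℕ) αs →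
        sum (map f (cartesianProductWith extend αs (allFin (suc n)))) ≡ sum
          (map (λ α → sum (map (λ m → f (extend α m)) (allFin (suc n)))) αs)
      sum-product {n} f []       = refl
      sum-product {n} f (α ∷ αs) = trans (cong sum (map-++ f (map (extend α) (allFin (suc n))) _))
        (trans (sum-++ (map f (map (extend α) (allFin (suc n)))) _)
          (cong₂ _+_ (cong sum (sym (map-∘ (allFin (suc n))))) (sum-product f αs)))

      sum-descendants : ∀ N n → sum (map (descendants N) (extensions n)) ≡ sum
        (map indicator (extensions (N + n)))
      sum-descendants zero    n = refl
      sum-descendants (suc N) n = trans (sym (sum-product (descendants N) (extensions n)))
        (trans (sum-descendants N (suc n)) (cong (λ m → sum (map indicator (extensions m)))
          (ℕ.+-suc N n)))

    p-descendants : ∀ n → p n k ≡ descendants n {0} Perm.id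
    p-descendants n = trans
      (filter-length-≡ (Permutationₛ n) (genus2Partition? k)
        (λ {α} {β} → Genus2Partition-resp {k} {n} {α} {β})
        (permutations-unique n) (extensions-unique n) permutations-complete extensions-complete)
      (trans (length-filter (extensions n)) (trans
        (cong (λ m → sum (map indicator (extensions m))) (sym (ℕ.+-identityʳ n)))
        (trans (sym (sum-descendants n 0)) (ℕ.+-identityʳ _))))

  -- Permutations as lists of cycles

  unique-resp-↭ : ∀ {A : Set} {xs ys : List A} → xs ↭ ys → Unique xs → Unique ys
  unique-resp-↭ {A} p = Permutationₛ′.Unique-resp-↭ (setoid A) (↭⇒↭ₛ p)

  unique-++⁻ : ∀ {A : Set} (xs : List A) {ys} → Unique (xs ++ ys) → Unique xs × Unique ys ×
    (∀ {i} → i ∈ xs → i ∉ ys)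
  unique-++⁻ []       u = [] , u , λ ()
  unique-++⁻ (x ∷ xs) (x∉ ∷ u) =
    let ux , uy , disjoint = unique-++⁻ xs u in
    (All.++⁻ˡ xs x∉ ∷ ux) , uy , λ
      { (here refl) i∈ys → All.lookup (All.++⁻ʳ xs x∉) i∈ys refl
      ; (there i∈xs) → disjoint i∈xs }

  LeastFirst : ∀ {n} → List (Fin n) → Set
  LeastFirst []       = ⊥
  LeastFirst (i ∷ is) = All (i ≤_) is

  module _ {n} (π : Permutation′ n) where

    -- The list holds only the points between the two ends, and a cycle is a path from its first
    -- entry back to it. Cutting, joining and rotating cycles then become operations on lists.
    Path : Fin n → List (Fin n) → Fin n → Set
    Path i []       j = π ⟨$⟩ʳ i ≡ j
    Path i (x ∷ xs) j = π ⟨$⟩ʳ i ≡ x × Path x xs j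

    IsCycle : List (Fin n) → Set
    IsCycle []       = ⊥
    IsCycle (i ∷ xs) = Path i xs i

    path-++⁺ : ∀ {i} xs {m ys j} → Path i xs m → Path m ys j → Path i (xs ++ m ∷ ys) j
    path-++⁺ []       refl p       = refl , p
    path-++⁺ (x ∷ xs) (eq , p) p′ = eq , path-++⁺ xs p p′

    path-++⁻ : ∀ {i} xs {m ys j} → Path i (xs ++ m ∷ ys) j → Path i xs m × Path m ys j
    path-++⁻ []       p        = p
    path-++⁻ (x ∷ xs) (eq , p) = let q , q′ = path-++⁻ xs p in (eq , q) , q′

    rotate : ∀ as {i bs} → IsCycle (as ++ i ∷ bs) → Path i (bs ++ as) i
    rotate []       {i} {bs} p = subst (λ xs → Path i xs i) (sym (++-identityʳ bs)) p
    rotate (a ∷ as) {i} {bs} p = let q , q′ = path-++⁻ as p in path-++⁺ bs q′ q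

    takeWhile-path : ∀ {i j} xs {N} → Path i xs j → All (_≢ j) xs → length xs ℕ.< N →
      takeWhile (λ k → ¬? (k ≟ j)) (iterate (π ⟨$⟩ʳ_) (π ⟨$⟩ʳ i) N) ≡ xs
    takeWhile-path {i} {j} [] {suc N} eq [] (ℕ.s≤s _) with π ⟨$⟩ʳ i ≟ j
    ... | yes _ = refl
    ... | no  ≢ = contradiction eq ≢
    takeWhile-path {i} {j} (x ∷ xs) {suc N} (refl , p) (x≢j ∷ ≢j) (ℕ.s≤s len) with π ⟨$⟩ʳ i ≟ j
    ... | yes x≡j = contradiction x≡j x≢j
    ... | no  _   = cong (π ⟨$⟩ʳ i ∷_) (takeWhile-path xs p ≢j len)

    cycle-rotation : ∀ {as i bs} → IsCycle (as ++ i ∷ bs) → Unique (as ++ i ∷ bs) → length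
      (as ++ i ∷ bs) ℕ.≤ n →
      cycle π i ≡ i ∷ bs ++ as
    cycle-rotation {as} {i} {bs} c u len = cong (i ∷_) (takeWhile-path (bs ++ as) (rotate as c)
      (All.map (λ i≢ → i≢ ∘ sym) (i∉ (unique-resp-↭ (++-comm as (i ∷ bs)) u)))
      (subst (ℕ._≤ n) (↭-length (++-comm as (i ∷ bs))) len))
      where
      i∉ : Unique (i ∷ bs ++ as) → All (i ≢_) (bs ++ as)
      i∉ (i≢ ∷ _) = i≢

    -- The cycles may come in any order and start at any entry, so they can be rearranged without
    -- restoring a normal form.
    record Represents (cs : List (List (Fin n))) : Set where
      field
        areCycles : All IsCycle cs
        exhaust   : concat cs ↭ allFin n

      unique : Unique (concat cs)
      unique = unique-resp-↭ (↭-sym exhaust) (allFin⁺ n)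

      covers : ∀ i → ∃ λ c → c ∈ cs × i ∈ c
      covers i = let c , i∈c , c∈cs = ∈-concat⁻′ cs (∈-resp-↭ (↭-sym exhaust) (∈-allFin i)) in c , c∈cs , i∈c

      total-length : length (concat cs) ≡ n
      total-length = trans (↭-length exhaust) (length-tabulate (λ i → i))

      member : ∀ {c} → c ∈ cs → IsCycle c × Unique c × length c ℕ.≤ n
      member {c} c∈cs with ∈-∃++ c∈cs
      ... | ds , es , refl = All.lookup areCycles c∈cs , go ds unique , subst (length c ℕ.≤_)
        total-length (len {c} {es} ds)
        where
        go : ∀ {c es} ds → Unique (concat (ds ++ c ∷ es)) → Unique c
        go {c} []       u = proj₁ (unique-++⁻ c u)
        go     (d ∷ ds) u = go ds (proj₁ (proj₂ (unique-++⁻ d u)))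
        len : ∀ {c es} ds → length c ℕ.≤ length (concat (ds ++ c ∷ es))
        len {c} []       = subst (length c ℕ.≤_) (sym (length-++ c)) (ℕ.m≤m+n _ _)
        len {c} {es} (d ∷ ds) = ℕ.≤-trans (len {c} {es} ds)
          (subst (length (concat (ds ++ c ∷ es)) ℕ.≤_) (sym (length-++ d)) (ℕ.m≤n+m _ _))

      cycle-of : ∀ {as i bs} → as ++ i ∷ bs ∈ cs → cycle π i ≡ i ∷ bs ++ as
      cycle-of c∈cs = let c , u , len = member c∈cs in cycle-rotation c u len

      ∈-cycle : ∀ {c i j} → c ∈ cs → i ∈ c → j ∈ c → i ∈ cycle π j
      ∈-cycle {i = i} {j} c∈cs i∈c j∈c with ∈-∃++ j∈c
      ... | as , bs , refl = subst (i ∈_) (sym (cycle-of c∈cs)) (∈-resp-↭ (++-comm as (j ∷ bs)) i∈c)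

    minimum : ∀ (c : List (Fin n)) → c ≢ [] → ∃ λ i → i ∈ c × All (i ≤_) c
    minimum []           c≢[] = contradiction refl c≢[]
    minimum (x ∷ [])     _    = x , here refl , ≤-refl ∷ []
    minimum (x ∷ y ∷ c)  _    with minimum (y ∷ c) (λ ())
    ... | i , i∈ , i≤ with ≤-total x i
    ...   | inj₁ x≤i = x , here refl , ≤-refl ∷ All.map (≤-trans x≤i) i≤
    ...   | inj₂ i≤x = i , there i∈ , i≤x ∷ i≤

    module _ {cs} (R : Represents cs) where
      open Represents R

      private
        least-count : ∀ {c} → c ∈ cs → length (filter (leastInCycle? π) c) ≡ 1
        least-count {c} c∈cs with minimum c (λ { refl → proj₁ (member c∈cs) })
        ... | i , i∈c , i≤c with ∈-∃++ i∈c
        ...   | as , bs , refl = trans (↭-length (filter-↭ (leastInCycle? π) (++-comm as (i ∷ bs))))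
          (trans (cong length (filter-accept (leastInCycle? π) {xs = bs ++ as}
              (subst (All (i ≤_)) (sym (cycle-of c∈cs)) (All-resp-↭ (++-comm as (i ∷ bs)) i≤c))))
            (cong (suc ∘ length) (filter-none (leastInCycle? π) (All.tabulate others))))
          where
          i∉ : All (i ≢_) (bs ++ as)
          i∉ with unique-resp-↭ (++-comm as (i ∷ bs)) (proj₁ (proj₂ (member c∈cs)))
          ... | i≢ ∷ _ = i≢
          others : ∀ {j} → j ∈ bs ++ as → LeastInCycle π j → ⊥
          others j∈ least = All.lookup i∉ j∈ (≤-antisym
            (All.lookup i≤c j∈c) (All.lookup least (∈-cycle c∈cs i∈c j∈c)))
            where j∈c = ∈-resp-↭ (++-comm (i ∷ bs) as) (there j∈)

        least-counts : ∀ ds → (∀ {c} → c ∈ ds → c ∈ cs) → length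
          (filter (leastInCycle? π) (concat ds)) ≡ length ds
        least-counts []       _ = refl
        least-counts (d ∷ ds) ⊆ = trans (cong length (filter-++ (leastInCycle? π) d (concat ds)))
          (trans (length-++ (filter (leastInCycle? π) d))
            (cong₂ _+_ (least-count (⊆ (here refl))) (least-counts ds (⊆ ∘ there))))

      -- By definition cycles are counted through elements that are least in their cycle, and each
      -- listed cycle contains exactly one of these.
      z-represents : z π ≡ length cs
      z-represents = trans (length-map (cycle π) (filter (leastInCycle? π) (allFin n)))
        (trans (↭-length (filter-↭ (leastInCycle? π) (↭-sym exhaust)))
          (least-counts cs (λ c∈ → c∈)))

      module _ (leastFirst : All LeastFirst cs) where

        partition⇒linked : IsPartition π → All (Linked _<_) cs
        partition⇒linked partition = All.tabulate go
          where
          go : ∀ {c} → c ∈ cs → Linked _<_ c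
          go {[]}     c∈cs = ⊥-elim (All.lookup leastFirst c∈cs)
          go {i ∷ is} c∈cs = subst (Linked _<_) eq (All.lookup partition
            (∈-map⁺ (cycle π) (∈-filter⁺ (leastInCycle? π) (∈-allFin i)
              (subst (All (i ≤_)) (sym eq) (≤-refl ∷ All.lookup leastFirst c∈cs)))))
            where
            eq : cycle π i ≡ i ∷ is
            eq = trans (cycle-of {[]} c∈cs) (cong (i ∷_) (++-identityʳ is))

        linked⇒partition : All (Linked _<_) cs → IsPartition π
        linked⇒partition linked = All.map⁺ (All.map go
          (All.all-filter (leastInCycle? π) (allFin n)))
          where
          go : ∀ {i} → LeastInCycle π i → Linked _<_ (cycle π i)
          go {i} least with covers i
          ... | []     , c∈cs , ()
          ... | a ∷ as , c∈cs , i∈c = subst (λ j → Linked _<_ (cycle π j)) a≡i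
            (subst (Linked _<_) (sym eq) (All.lookup linked c∈cs))
            where
            eq : cycle π a ≡ a ∷ as
            eq = trans (cycle-of {[]} c∈cs) (cong (a ∷_) (++-identityʳ as))
            a≡i : a ≡ i
            a≡i = ≤-antisym (All.lookup (≤-refl ∷ All.lookup leastFirst c∈cs) i∈c)
              (All.lookup least (∈-cycle c∈cs (here refl) i∈c))

  -- Parts

  allFin-last : ∀ n → allFin (suc n) ↭ fromℕ n ∷ map inject₁ (allFin n)
  allFin-last zero    = ↭-refl
  allFin-last (suc n) = ↭-trans
    (prep zero (↭-trans (↭-reflexive (sym (map-tabulate (λ i → i) suc)))
      (map⁺ suc (allFin-last n))))
    (↭-trans (swap zero (suc (fromℕ n)) ↭-refl) (prep _ (prep zero (↭-reflexive (trans
      (sym (map-∘ (allFin n))) (trans (map-∘ (allFin n))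
        (cong (map inject₁) (map-tabulate (λ i → i) suc))))))))

  inject₁s : ∀ {n} → List (List (Fin n)) → List (List (Fin (suc n)))
  inject₁s = map (map inject₁)

  exhaust-extend : ∀ {n} (cs : List (List (Fin n))) cs′ → concat cs ↭ allFin n →
    concat cs′ ↭ fromℕ n ∷ map inject₁ (concat cs) → concat cs′ ↭ allFin (suc n)
  exhaust-extend {n} cs cs′ old new = ↭-trans new (↭-trans (prep (fromℕ n) (map⁺ inject₁ old))
    (↭-sym (allFin-last n)))

  module _ {n} (α : Permutation′ n) where

    path-inject : ∀ {m i xs j} → Path α i xs j → All (λ x → inject₁ x ≢ m) (i ∷ xs) →
      Path (extend α m) (inject₁ i) (map inject₁ xs) (inject₁ j)
    path-inject {m} {i} {[]}     eq       (i≢m ∷ _)  = trans (extend-other α m i i≢m)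
      (cong inject₁ eq)
    path-inject {m} {i} {x ∷ xs} (eq , p) (i≢m ∷ ≢m) = trans (extend-other α m i i≢m)
      (cong inject₁ eq) , path-inject p ≢m

    path-insert : ∀ {m xs j} → Path α m xs j → All (_≢ m) xs →
      Path (extend α (inject₁ m)) (inject₁ m) (fromℕ n ∷ map inject₁ xs) (inject₁ j)
    path-insert {m} {[]}     eq       _    = extend-at α (inject₁ m) , trans (extend-last α m)
      (cong inject₁ eq)
    path-insert {m} {x ∷ xs} (eq , p) ≢m = extend-at α (inject₁ m) , trans (extend-last α m)
      (cong inject₁ eq) ,
      path-inject p (All.map (λ ≢ → ≢ ∘ inject₁-injective) ≢m)

    cycle-inject : ∀ {m} c → IsCycle α c → All (λ x → inject₁ x ≢ m) c → IsCycle (extend α m)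
      (map inject₁ c)
    cycle-inject (i ∷ is) = path-inject

    cycle-insert : ∀ as {m bs} → IsCycle α (as ++ m ∷ bs) → Unique (as ++ m ∷ bs) →
      IsCycle (extend α (inject₁ m)) (map inject₁ as ++ inject₁ m ∷ fromℕ n ∷ map inject₁ bs)
    cycle-insert []       p (m∉ ∷ _) = path-insert p (All.map (λ ≢ → ≢ ∘ sym) m∉)
    cycle-insert (a ∷ as) {m} {bs} p u with path-++⁻ α as p | unique-++⁻ (a ∷ as) u
    ... | p₁ , p₂ | _ , m∉ ∷ _ , disjoint = path-++⁺ (extend α (inject₁ m)) (map inject₁ as)
        (path-inject p₁ (All.tabulate λ x∈ x≡m → disjoint x∈ (here (inject₁-injective x≡m))))
        (path-insert p₂ (All.map (λ ≢ → ≢ ∘ sym) m∉))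

  linked-inject : ∀ {n} {c : List (Fin n)} → Linked _<_ c → Linked _<_ (map inject₁ c)
  linked-inject []         = []
  linked-inject [-]        = [-]
  linked-inject (x<y ∷ l) = subst₂ ℕ._<_ (sym (toℕ-inject₁ _)) (sym (toℕ-inject₁ _)) x<y ∷
    linked-inject l

  linked-inject⁻ : ∀ {n} {c : List (Fin n)} → Linked _<_ (map inject₁ c) → Linked _<_ c
  linked-inject⁻ {c = []}        l         = []
  linked-inject⁻ {c = x ∷ []}    l         = [-]
  linked-inject⁻ {c = x ∷ y ∷ c} (x<y ∷ l) = subst₂ ℕ._<_ (toℕ-inject₁ _) (toℕ-inject₁ _) x<y ∷
    linked-inject⁻ l

  inject₁<fromℕ : ∀ {n} (i : Fin n) → inject₁ i < fromℕ n
  inject₁<fromℕ i = subst₂ ℕ._<_ (sym (toℕ-inject₁ i)) (sym (toℕ-fromℕ _)) (toℕ<n i)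

  linked-++⁻ʳ : ∀ {n} (as : List (Fin n)) {bs} → Linked _<_ (as ++ bs) → Linked _<_ bs
  linked-++⁻ʳ []           l       = l
  linked-++⁻ʳ (a ∷ [])     {[]}    l = []
  linked-++⁻ʳ (a ∷ [])     {_ ∷ _} (_ ∷ l) = l
  linked-++⁻ʳ (a ∷ b ∷ as) (_ ∷ l) = linked-++⁻ʳ (b ∷ as) l

  linked-snoc : ∀ {n} as {m : Fin n} → Linked _<_ (as ++ m ∷ []) →
    Linked _<_ (map inject₁ as ++ inject₁ m ∷ fromℕ n ∷ [])
  linked-snoc []           {m} l   = inject₁<fromℕ m ∷ [-]
  linked-snoc (a ∷ [])     {m} (a<m ∷ l) = subst₂ ℕ._<_ (sym (toℕ-inject₁ a))
    (sym (toℕ-inject₁ m)) a<m ∷ linked-snoc [] l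
  linked-snoc (a ∷ b ∷ as) (a<b ∷ l) = subst₂ ℕ._<_ (sym (toℕ-inject₁ a)) (sym (toℕ-inject₁ b))
    a<b ∷ linked-snoc (b ∷ as) l

  linked-init : ∀ {n} (as : List (Fin n)) {m k} → Linked _<_ (as ++ m ∷ k ∷ []) → Linked _<_
    (as ++ m ∷ [])
  linked-init []           l       = [-]
  linked-init (a ∷ [])     (a< ∷ l) = a< ∷ linked-init [] l
  linked-init (a ∷ b ∷ as) (a< ∷ l) = a< ∷ linked-init (b ∷ as) l

  -- Unlike the faces, the parts are listed from their least elements, because being a partition is
  -- a condition on the cycles written in that way.
  record Blocks {n} (α : Permutation′ n) : Set where
    field
      blocks     : List (List (Fin n))
      represents : Represents α blocks
      leastFirst : All LeastFirst blocks

    open Represents represents public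

    z-blocks : z α ≡ length blocks
    z-blocks = z-represents α represents

    linked : IsPartition α → All (Linked _<_) blocks
    linked = partition⇒linked α represents leastFirst

    partition : All (Linked _<_) blocks → IsPartition α
    partition = linked⇒partition α represents leastFirst

  leastFirst-inject : ∀ {n} (c : List (Fin n)) → LeastFirst c → LeastFirst (map inject₁ c)
  leastFirst-inject (i ∷ is) least = All.map⁺ (All.map
    (λ {j} i≤j → subst₂ ℕ._≤_ (sym (toℕ-inject₁ i)) (sym (toℕ-inject₁ j)) i≤j) least)

  leastFirst-insert : ∀ {n} as {m : Fin n} {bs} → LeastFirst (as ++ m ∷ bs) →
    LeastFirst (map inject₁ as ++ inject₁ m ∷ fromℕ n ∷ map inject₁ bs)
  leastFirst-insert []       {m} {bs} least = ≤fromℕ (inject₁ m) ∷ leastFirst-inject (m ∷ bs) least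
  leastFirst-insert (a ∷ as) {m} {bs} least = All.++⁺
    (All.map⁺ (All.map inject (All.++⁻ˡ as least)))
    (inject (All.head (All.++⁻ʳ as least)) ∷ ≤fromℕ (inject₁ a) ∷ All.map⁺
      (All.map inject (All.tail (All.++⁻ʳ as least))))
    where
    inject : ∀ {j} → a ≤ j → inject₁ a ≤ inject₁ j
    inject {j} = subst₂ ℕ._≤_ (sym (toℕ-inject₁ a)) (sym (toℕ-inject₁ j))

  concat-pull : ∀ {A : Set} ds (c : List A) {es} → concat (ds ++ c ∷ es) ↭ c ++ concat (ds ++ es)
  concat-pull ds c {es} = ↭-trans (↭-reflexive (sym (concat-++ ds (c ∷ es))))
    (↭-trans (shifts (concat ds) c) (++⁺ˡ c (↭-reflexive (concat-++ ds es))))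

  module _ {n} {α : Permutation′ n} (B : Blocks α) where
    open Blocks B

    extend-last-blocks : Blocks (extend α (fromℕ n))
    extend-last-blocks = record
      { blocks     = (fromℕ n ∷ []) ∷ inject₁s blocks
      ; represents = record
        { areCycles = extend-at α (fromℕ n) ∷ All.map⁺
          (All.map (λ {c} isCycle → cycle-inject α c isCycle
          (All.tabulate λ _ → fromℕ≢inject₁ ∘ sym)) areCycles)
        ; exhaust   = exhaust-extend blocks ((fromℕ n ∷ []) ∷ inject₁s blocks) exhaust
          (prep _ (↭-reflexive (concat-map blocks)))
        }
      ; leastFirst = [] ∷ All.map⁺ (All.map (λ {c} → leastFirst-inject c) leastFirst)
      }

    module _ {ds es as bs m} (eq : blocks ≡ ds ++ (as ++ m ∷ bs) ∷ es) where

      private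
        c  = as ++ m ∷ bs
        c′ = map inject₁ as ++ inject₁ m ∷ fromℕ n ∷ map inject₁ bs

        pulled : concat blocks ↭ c ++ concat (ds ++ es)
        pulled = subst (λ cs → concat cs ↭ c ++ concat (ds ++ es)) (sym eq) (concat-pull ds c)

        parts : Unique c × Unique (concat (ds ++ es)) × (∀ {i} → i ∈ c → i ∉ concat (ds ++ es))
        parts = unique-++⁻ c (unique-resp-↭ pulled unique)

        others : ∀ {P : List (Fin n) → Set} → All P blocks → All P (ds ++ es)
        others all = let all′ = subst (All _) eq all in All.++⁺ (All.++⁻ˡ ds all′) (All.tail (All.++⁻ʳ ds all′))

        this : ∀ {P : List (Fin n) → Set} → All P blocks → P c
        this all = All.head (All.++⁻ʳ ds (subst (All _) eq all))

        avoids : All (All (λ x → inject₁ x ≢ inject₁ m)) (ds ++ es)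
        avoids = All.tabulate λ c∈ → All.tabulate λ x∈c x≡m →
          proj₂ (proj₂ parts) (∈-++⁺ʳ as (here refl))
            (∈-concat⁺′ (subst (_∈ _) (inject₁-injective x≡m) x∈c) c∈)

      extend-inject-blocks : Blocks (extend α (inject₁ m))
      extend-inject-blocks = record
        { blocks     = c′ ∷ inject₁s (ds ++ es)
        ; represents = record
          { areCycles = cycle-insert α as (this areCycles) (proj₁ parts)
              ∷ All.map⁺ (All.zipWith (λ {c} (isCycle , m∉) → cycle-inject α c isCycle m∉)
                (others areCycles , avoids))
          ; exhaust   = exhaust-extend blocks (c′ ∷ inject₁s (ds ++ es)) exhaust
            (↭-trans inserted (prep _ (map⁺ inject₁ (↭-sym pulled))))
          }
        ; leastFirst = leastFirst-insert as (this leastFirst) ∷ All.map⁺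
          (All.map (λ {c} → leastFirst-inject c) (others leastFirst))
        }
        where
        R = concat (ds ++ es)
        inserted : c′ ++ concat (inject₁s (ds ++ es)) ↭ fromℕ n ∷ map inject₁ (c ++ R)
        inserted = ↭-trans (↭-reflexive (trans (cong (c′ ++_) (concat-map (ds ++ es)))
          (++-assoc (map inject₁ as) _ _)))
          (↭-trans (++⁺ˡ (map inject₁ as) (swap (inject₁ m) (fromℕ n) ↭-refl))
            (↭-trans (shift (fromℕ n) (map inject₁ as) _)
              (prep _ (↭-reflexive (sym (trans (cong (map inject₁) (++-assoc as (m ∷ bs) R))
                (trans (map-++ inject₁ as _) (cong (λ t → map inject₁ as ++ inject₁ m ∷ t)
                  (map-++ inject₁ bs R)))))))))

      private
        corner⇒[] : Linked _<_ c → α ⟨$⟩ʳ m ≤ m → bs ≡ []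
        corner⇒[] = go bs (path-end as (this areCycles))
          where
          path-end : ∀ as → IsCycle α (as ++ m ∷ bs) → ∃ λ j → Path α m bs j
          path-end []       p = _ , p
          path-end (a ∷ as) p = _ , proj₂ (path-++⁻ α as p)
          go : ∀ bs → (∃ λ j → Path α m bs j) → Linked _<_ (as ++ m ∷ bs) → α ⟨$⟩ʳ m ≤ m → bs ≡ []
          go []       _ _ _ = refl
          go (b ∷ bs) (_ , refl , _) l αm≤m with linked-++⁻ʳ as l
          ... | m<b ∷ _ = contradiction αm≤m (ℕ.<⇒≱ m<b)

        linked⇒[] : Linked _<_ c′ → bs ≡ []
        linked⇒[] l = go bs (linked-++⁻ʳ (map inject₁ as) l)
          where
          go : ∀ bs → Linked _<_ (inject₁ m ∷ fromℕ n ∷ map inject₁ bs) → bs ≡ []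
          go []       _ = refl
          go (b ∷ bs) (_ ∷ e<b ∷ _) = contradiction (≤fromℕ (inject₁ b)) (ℕ.<⇒≱ e<b)

        []⇒corner : bs ≡ [] → α ⟨$⟩ʳ m ≤ m
        []⇒corner refl = go as (this areCycles) (this leastFirst)
          where
          go : ∀ as → IsCycle α (as ++ m ∷ []) → LeastFirst (as ++ m ∷ []) → α ⟨$⟩ʳ m ≤ m
          go []       p _     = ≤-reflexive p
          go (a ∷ as) p least = subst (_≤ m) (sym (proj₂ (path-++⁻ α as p)))
            (All.head (All.++⁻ʳ as least))

      -- The new element is the largest, so the cycle stays increasing only if it comes last, that
      -- is, if `bs` is empty. In an increasing cycle listed from its least element this means that
      -- `m` is the entry not mapped to a larger one.
      join-partition : IsPartition α → α ⟨$⟩ʳ m ≤ m → IsPartition (extend α (inject₁ m))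
      join-partition isPartition αm≤m = Blocks.partition extend-inject-blocks
        (increasing (corner⇒[] (this (linked isPartition)) αm≤m) (this (linked isPartition))
          ∷ All.map⁺ (All.map linked-inject (others (linked isPartition))))
        where
        increasing : bs ≡ [] → Linked _<_ c → Linked _<_ c′
        increasing refl = linked-snoc as

      join-partition⁻ : IsPartition (extend α (inject₁ m)) → IsPartition α × α ⟨$⟩ʳ m ≤ m
      join-partition⁻ isPartition with Blocks.linked extend-inject-blocks isPartition
      ... | l ∷ ls = partition (subst (All _) (sym eq)
        (All.++⁺ (All.++⁻ˡ ds rest) (increasing (linked⇒[] l) l ∷ All.++⁻ʳ ds rest)))
          , []⇒corner (linked⇒[] l)
        where
        rest : All (Linked _<_) (ds ++ es)
        rest = All.map linked-inject⁻ (All.map⁻ ls)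
        increasing : bs ≡ [] → Linked _<_ c′ → Linked _<_ c
        increasing refl l = linked-inject⁻ (subst (Linked _<_) (sym (map-++ inject₁ as (m ∷ [])))
          (linked-init (map inject₁ as) l))

  blocks-resp : ∀ {n} {α β : Permutation′ n} → α Perm.≈ β → Blocks α → Blocks β
  blocks-resp {α = α} {β} α≈β B = record
    { blocks     = blocks
    ; represents = record { areCycles = All.map (λ {c} → cycle-resp c) areCycles ; exhaust =
      exhaust }
    ; leastFirst = leastFirst
    }
    where
    open Blocks B
    path-resp : ∀ {i} xs {j} → Path α i xs j → Path β i xs j
    path-resp []       eq       = trans (sym (α≈β _)) eq
    path-resp (x ∷ xs) (eq , p) = trans (sym (α≈β _)) eq , path-resp xs p
    cycle-resp : ∀ c → IsCycle α c → IsCycle β c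
    cycle-resp (i ∷ is) = path-resp is

  split-at : ∀ {n} {α : Permutation′ n} (B : Blocks α) m → ∃₂ λ ds es → ∃₂ λ as bs → Blocks.blocks
    B ≡ ds ++ (as ++ m ∷ bs) ∷ es
  split-at B m with Blocks.covers B m
  ... | c , c∈ , m∈ with ∈-∃++ c∈ | ∈-∃++ m∈
  ...   | ds , es , eq | as , bs , refl = ds , es , as , bs , eq

  Blocks-of : ∀ {n} (α : Permutation′ n) → Blocks α
  Blocks-of {zero}  α = record { blocks = [] ; represents = record
    { areCycles = [] ; exhaust = ↭-refl } ; leastFirst = [] }
  Blocks-of {suc n} β with extend-surjective β
  ... | α , m , eq with view m
  ...   | ‵fromℕ = blocks-resp eq (extend-last-blocks (Blocks-of α))
  ...   | ‵inject₁ j with split-at (Blocks-of α) j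
  ...     | _ , _ , _ , _ , split = blocks-resp eq (extend-inject-blocks (Blocks-of α) split)

  module _ {n} (α : Permutation′ n) where
    private B = Blocks-of α

    z-extend-last : z (extend α (fromℕ n)) ≡ suc (z α)
    z-extend-last = trans (Blocks.z-blocks (extend-last-blocks B))
      (cong suc (trans (length-map (map inject₁) (Blocks.blocks B)) (sym (Blocks.z-blocks B))))

    z-extend-inject : ∀ m → z (extend α (inject₁ m)) ≡ z α
    z-extend-inject m with split-at B m
    ... | ds , es , as , bs , eq = trans (Blocks.z-blocks (extend-inject-blocks B eq))
      (trans (cong suc (trans (length-map (map inject₁) (ds ++ es)) (length-++ ds)))
        (trans (sym (ℕ.+-suc (length ds) (length es)))
          (trans (sym (length-++ ds)) (trans (cong length (sym eq)) (sym (Blocks.z-blocks B))))))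

    partition-extend-last : IsPartition α → IsPartition (extend α (fromℕ n))
    partition-extend-last partition = Blocks.partition (extend-last-blocks B)
      ([-] ∷ All.map⁺ (All.map linked-inject (Blocks.linked B partition)))

    partition-extend-inject : ∀ m → IsPartition α → α ⟨$⟩ʳ m ≤ m → IsPartition
      (extend α (inject₁ m))
    partition-extend-inject m with split-at B m
    ... | _ , _ , _ , _ , eq = join-partition B eq

    partition-extend-inject⁻ : ∀ m → IsPartition (extend α (inject₁ m)) → α ⟨$⟩ʳ m ≤ m
    partition-extend-inject⁻ m partition with split-at B m
    ... | _ , _ , _ , _ , eq = proj₂ (join-partition⁻ B eq partition)

    -- Deleting the largest element from an increasing cycle leaves it increasing; hence a
    -- permutation that is no partition has no partitions among its descendants.
    partition-extend⁻ : ∀ m → IsPartition (extend α m) → IsPartition α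
    partition-extend⁻ m partition with view m
    ... | ‵fromℕ with Blocks.linked (extend-last-blocks B) partition
    ...   | _ ∷ ls = Blocks.partition B (All.map linked-inject⁻ (All.map⁻ ls))
    partition-extend⁻ _ partition | ‵inject₁ j with split-at B j
    ... | _ , _ , _ , _ , eq = proj₁ (join-partition⁻ B eq partition)

  -- Faces

  ζ-last : ∀ n → ζ (suc n) ⟨$⟩ʳ fromℕ n ≡ zero
  ζ-last n = insert-at (fromℕ n) zero Perm.id

  ζ-inject : ∀ n i → ζ (suc n) ⟨$⟩ʳ inject₁ i ≡ suc i
  ζ-inject n i = trans (cong (ζ (suc n) ⟨$⟩ʳ_) (sym (punchIn-fromℕ i)))
    (Perm.insert-punchIn (fromℕ n) zero Perm.id i)

  faceMap : ∀ {n} → Permutation′ n → Permutation′ n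
  faceMap {n} α = ζ n ∘ₚ flip α

  faceMap⁺ : ∀ {n} (α : Permutation′ n) i j → ζ n ⟨$⟩ʳ i ≡ α ⟨$⟩ʳ j → faceMap α ⟨$⟩ʳ i ≡ j
  faceMap⁺ α i j eq = trans (cong (α ⟨$⟩ˡ_) eq) (Perm.inverseˡ α)

  faceMap⁻ : ∀ {n} (α : Permutation′ n) i j → faceMap α ⟨$⟩ʳ i ≡ j → ζ n ⟨$⟩ʳ i ≡ α ⟨$⟩ʳ j
  faceMap⁻ α i j refl = sym (Perm.inverseʳ α)

  -- The cycle through the last element is kept apart because every insertion alters it.
  record Faces {n} (α : Permutation′ (suc n)) : Set where
    field
      current    : List (Fin (suc n))
      others     : List (List (Fin (suc n)))
      represents : Represents (faceMap α) ((fromℕ n ∷ current) ∷ others)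
    open Represents represents public

  module _ {n} {α : Permutation′ (suc n)} (F : Faces α) where
    open Faces F

    private
      e : Fin (suc n)
      e = fromℕ n
      e′ : Fin (suc (suc n))
      e′ = fromℕ (suc n)

      ζ-inject-≢ : ∀ {i} → i ≢ e → ζ (suc (suc n)) ⟨$⟩ʳ inject₁ i ≡ inject₁ (ζ (suc n) ⟨$⟩ʳ i)
      ζ-inject-≢ {i} i≢e with view i
      ... | ‵fromℕ     = contradiction refl i≢e
      ... | ‵inject₁ j = trans (ζ-inject (suc n) (inject₁ j)) (cong inject₁ (sym (ζ-inject n j)))

      ζ-new : ζ (suc (suc n)) ⟨$⟩ʳ e′ ≡ inject₁ (ζ (suc n) ⟨$⟩ʳ e)
      ζ-new = trans (ζ-last (suc n)) (cong inject₁ (sym (ζ-last n)))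

    module _ (m : Fin (suc (suc n))) where
      private
        α′ = extend α m
        φ  = faceMap α
        φ′ = faceMap α′

      faceMap-last : φ′ ⟨$⟩ʳ inject₁ e ≡ m
      faceMap-last = faceMap⁺ α′ (inject₁ e) m (trans (ζ-inject (suc n) e) (sym (extend-at α m)))

      -- The ends may change along with the permutation: the new element takes over the step that
      -- left `e`, since ζ sends both to the first element, and the step that entered `m`, since it
      -- takes over the image of `m`. All other steps remain, and `e` itself now goes to `m`.
      face-path : ∀ {i i′} xs {j j′} → ζ (suc (suc n)) ⟨$⟩ʳ i′ ≡ inject₁ (ζ (suc n) ⟨$⟩ʳ i) →
        Path φ i xs j → All (λ x → x ≢ e × inject₁ x ≢ m) xs → α′ ⟨$⟩ʳ j′ ≡ inject₁ (α ⟨$⟩ʳ j) →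
        Path φ′ i′ (map inject₁ xs) j′
      face-path {i} {i′} [] {j} {j′} source eq [] target = faceMap⁺ α′ i′ j′
        (trans source (trans (cong inject₁ (faceMap⁻ α i j eq)) (sym target)))
      face-path {i} {i′} (x ∷ xs) source (eq , p) ((x≢e , x≢m) ∷ avoid) target =
          faceMap⁺ α′ i′ (inject₁ x) (trans source (trans (cong inject₁ (faceMap⁻ α i x eq))
            (sym (extend-other α m x x≢m))))
        , face-path xs (ζ-inject-≢ x≢e) p avoid target

      face-cycle : ∀ c → IsCycle φ c → All (λ x → x ≢ e × inject₁ x ≢ m) c → IsCycle φ′
        (map inject₁ c)
      face-cycle (i ∷ is) p ((i≢e , i≢m) ∷ avoid) = face-path is (ζ-inject-≢ i≢e) p avoid
        (extend-other α m i i≢m)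

      extendFaces : ∀ xs cs → Path φ′ e′ (map inject₁ xs) e′ → All (IsCycle φ′ ∘ map inject₁) cs →
        xs ++ concat cs ↭ e ∷ current ++ concat others → Faces α′
      extendFaces xs cs path areCycles′ exhaust′ = record
        { current = map inject₁ xs
        ; others  = inject₁s cs
        ; represents = record
          { areCycles = path ∷ All.map⁺ areCycles′
          ; exhaust   = exhaust-extend ((e ∷ current) ∷ others)
            ((e′ ∷ map inject₁ xs) ∷ inject₁s cs) exhaust
              (prep e′ (↭-trans (↭-reflexive (trans (cong (map inject₁ xs ++_) (concat-map cs))
                (sym (map-++ inject₁ xs (concat cs)))))
                (map⁺ inject₁ exhaust′)))
          }
        }

    private
      φ = faceMap α

      current-path : Path φ e current e
      current-path = All.head areCycles

      e∉ : All (_≢ e) (current ++ concat others)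
      e∉ with unique
      ... | e≢ ∷ _ = All.map (λ ≢ → ≢ ∘ sym) e≢

      e≢current : All (_≢ e) current
      e≢current = All.++⁻ˡ current e∉

      unique′ : Unique (current ++ concat others)
      unique′ with unique
      ... | _ ∷ u = u

      e≢others : ∀ {c} → c ∈ others → All (_≢ e) c
      e≢others c∈ = All.tabulate λ x∈ → All.lookup (All.++⁻ʳ current e∉) (∈-concat⁺′ x∈ c∈)

      inject₁≢ : ∀ {m} → m ∉ current → All (λ x → x ≢ e × inject₁ x ≢ inject₁ m) current
      inject₁≢ m∉ = All.tabulate λ x∈ → All.lookup e≢current x∈ , λ eq → m∉
        (subst (_∈ current) (inject₁-injective eq) x∈)

    -- The stack, bottom first: the current face read from the successor of `e` round to `e` itself,
    -- the top.
    line : List (Fin (suc n))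
    line = current ++ e ∷ []

    private
      others-cycles : ∀ m {cs} → (∀ {c} → c ∈ cs → c ∈ others) →
        (∀ {c x} → c ∈ cs → x ∈ c → inject₁ x ≢ m) →
        All (IsCycle (faceMap (extend α m)) ∘ map inject₁) cs
      others-cycles m ⊆ ≢m = All.tabulate λ {c} c∈ → face-cycle m c
        (All.lookup (All.tail areCycles) (⊆ c∈))
        (All.tabulate λ x∈ → All.lookup (e≢others (⊆ c∈)) x∈ , ≢m c∈ x∈)

    singletonFaces : Faces (extend α e′)
    singletonFaces = extendFaces e′ line others
      (subst (λ xs → Path (faceMap (extend α e′)) e′ xs e′) (sym (map-++ inject₁ current (e ∷ [])))
        (path-++⁺ (faceMap (extend α e′)) (map inject₁ current)
          (face-path e′ current ζ-new current-path (All.map (λ x≢e → x≢e , fromℕ≢inject₁ ∘ sym)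
            e≢current) (extend-other α e′ e (fromℕ≢inject₁ ∘ sym)))
          (faceMap-last e′)))
      (others-cycles e′ (λ c∈ → c∈) (λ _ _ → fromℕ≢inject₁ ∘ sym))
      (↭-trans (↭-reflexive (++-assoc current (e ∷ []) (concat others)))
        (shift e current (concat others)))

    -- The entry into `m` is redirected to the new element, which closes the cycle through `xs`; the
    -- new step from `e` to `m` closes the cycle of `m` and `ys`.
    popFaces : ∀ xs {m ys} → line ≡ xs ++ m ∷ ys → Faces (extend α (inject₁ m))
    popFaces xs {m} {ys} eq = extendFaces (inject₁ m) xs ((m ∷ ys) ∷ others) (proj₁ paths)
      (proj₂ paths ∷ others-cycles (inject₁ m) (λ c∈ → c∈)
        (λ c∈ x∈ x≡m → m∉others (∈-concat⁺′ (subst (_∈ _) (inject₁-injective x≡m) x∈) c∈)))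
      (subst (_↭ e ∷ current ++ concat others) (trans (cong (_++ concat others) eq)
        (++-assoc xs (m ∷ ys) (concat others)))
        (↭-trans (↭-reflexive (++-assoc current (e ∷ []) (concat others)))
          (shift e current (concat others))))
      where
      φ′ = faceMap (extend α (inject₁ m))
      line-unique : Unique (line ++ concat others)
      line-unique = unique-resp-↭
        (↭-sym (↭-trans (↭-reflexive (++-assoc current (e ∷ []) (concat others)))
        (shift e current (concat others)))) unique
      m∉others : m ∉ concat others
      m∉others = proj₂ (proj₂ (unique-++⁻ line line-unique))
        (subst (m ∈_) (sym eq) (∈-++⁺ʳ xs (here refl)))
      paths : Path φ′ e′ (map inject₁ xs) e′ × Path φ′ (inject₁ m) (map inject₁ ys) (inject₁ m)
      -- Either `m` is `e`, the top of the stack, and becomes a face by itself, or `ys` ends with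
      -- `e`.
      paths with initLast ys
      ... | [] with ∷ʳ-injective current xs eq
      ...   | refl , refl = face-path (inject₁ e) current ζ-new current-path
        (inject₁≢ λ e∈ → All.lookup e≢current e∈ refl) (trans (extend-last α e) refl)
                          , faceMap-last (inject₁ e)
      paths | zs ∷ʳ′ z with ∷ʳ-injective current (xs ++ m ∷ zs)
        (trans eq (sym (++-assoc xs (m ∷ zs) (z ∷ []))))
      ... | eq′ , refl = face-path (inject₁ m) xs ζ-new p₁ avoid-xs (extend-last α m)
          , subst (λ ts → Path φ′ (inject₁ m) ts (inject₁ m)) (sym (map-++ inject₁ zs (e ∷ [])))
              (path-++⁺ φ′ (map inject₁ zs)
                (face-path (inject₁ m) zs (ζ-inject-≢ m≢e) p₂ avoid-zs
                  (extend-other α (inject₁ m) e (m≢e ∘ sym ∘ inject₁-injective)))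
                (faceMap-last (inject₁ m)))
        where
        p₁ = proj₁ (path-++⁻ φ xs (subst (λ ts → Path φ e ts e) eq′ current-path))
        p₂ = proj₂ (path-++⁻ φ xs (subst (λ ts → Path φ e ts e) eq′ current-path))
        split = unique-++⁻ xs (subst Unique eq′ (proj₁ (unique-++⁻ current unique′)))
        ≢e : All (_≢ e) (xs ++ m ∷ zs)
        ≢e = subst (All (_≢ e)) eq′ e≢current
        avoid-xs : All (λ x → x ≢ e × inject₁ x ≢ inject₁ m) xs
        avoid-xs = All.tabulate λ x∈ → All.lookup (All.++⁻ˡ xs ≢e) x∈ ,
          λ x≡m → proj₂ (proj₂ split) x∈ (here (inject₁-injective x≡m))
        avoid-zs : All (λ x → x ≢ e × inject₁ x ≢ inject₁ m) zs
        avoid-zs with proj₁ (proj₂ split)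
        ... | m∉ ∷ _ = All.zipWith (λ (x≢e , m≢x) → x≢e , λ x≡m → m≢x
          (sym (inject₁-injective x≡m))) (All.tail (All.++⁻ʳ xs ≢e) , m∉)
        m≢e : m ≢ e
        m≢e = All.head (All.++⁻ʳ xs ≢e)

    -- From `e` the new face enters the other face at `m`, runs round it, and, where it would return
    -- to `m`, goes to the new element instead.
    mergeFaces : ∀ ds {as m bs es} → others ≡ ds ++ (as ++ m ∷ bs) ∷ es → Faces
      (extend α (inject₁ m))
    mergeFaces ds {as} {m} {bs} {es} eq = extendFaces (inject₁ m) (current ++ e ∷ m ∷ bs ++ as)
      (ds ++ es)
      (subst (λ ts → Path φ′ e′ ts e′) (sym (map-++ inject₁ current (e ∷ m ∷ bs ++ as)))
        (path-++⁺ φ′ (map inject₁ current)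
          (face-path (inject₁ m) current ζ-new current-path (inject₁≢ m∉current)
            (extend-other α (inject₁ m) e (m≢e ∘ sym ∘ inject₁-injective)))
          (faceMap-last (inject₁ m) , face-path (inject₁ m) (bs ++ as) (ζ-inject-≢ m≢e)
            (rotate φ as face) avoid (extend-last α m))))
      (others-cycles (inject₁ m) rest⊆ λ c∈ x∈ x≡m →
        proj₂ (proj₂ parts) (∈-++⁺ʳ as (here refl))
          (∈-concat⁺′ (subst (_∈ _) (inject₁-injective x≡m) x∈) c∈))
      (↭-trans (↭-reflexive (++-assoc current (e ∷ m ∷ bs ++ as) (concat (ds ++ es))))
        (↭-trans (shift e current (m ∷ (bs ++ as) ++ concat (ds ++ es)))
          (prep e (++⁺ˡ current (↭-trans (++⁺ʳ (concat (ds ++ es)) (++-comm (m ∷ bs) as))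
            (↭-sym pulled))))))
      where
      φ′ = faceMap (extend α (inject₁ m))
      c = as ++ m ∷ bs
      pulled : concat others ↭ c ++ concat (ds ++ es)
      pulled = subst (λ cs → concat cs ↭ c ++ concat (ds ++ es)) (sym eq) (concat-pull ds c)
      parts : Unique c × Unique (concat (ds ++ es)) × (∀ {i} → i ∈ c → i ∉ concat (ds ++ es))
      parts = unique-++⁻ c (unique-resp-↭ pulled (proj₁ (proj₂ (unique-++⁻ current unique′))))
      c∈others : c ∈ others
      c∈others = subst (c ∈_) (sym eq) (∈-++⁺ʳ ds (here refl))
      rest⊆ : ∀ {d} → d ∈ ds ++ es → d ∈ others
      rest⊆ {d} d∈ with ∈-++⁻ ds d∈
      ... | inj₁ d∈ds = subst (d ∈_) (sym eq) (∈-++⁺ˡ d∈ds)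
      ... | inj₂ d∈es = subst (d ∈_) (sym eq) (∈-++⁺ʳ ds (there d∈es))
      face : IsCycle φ c
      face = All.lookup (All.tail areCycles) c∈others
      m∈c : m ∈ c
      m∈c = ∈-++⁺ʳ as (here refl)
      m≢e : m ≢ e
      m≢e = All.lookup (e≢others c∈others) m∈c
      m∉current : m ∉ current
      m∉current m∈ = proj₂ (proj₂ (unique-++⁻ current unique′)) m∈ (∈-concat⁺′ m∈c c∈others)
      avoid : All (λ x → x ≢ e × inject₁ x ≢ inject₁ m) (bs ++ as)
      avoid with unique-resp-↭ (++-comm as (m ∷ bs)) (proj₁ parts)
      ... | m∉ ∷ _ = All.tabulate λ {x} x∈ →
          All.lookup (e≢others c∈others) (∈-resp-↭ (++-comm (m ∷ bs) as) (there x∈))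
        , λ x≡m → All.lookup m∉ x∈ (sym (inject₁-injective x≡m))

  -- Counting the maxima on the faces

  module _ {n} (α : Permutation′ n) where

    -- In a partition these are the greatest elements of the parts.
    isCorner : Fin n → Bool
    isCorner i = toℕ (α ⟨$⟩ʳ i) ≤ᵇ toℕ i

    corners : List (Fin n) → ℕ
    corners []       = 0
    corners (i ∷ is) = (if isCorner i then 1 else 0) + corners is

    corners-++ : ∀ is js → corners (is ++ js) ≡ corners is + corners js
    corners-++ []       js = refl
    corners-++ (i ∷ is) js = trans (cong (_ +_) (corners-++ is js))
      (sym (ℕ.+-assoc (if isCorner i then 1 else 0) _ _))

    sum-corners : ∀ {g : Fin n → ℕ} {h} is → (∀ {i} → i ∈ is → g i ≡
      (if isCorner i then h else 0)) → sum (map g is) ≡ corners is * h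
    sum-corners []       g≡ = refl
    sum-corners (i ∷ is) g≡ with isCorner i | g≡ (here refl)
    ... | true  | eq = cong₂ _+_ eq (sum-corners is (g≡ ∘ there))
    ... | false | eq = cong₂ _+_ eq (sum-corners is (g≡ ∘ there))

    -- Only maxima contribute. The maximum at height j of the stack leaves j - 1 maxima below and
    -- cuts off those above, so the positions become the splittings of the level.
    sum-line : ∀ {g : Fin n → ℕ} {h : ℕ → ℕ → ℕ} is →
      (∀ js {i ks} → is ≡ js ++ i ∷ ks → g i ≡ (if isCorner i then h (suc (corners js))
      (corners ks) else 0)) →
      sum (map g is) ≡ splitSum h (corners is)
    sum-line []       g≡ = refl
    sum-line {g} {h} (i ∷ is) g≡ with isCorner i in eq | g≡ [] refl
    ... | true  | head = cong₂ _+_ head (sum-line {g} {h ∘ suc} is λ js {i′} {ks} split → trans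
      (g≡ (i ∷ js) (cong (i ∷_) split))
      (cong (λ b → if isCorner i′ then h (suc ((if b then 1 else 0) + corners js)) (corners ks)
        else 0) eq))
    ... | false | head = cong₂ _+_ head (sum-line {g} {h} is λ js {i′} {ks} split → trans
      (g≡ (i ∷ js) (cong (i ∷_) split))
      (cong (λ b → if isCorner i′ then h (suc ((if b then 1 else 0) + corners js)) (corners ks)
        else 0) eq))

    -- All maxima of one face lead to the same state, which explains the factor c.
    sum-others : ∀ {g : Fin n → ℕ} {h : ℕ → List ℕ → ℕ} cs →
      (∀ ds {as i bs es} → cs ≡ ds ++ (as ++ i ∷ bs) ∷ es →
        g i ≡ (if isCorner i then h (corners (as ++ i ∷ bs)) (map corners (ds ++ es)) else 0)) →
      sum (map g (concat cs)) ≡ removeSum (λ c r → c * h c r) (map corners cs)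
    sum-others []       g≡ = refl
    sum-others {g} {h} (c ∷ cs) g≡ = trans (cong sum (map-++ g c (concat cs)))
      (trans (sum-++ (map g c) _)
      (cong₂ _+_ (sum-corners c λ i∈c → this i∈c) (sum-others {g} {λ c′ r → h c′ (corners c ∷ r)}
        cs λ ds eq → g≡ (c ∷ ds) (cong (c ∷_) eq))))
      where
      this : ∀ {i} → i ∈ c → g i ≡ (if isCorner i then h (corners c) (map corners cs) else 0)
      this i∈c with ∈-∃++ i∈c
      ... | as , bs , refl = g≡ [] refl

  module _ {n} (α : Permutation′ n) where

    isCorner-other : ∀ m i → inject₁ i ≢ m → isCorner (extend α m) (inject₁ i) ≡ isCorner α i
    isCorner-other m i i≢m = cong₂ _≤ᵇ_ (trans (cong toℕ (extend-other α m i i≢m))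
      (toℕ-inject₁ _)) (toℕ-inject₁ i)

    -- The image of `m` is now the new, larger element: `m` is no longer the maximum of its part.
    isCorner-at : ∀ m → isCorner (extend α (inject₁ m)) (inject₁ m) ≡ false
    isCorner-at m = ≰⇒false λ le → ℕ.<⇒≱ (inject₁<fromℕ m)
      (subst (λ i → toℕ i ℕ.≤ toℕ (inject₁ m)) (extend-at α (inject₁ m)) (ℕ.≤ᵇ⇒≤ _ _ le))
      where
      ≰⇒false : ∀ {b} → (T b → ⊥) → b ≡ false
      ≰⇒false {false} _ = refl
      ≰⇒false {true}  f = ⊥-elim (f _)

    corners-inject : ∀ m is → All (λ i → inject₁ i ≢ m) is → corners (extend α m) (map inject₁ is)
      ≡ corners α is
    corners-inject m []       []         = refl
    corners-inject m (i ∷ is) (i≢m ∷ ≢m) = cong₂ (λ b c → (if b then 1 else 0) + c)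
      (isCorner-other m i i≢m) (corners-inject m is ≢m)

    corners-at : ∀ m is → All (_≢ m) is → corners (extend α (inject₁ m)) (map inject₁ (m ∷ is)) ≡
      corners α is
    corners-at m is ≢m = cong₂ (λ b c → (if b then 1 else 0) + c) (isCorner-at m)
      (corners-inject (inject₁ m) is (All.map (_∘ inject₁-injective) ≢m))

  isCorner-last : ∀ {n} (α : Permutation′ (suc n)) → isCorner α (fromℕ n) ≡ true
  isCorner-last α = Equivalence.to T-≡ (ℕ.≤⇒≤ᵇ (≤fromℕ (α ⟨$⟩ʳ fromℕ _)))

  isCorner⁺ : ∀ {n} (α : Permutation′ n) {i} → α ⟨$⟩ʳ i ≤ i → isCorner α i ≡ true
  isCorner⁺ α le = Equivalence.to T-≡ (ℕ.≤⇒≤ᵇ le)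

  isCorner⁻ : ∀ {n} (α : Permutation′ n) {i} → isCorner α i ≡ true → α ⟨$⟩ʳ i ≤ i
  isCorner⁻ α eq = ℕ.≤ᵇ⇒≤ _ _ (Equivalence.from T-≡ eq)

  module _ {n} {α : Permutation′ (suc n)} (F : Faces α) where
    open Faces F

    level : ℕ
    level = corners α (line F)

    bag : List ℕ
    bag = map (corners α) others

    line↭ : line F ++ concat others ↭ concat ((fromℕ n ∷ current) ∷ others)
    line↭ = ↭-trans (↭-reflexive (++-assoc current (fromℕ n ∷ []) (concat others)))
      (shift (fromℕ n) current (concat others))

    line-unique : Unique (line F ++ concat others)
    line-unique = unique-resp-↭ (↭-sym line↭) unique

    private
      level-extend : ∀ m is → corners (extend α m) (map inject₁ is ++ fromℕ (suc n) ∷ []) ≡ suc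
        (corners (extend α m) (map inject₁ is))
      level-extend m is = trans (corners-++ (extend α m) (map inject₁ is) _)
        (trans (cong (λ b → corners (extend α m) (map inject₁ is) + ((if b then 1 else 0) + 0))
          (isCorner-last (extend α m)))
          (ℕ.+-comm _ 1))

      bag-extend : ∀ m cs → (∀ {c i} → c ∈ cs → i ∈ c → inject₁ i ≢ m) → map
        (corners (extend α m)) (inject₁s cs) ≡ map (corners α) cs
      bag-extend m cs ≢m = trans (sym (map-∘ cs)) (map-cong-local
        (All.tabulate λ {c} c∈ → corners-inject α m c (All.tabulate (≢m c∈))))

    singleton-level : corners (extend α (fromℕ (suc n))) (line (singletonFaces F)) ≡ suc level
    singleton-level = trans (level-extend _ (line F))
      (cong suc (corners-inject α _ (line F) (All.tabulate λ _ → fromℕ≢inject₁ ∘ sym)))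

    singleton-bag : map (corners (extend α (fromℕ (suc n)))) (Faces.others (singletonFaces F)) ≡ bag
    singleton-bag = bag-extend _ others (λ _ _ → fromℕ≢inject₁ ∘ sym)

    module _ xs {m ys} (eq : line F ≡ xs ++ m ∷ ys) where
      private
        split : Unique (xs ++ m ∷ ys) × Unique (concat others) ×
          (∀ {i} → i ∈ xs ++ m ∷ ys → i ∉ concat others)
        split = unique-++⁻ (xs ++ m ∷ ys) (subst (λ is → Unique (is ++ concat others)) eq
          line-unique)
        split′ : Unique xs × Unique (m ∷ ys) × (∀ {i} → i ∈ xs → i ∉ m ∷ ys)
        split′ = unique-++⁻ xs (proj₁ split)
        m≢ys : All (_≢ m) ys
        m≢ys with proj₁ (proj₂ split′)
        ... | m∉ ∷ _ = All.map (_∘ sym) m∉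

      -- The successor accounts for the new element, which is the maximum of its part and the new
      -- top of the stack.
      pop-level : corners (extend α (inject₁ m)) (line (popFaces F xs eq)) ≡ suc (corners α xs)
      pop-level = trans (level-extend (inject₁ m) xs) (cong suc (corners-inject α (inject₁ m) xs
        (All.tabulate λ x∈ x≡m → proj₂ (proj₂ split′) x∈ (here (inject₁-injective x≡m)))))

      pop-bag : map (corners (extend α (inject₁ m))) (Faces.others (popFaces F xs eq)) ≡ corners α
        ys ∷ bag
      pop-bag = cong₂ _∷_ (corners-at α m ys m≢ys) (bag-extend (inject₁ m) others λ c∈ x∈ x≡m →
        proj₂ (proj₂ split) (∈-++⁺ʳ xs (here refl))
          (∈-concat⁺′ (subst (_∈ _) (inject₁-injective x≡m) x∈) c∈))

    module _ ds {as m bs es} (eq : others ≡ ds ++ (as ++ m ∷ bs) ∷ es)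
      (corner : isCorner α m ≡ true) where
      private
        c = as ++ m ∷ bs
        α′ = extend α (inject₁ m)
        pulled : concat others ↭ c ++ concat (ds ++ es)
        pulled = subst (λ cs → concat cs ↭ c ++ concat (ds ++ es)) (sym eq) (concat-pull ds c)
        split : Unique (line F) × Unique (concat others) × (∀ {i} → i ∈ line F → i ∉ concat others)
        split = unique-++⁻ (line F) line-unique
        split′ : Unique c × Unique (concat (ds ++ es)) × (∀ {i} → i ∈ c → i ∉ concat (ds ++ es))
        split′ = unique-++⁻ c (unique-resp-↭ pulled (proj₁ (proj₂ split)))
        m∉line : All (_≢ m) (line F)
        m∉line = All.tabulate λ x∈ → λ { refl → proj₂ (proj₂ split) x∈
          (∈-concat⁺′ (∈-++⁺ʳ as (here refl)) (subst (c ∈_) (sym eq) (∈-++⁺ʳ ds (here refl)))) }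
        m∉rest : All (_≢ m) (bs ++ as)
        m∉rest with unique-resp-↭ (++-comm as (m ∷ bs)) (proj₁ split′)
        ... | m∉ ∷ _ = All.map (_∘ sym) m∉

      -- The face loses the maximum `m` on merging, and the new element makes up for it.
      merge-level : corners α′ (line (mergeFaces F ds eq)) ≡ level + corners α c
      merge-level = begin
        corners α′ (map inject₁ (current ++ fromℕ n ∷ m ∷ bs ++ as) ++ fromℕ (suc n) ∷ [])
          ≡⟨ level-extend (inject₁ m) (current ++ fromℕ n ∷ m ∷ bs ++ as) ⟩
        suc (corners α′ (map inject₁ (current ++ fromℕ n ∷ m ∷ bs ++ as)))
          ≡⟨ cong (λ is → suc (corners α′ (map inject₁ is)))
            (++-assoc current (fromℕ n ∷ []) (m ∷ bs ++ as)) ⟨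
        suc (corners α′ (map inject₁ (line F ++ m ∷ bs ++ as)))
          ≡⟨ cong (suc ∘ corners α′) (map-++ inject₁ (line F) (m ∷ bs ++ as)) ⟩
        suc (corners α′ (map inject₁ (line F) ++ map inject₁ (m ∷ bs ++ as)))
          ≡⟨ cong suc (corners-++ α′ (map inject₁ (line F)) _) ⟩
        suc (corners α′ (map inject₁ (line F)) + corners α′ (map inject₁ (m ∷ bs ++ as)))
          ≡⟨ cong suc (cong₂ _+_ (corners-inject α (inject₁ m) (line F)
            (All.map (_∘ inject₁-injective) m∉line)) (corners-at α m (bs ++ as) m∉rest)) ⟩
        suc (level + corners α (bs ++ as))
          ≡⟨ ℕ.+-suc level _ ⟨
        level + suc (corners α (bs ++ as))
          ≡⟨ cong (λ b → level + ((if b then 1 else 0) + corners α (bs ++ as))) corner ⟨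
        level + corners α (m ∷ bs ++ as)
          ≡⟨ cong (level +_) (trans (corners-++ α (m ∷ bs) as)
            (trans (ℕ.+-comm (corners α (m ∷ bs)) _) (sym (corners-++ α as (m ∷ bs))))) ⟩
        level + corners α c ∎
        where open ≡-Reasoning

      merge-bag : map (corners α′) (Faces.others (mergeFaces F ds eq)) ≡ map (corners α) (ds ++ es)
      merge-bag = bag-extend (inject₁ m) (ds ++ es) λ c∈ x∈ x≡m →
        proj₂ (proj₂ split′) (∈-++⁺ʳ as (here refl))
          (∈-concat⁺′ (subst (_∈ _) (inject₁-injective x≡m) x∈) c∈)

  -- Counting the partitions

  minus⇒plus : ∀ a b c → ℤ.+ a ℤ.- ℤ.+ b ≡ ℤ.+ c → a ≡ c + b
  minus⇒plus a b c eq = ℤ.+-injective (begin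
    ℤ.+ a                                ≡⟨ ℤ.+-identityʳ (ℤ.+ a) ⟨
    ℤ.+ a ℤ.+ ℤ.0ℤ                       ≡⟨ cong (λ t → ℤ.+ a ℤ.+ t) (ℤ.+-inverseˡ (ℤ.+ b)) ⟨
    ℤ.+ a ℤ.+ (ℤ.- ℤ.+ b ℤ.+ ℤ.+ b)      ≡⟨ ℤ.+-assoc (ℤ.+ a) (ℤ.- ℤ.+ b) (ℤ.+ b) ⟨
    ℤ.+ a ℤ.- ℤ.+ b ℤ.+ ℤ.+ b            ≡⟨ cong (λ t → t ℤ.+ ℤ.+ b) eq ⟩
    ℤ.+ (c + b)                          ∎)
    where open ≡-Reasoning

  plus⇒minus : ∀ a b c → a ≡ c + b → ℤ.+ a ℤ.- ℤ.+ b ≡ ℤ.+ c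
  plus⇒minus _ b c refl = begin
    ℤ.+ c ℤ.+ ℤ.+ b ℤ.- ℤ.+ b            ≡⟨ ℤ.+-assoc (ℤ.+ c) (ℤ.+ b) (ℤ.- ℤ.+ b) ⟩
    ℤ.+ c ℤ.+ (ℤ.+ b ℤ.- ℤ.+ b)          ≡⟨ cong (λ t → ℤ.+ c ℤ.+ t) (ℤ.+-inverseʳ (ℤ.+ b)) ⟩
    ℤ.+ c ℤ.+ ℤ.0ℤ                       ≡⟨ ℤ.+-identityʳ (ℤ.+ c) ⟩
    ℤ.+ c                                ∎
    where open ≡-Reasoning

  module _ (k : ℕ) where

    -- As walkCount, but γ and b are the numbers of merges and pushes already made.

    walks : (N γ b l : ℕ) → List ℕ → ℕ
    walks zero    γ b l cs = if does (γ ℕ.≟ 2 ×-dec b ℕ.≟ k) then 1 else 0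
    walks (suc N) γ b l cs = walks N γ (suc b) (suc l) cs +
      (splitSum (λ j c → walks N γ b j (c ∷ cs)) l + removeSum
        (λ c r → c * walks N (suc γ) b (l + c) r) cs)

    walks-cong : ∀ N γ {b b′ l l′ cs cs′} → b ≡ b′ → l ≡ l′ → cs ≡ cs′ → walks N γ b l cs ≡ walks
      N γ b′ l′ cs′
    walks-cong N γ refl refl refl = refl

    -- `α` permutes n + 1 elements, so the last hypothesis says that its genus is `γ`: the number of
    -- merges made so far.
    partition-indicator : ∀ {n} (α : Permutation′ (suc n)) (F : Faces α) γ → IsPartition α →
      n + 2 ≡ (z α + suc (length (Faces.others F))) + 2 * γ → indicator k α ≡ walks 0 γ (z α) 0 []
    partition-indicator {n} α F γ partition euler = cong (λ b → if b then 1 else 0)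
      (does-⇔ (mk⇔ to from)
      (genus2Partition? k α) (γ ℕ.≟ 2 ×-dec z α ℕ.≟ k))
      where
      S = z α + suc (length (Faces.others F))
      z-sum : z α + z (faceMap α) ≡ S
      z-sum = cong (z α +_) (z-represents (faceMap α) (Faces.represents F))
      size : suc n + 1 ≡ S + 2 * γ
      size = trans (sym (ℕ.+-suc n 1)) euler
      to : Genus2Partition k α → γ ≡ 2 × z α ≡ k
      to (_ , genus , zα≡k) = ℕ.*-cancelˡ-≡ γ 2 2 (ℕ.+-cancelˡ-≡ S _ _ (trans (sym size)
        (trans (minus⇒plus (suc n + 1) 4 _ genus) (cong (_+ 4) z-sum)))) , zα≡k
      from : γ ≡ 2 × z α ≡ k → Genus2Partition k α
      from (refl , zα≡k) = partition , plus⇒minus (suc n + 1) 4 _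
        (trans size (cong (_+ 4) (sym z-sum))) , zα≡k

    sum-extensions : ∀ {n} (f : Fin (suc n) → ℕ) → sum (map f (allFin (suc n))) ≡ f (fromℕ n) +
      sum (map (f ∘ inject₁) (allFin n))
    sum-extensions {n} f = trans (sum-↭ (map⁺ f (allFin-last n)))
      (cong (λ ms → f (fromℕ n) + sum ms) (sym (map-∘ (allFin n))))

    no-descendants : ∀ N {n} (α : Permutation′ n) → ¬ IsPartition α → descendants k N α ≡ 0
    no-descendants zero    α ¬partition = cong (λ b → if b then 1 else 0)
      (dec-false (genus2Partition? k α) (¬partition ∘ proj₁))
    no-descendants (suc N) {n} α ¬partition = zeros (allFin (suc n))
      where
      zeros : ∀ ms → sum (map (λ m → descendants k N (extend α m)) ms) ≡ 0
      zeros []       = refl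
      zeros (m ∷ ms) = cong₂ _+_ (no-descendants N (extend α m)
        (¬partition ∘ partition-extend⁻ α m)) (zeros ms)

    -- Each insertion adds 1 to the left side of the genus equation. On the right a push adds a part
    -- and a pop adds a face, whereas a merge removes a face and must therefore raise `γ` by 1.
    descendants-walks : ∀ N {n} (α : Permutation′ (suc n)) (F : Faces α) γ → IsPartition α →
      n + 2 ≡ (z α + suc (length (Faces.others F))) + 2 * γ →
      descendants k N α ≡ walks N γ (z α) (level F) (bag F)
    descendants-walks zero    α F γ partition euler = partition-indicator α F γ partition euler
    descendants-walks (suc N) {n} α F γ partition euler = begin
      sum (map f (allFin (suc (suc n))))
        ≡⟨ sum-extensions f ⟩
      f (fromℕ (suc n)) + sum (map g (allFin (suc n)))
        ≡⟨ cong₂ _+_ singleton (trans (sum-↭ (map⁺ g (↭-trans (↭-sym exhaust) (↭-sym (line↭ F)))))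
             (trans (cong sum (map-++ g (line F) (concat others))) (sum-++ (map g (line F)) _))) ⟩
      walks N γ (suc (z α)) (suc (level F)) (bag F) +
        (sum (map g (line F)) + sum (map g (concat others)))
        ≡⟨ cong (walks N γ (suc (z α)) (suc (level F)) (bag F) +_) (cong₂ _+_
             (sum-line α {g} {λ j c → walks N γ (z α) j (c ∷ bag F)} (line F) pop)
             (sum-others α {g} {λ c r → walks N (suc γ) (z α) (level F + c) r} others merge)) ⟩
      walks (suc N) γ (z α) (level F) (bag F) ∎
      where
      open ≡-Reasoning
      open Faces F
      f : Fin (suc (suc n)) → ℕ
      f m = descendants k N (extend α m)
      g : Fin (suc n) → ℕ
      g = f ∘ inject₁

      singleton : f (fromℕ (suc n)) ≡ walks N γ (suc (z α)) (suc (level F)) (bag F)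
      singleton = trans (descendants-walks N (extend α (fromℕ (suc n))) (singletonFaces F) γ
        (partition-extend-last α partition)
          (trans (cong suc euler) (cong₂ (λ a b → (a + suc b) + 2 * γ) (sym (z-extend-last α))
            (sym (length-map (map inject₁) others)))))
        (walks-cong N γ (z-extend-last α) (singleton-level F) (singleton-bag F))

      -- Joining a part elsewhere than at its maximum destroys the partition for good, so such
      -- positions count 0.
      corner-case : ∀ m {h} → (isCorner α m ≡ true → g m ≡ h) → g m ≡
        (if isCorner α m then h else 0)
      corner-case m eq with isCorner α m in corner
      ... | true  = eq refl
      ... | false = no-descendants N (extend α (inject₁ m)) λ partition′ →
        case trans (sym corner) (isCorner⁺ α (partition-extend-inject⁻ α m partition′)) of λ ()

      pop : ∀ xs {m ys} → line F ≡ xs ++ m ∷ ys →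
        g m ≡ (if isCorner α m then walks N γ (z α) (suc (corners α xs)) (corners α ys ∷ bag F)
          else 0)
      pop xs {m} {ys} eq = corner-case m λ corner →
        trans (descendants-walks N (extend α (inject₁ m)) (popFaces F xs eq) γ
          (partition-extend-inject α m partition (isCorner⁻ α corner))
          (trans (cong suc euler) (trans (solve-∀′ (z α) (length others) γ)
            (cong₂ (λ a b → (a + suc b) + 2 * γ) (sym (z-extend-inject α m))
              (cong suc (sym (length-map (map inject₁) others)))))))
        (walks-cong N γ (z-extend-inject α m) (pop-level F xs eq) (pop-bag F xs eq))
        where
        solve-∀′ : ∀ a b γ → suc ((a + suc b) + 2 * γ) ≡ (a + suc (suc b)) + 2 * γ
        solve-∀′ = solve-∀

      merge : ∀ ds {as m bs es} → others ≡ ds ++ (as ++ m ∷ bs) ∷ es →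
        g m ≡ (if isCorner α m then walks N (suc γ) (z α) (level F + corners α (as ++ m ∷ bs))
          (map (corners α) (ds ++ es)) else 0)
      merge ds {as} {m} {bs} {es} eq = corner-case m λ corner →
        trans (descendants-walks N (extend α (inject₁ m)) (mergeFaces F ds eq) (suc γ)
          (partition-extend-inject α m partition (isCorner⁻ α corner))
          (trans (cong suc euler) (trans (cong (λ l → suc ((z α + suc l) + 2 * γ))
            (trans (cong length eq) (trans (length-++ ds)
            (trans (ℕ.+-suc (length ds) _) (cong suc (sym (length-++ ds)))))))
            (trans (solve-∀′ (z α) (length (ds ++ es)) γ)
            (cong₂ (λ a b → (a + suc b) + 2 * suc γ) (sym (z-extend-inject α m))
              (sym (length-map (map inject₁) (ds ++ es))))))))
        (walks-cong N (suc γ) (z-extend-inject α m) (merge-level F ds eq corner)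
          (merge-bag F ds eq corner))
        where
        solve-∀′ : ∀ a b γ → suc ((a + suc (suc b)) + 2 * γ) ≡ (a + suc b) + 2 * suc γ
        solve-∀′ = solve-∀

    -- Neither count ever decreases, so a target once exceeded is never met.
    walks-overshoot : ∀ N {γ b} l cs → 2 ℕ.< γ ⊎ k ℕ.< b → walks N γ b l cs ≡ 0
    walks-overshoot zero    {γ} {b} l cs over = cong (λ t → if t then 1 else 0)
      (dec-false (γ ℕ.≟ 2 ×-dec b ℕ.≟ k) λ
      { (refl , refl) → [ ℕ.<-irrefl refl , ℕ.<-irrefl refl ]′ over })
    walks-overshoot (suc N) {γ} {b} l cs over = cong₂ _+_
      (walks-overshoot N (suc l) cs (map₂ ℕ.m<n⇒m<1+n over))
      (cong₂ _+_
        (trans (splitSum-cong l λ j c _ → walks-overshoot N j (c ∷ cs) over) (splitSum-zero l))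
        (trans (removeSum-cong cs λ c r → trans (cong (c *_)
          (walks-overshoot N (l + c) r (map₁ ℕ.m<n⇒m<1+n over))) (ℕ.*-zeroʳ c))
          (removeSum-zero cs)))

    -- One function counts merges and pushes upwards, the other downwards; a counter that cannot go
    -- below 0 corresponds to an overshoot.
    walks-walkCount : ∀ N g j {γ b} l cs → γ + g ≡ 2 → b + j ≡ k → walks N γ b l cs ≡ walkCount N
      g j l cs
    walks-walkCount zero zero zero {γ} {b} l cs γ≡2 b≡k = cong (λ t → if t then 1 else 0)
      (dec-true (γ ℕ.≟ 2 ×-dec b ℕ.≟ k)
      (trans (sym (ℕ.+-identityʳ γ)) γ≡2 , trans (sym (ℕ.+-identityʳ b)) b≡k))
    walks-walkCount zero zero (suc j) {γ} {b} l cs _ b+j≡k = cong (λ t → if t then 1 else 0)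
      (dec-false (γ ℕ.≟ 2 ×-dec b ℕ.≟ k)
      λ { (_ , refl) → ℕ.m+1+n≢m b b+j≡k })
    walks-walkCount zero (suc g) j {γ} {b} l cs γ+g≡2 _ = cong (λ t → if t then 1 else 0)
      (dec-false (γ ℕ.≟ 2 ×-dec b ℕ.≟ k)
      λ { (refl , _) → ℕ.m+1+n≢m γ γ+g≡2 })
    walks-walkCount (suc N) g j {γ} {b} l cs γ+g≡2 b+j≡k = cong₂ _+_ (push j b+j≡k)
      (cong₂ _+_ (splitSum-cong l λ i c _ → walks-walkCount N g j i (c ∷ cs) γ+g≡2 b+j≡k)
        (merge g γ+g≡2))
      where
      push : ∀ j → b + j ≡ k → walks N γ (suc b) (suc l) cs ≡ pushes N g j l cs
      push zero    b+0≡k = walks-overshoot N (suc l) cs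
        (inj₂ (ℕ.≤-reflexive (cong suc (trans (sym b+0≡k) (ℕ.+-identityʳ b)))))
      push (suc j) b+j≡k = walks-walkCount N g j (suc l) cs γ+g≡2 (trans (sym (ℕ.+-suc b j)) b+j≡k)
      merge : ∀ g → γ + g ≡ 2 → removeSum (λ c r → c * walks N (suc γ) b (l + c) r) cs ≡ merges N
        g j l cs
      merge zero    γ+0≡2 = trans
        (removeSum-cong cs λ c r → trans (cong (c *_) (walks-overshoot N (l + c) r
          (inj₁ (ℕ.≤-reflexive (cong suc (trans (sym γ+0≡2) (ℕ.+-identityʳ γ))))))) (ℕ.*-zeroʳ c))
        (removeSum-zero cs)
      merge (suc g) γ+g≡2 = removeSum-cong cs λ c r → cong (c *_)
        (walks-walkCount N g j (l + c) r (trans (sym (ℕ.+-suc γ g)) γ+g≡2) b+j≡k)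

    p-walkCount : ∀ n → p (suc n) k ≡ walkCount (suc n) 2 k 0 []
    p-walkCount n = begin
      p (suc n) k
        ≡⟨ p-descendants k (suc n) ⟩
      descendants k n α₁ + 0
        ≡⟨ cong (_+ 0) (trans (descendants-walks n α₁ F₁ 0 (partition-extend-last {0} Perm.id [])
          (cong (λ b → (b + 1) + 0) (sym z₁)))
             (walks-cong n 0 z₁ (cong (λ b → (if b then 1 else 0) + 0) (isCorner-last α₁)) refl)) ⟩
      -- From level 0 without other faces only a push is possible, so this unfolds to the walks that
      -- start at the permutation of one element; the added 0 stands for the empty sums of pops and
      -- merges.
      walks (suc n) 0 0 0 []
        ≡⟨ walks-walkCount (suc n) 2 k 0 [] refl refl ⟩
      walkCount (suc n) 2 k 0 [] ∎
      where
      open ≡-Reasoning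
      α₁ : Permutation′ 1
      α₁ = extend {0} Perm.id zero
      z₁ : z α₁ ≡ 1
      z₁ = z-extend-last {0} Perm.id
      F₁ : Faces α₁
      F₁ = record { current = [] ; others = [] ; represents = record
        { areCycles = only (faceMap α₁ ⟨$⟩ʳ zero) ∷ [] ; exhaust = ↭-refl } }
        where
        only : (i : Fin 1) → i ≡ zero
        only zero = refl

open import Data.Integer using (+_)
open import Data.Nat using (_<_; _≤_; s≤s; z≤n)
import Data.Fin.Properties as Fin
open ≡ using (refl; sym; trans)
open import Defs

-- The ring ℤ[[x,y]]

open Algebra.Properties.Semiring.Sum ℤ.+-*-semiring using (sum; sum-cong-≗)
private
  module PS¹ = PowerSeries ℤ.+-*-commutativeRing
  module PS² = PowerSeries PS¹.commutativeRing
  module ℤ[[y,x]] = CommutativeRing PS².commutativeRing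

-- The double sum is the product in ℤ[[y]][[x]]: the outer index is the exponent of x, and the
-- coefficients are power series in y. The ring laws are carried over along this identity.
*-⊛ : ∀ F G → F * G ≈ F PS².⊛ G
*-⊛ F G i j = go (suc i) (λ a → F (toℕ a) PS¹.⊛ G (i ∸ toℕ a))
  where
  open Algebra.Properties.Semiring.Sum (CommutativeRing.semiring PS¹.commutativeRing) using ()
    renaming (sum to sum²)
  go : ∀ n (f : Fin n → ℕ → ℤ) → sum (λ a → f a j) ≡ sum² f j
  go zero    f = refl
  go (suc n) f = cong (λ t → f zero j ℤ.+ t) (go n (f ∘ suc))

1#-const : 1# ≈ ℤ[[y,x]].1#
1#-const zero    zero    = refl
1#-const zero    (suc j) = refl
1#-const (suc i) j       = refl

seriesRing : CommutativeRing 0ℓ 0ℓ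
seriesRing = record
  { Carrier = Series ; _≈_ = _≈_ ; _+_ = _+_ ; _*_ = _*_ ; -_ = -_ ; 0# = λ _ _ → 0ℤ ; 1# = 1#
  ; isCommutativeRing = record
    { isRing = record
      { +-isAbelianGroup = R.+-isAbelianGroup
      ; *-cong = *-cong
      ; *-assoc = λ F G H → R.trans (*-⊛ (F * G) H) (R.trans (R.*-congʳ {x = H} (*-⊛ F G))
          (R.trans (R.*-assoc F G H) (R.trans (R.*-congˡ {x = F} (R.sym (*-⊛ G H)))
            (R.sym (*-⊛ F (G * H))))))
      ; *-identity = (λ F → R.trans (*-⊛ 1# F) (R.trans (R.*-congʳ {x = F} 1#-const)
        (R.*-identityˡ F)))
        , (λ F → R.trans (*-⊛ F 1#) (R.trans (R.*-congˡ {x = F} 1#-const) (R.*-identityʳ F)))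
      ; distrib =
          (λ F G H → R.trans (*-⊛ F (G + H)) (R.trans (R.distribˡ F G H)
            (R.+-cong (R.sym (*-⊛ F G)) (R.sym (*-⊛ F H)))))
        , (λ F G H → R.trans (*-⊛ (G + H) F) (R.trans (R.distribʳ F G H)
          (R.+-cong (R.sym (*-⊛ G F)) (R.sym (*-⊛ H F)))))
      }
    ; *-comm = λ F G → R.trans (*-⊛ F G) (R.trans (R.*-comm F G) (R.sym (*-⊛ G F)))
    }
  }
  where
  module R = ℤ[[y,x]]
  *-cong : ∀ {F F′ G G′} → F ≈ F′ → G ≈ G′ → F * G ≈ F′ * G′
  *-cong {F} {F′} {G} {G′} p q = R.trans (*-⊛ F G) (R.trans (R.*-cong {F} {F′} {G} {G′} p q)
    (R.sym (*-⊛ F′ G′)))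

private module S = CommutativeRing seriesRing

x*-zero : ∀ F j → (x * F) 0 j ≡ 0ℤ
x*-zero F j = trans (*-⊛ x F 0 j) (trans (ℤ.+-identityʳ _) (PS¹.⊛-zeroˡ (F 0) j))

x*-suc : ∀ F i j → (x * F) (suc i) j ≡ F i j
x*-suc F i j = trans (*-⊛ x F (suc i) j)
  (trans (cong₂ ℤ._+_ (PS¹.⊛-zeroˡ (F (suc i)) j) (trans (sym (*-⊛ 1# F i j))
    (S.*-identityˡ F i j))) (ℤ.+-identityˡ _))

y*-const : ∀ F i j → (y * F) i j ≡ (y 0 PS¹.⊛ F i) j
y*-const F i j = trans (*-⊛ y F i j) (trans
  (PS².⊛-cong {y} {PS².const (y 0)} {F} {F} (λ { zero k → refl ; (suc n) k → refl })
    (λ _ _ → refl) i j)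
  (PS².const-⊛ (y 0) F i j))

y*-zero : ∀ F i → (y * F) i 0 ≡ 0ℤ
y*-zero F i = y*-const F i 0

y*-suc : ∀ F i j → (y * F) i (suc j) ≡ F i j
y*-suc F i j = trans (y*-const F i (suc j)) (trans (ℤ.+-identityˡ _) (trans
  (PS¹.⊛-cong {y 0 ∘ suc} {PS¹.const 1ℤ} {F i} {F i} (λ { zero → refl ; (suc n) → refl })
    (λ _ → refl) j)
  (trans (PS¹.const-⊛ 1ℤ (F i) j) (ℤ.*-identityˡ _))))

-- Congruence modulo xⁿ

infix 4 _≈[_]_
_≈[_]_ : Series → ℕ → Series → Set
F ≈[ n ] G = ∀ i → i < n → ∀ j → F i j ≡ G i j

≈[]-refl : ∀ {F n} → F ≈[ n ] F
≈[]-refl _ _ _ = refl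

≈[]-+ : ∀ {F F′ G G′ n} → F ≈[ n ] F′ → G ≈[ n ] G′ → F + G ≈[ n ] F′ + G′
≈[]-+ F≈ G≈ i i<n j = cong₂ ℤ._+_ (F≈ i i<n j) (G≈ i i<n j)

≈[]-* : ∀ {F F′ G G′ n} → F ≈[ n ] F′ → G ≈[ n ] G′ → F * G ≈[ n ] F′ * G′
≈[]-* F≈ G≈ i i<n j = sum-cong-≗ {suc i} λ a → sum-cong-≗ {suc j} λ b → cong₂ ℤ._*_
  (F≈ (toℕ a) (ℕ.≤-<-trans (Fin.toℕ≤pred[n] a) i<n) (toℕ b))
  (G≈ (i ∸ toℕ a) (ℕ.≤-<-trans (ℕ.m∸n≤m i (toℕ a)) i<n) (j ∸ toℕ b))

≈[]-x* : ∀ {F F′ n} → F ≈[ n ] F′ → x * F ≈[ suc n ] x * F′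
≈[]-x* {F} {F′} F≈ zero    _         j = trans (x*-zero F j) (sym (x*-zero F′ j))
≈[]-x* {F} {F′} F≈ (suc i) (s≤s i<n) j = trans (x*-suc F i j)
  (trans (F≈ i i<n j) (sym (x*-suc F′ i j)))

-- Contraction in the x-adic topology: the coefficients of xⁱ no longer change from the iterate
-- number i + 1 on, and they make up the limit.
fixpoint : (Θ : Series → Series) → (∀ {n F G} → F ≈[ n ] G → Θ F ≈[ suc n ] Θ G) → ∃ λ F → F ≈ Θ F
fixpoint Θ contractive = limit , λ i j → sym (contractive (limit≈ i) i ℕ.≤-refl j)
  where
  iter : ℕ → Series
  iter zero    = λ _ _ → 0ℤ
  iter (suc n) = Θ (iter n)
  limit : Series
  limit i = iter (suc i) i
  stable : ∀ {m n} → m ≤ n → iter m ≈[ m ] iter n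
  stable z≤n       _ ()
  stable (s≤s m≤n) = contractive (stable m≤n)
  limit≈ : ∀ n → limit ≈[ n ] iter n
  limit≈ n i i<n j = stable i<n i ℕ.≤-refl j

-- The series 1/(1 - x f), obtained without division.
geometric : ∀ f → ∃ λ g → g ≈ 1# + x * (f * g)
geometric f = fixpoint (λ g → 1# + x * (f * g)) λ {n} {F} {G} F≈G →
  ≈[]-+ {1#} {1#} {x * (f * F)} {x * (f * G)} ≈[]-refl
    (≈[]-x* {f * F} {f * G} (≈[]-* {f} {f} {F} {G} ≈[]-refl F≈G))

*-constant : ∀ {F G} → F 0 0 ≡ 1ℤ → G 0 0 ≡ 1ℤ → (F * G) 0 0 ≡ 1ℤ
*-constant {F} {G} F≡ G≡ = trans (cong₂ (λ a b → a ℤ.* b ℤ.+ 0ℤ ℤ.+ 0ℤ) F≡ G≡) refl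

^-constant : ∀ {F} n → F 0 0 ≡ 1ℤ → (F ^ n) 0 0 ≡ 1ℤ
^-constant     zero    F≡ = refl
^-constant {F} (suc n) F≡ = *-constant {F} {F ^ n} F≡ (^-constant {F} n F≡)

-- The two powers agree by definition at each numeral, but deciding that is
-- expensive.
^-≡ : ∀ F n → F ^ n ≡ Quotient._^_ seriesRing F n
^-≡ F zero    = refl
^-≡ F (suc n) = cong (F *_) (^-≡ F n)

-- The theorem

P≡walkCount : ∀ i j → P i j ≡ + walkCount i 2 j 0 []
P≡walkCount zero    j       = refl
P≡walkCount (suc i) zero    = refl
P≡walkCount (suc i) (suc j) = cong +_ (GenusCount.p-walkCount (suc j) i)

numerator≡ : Quotient.numerator seriesRing x y ≡ x ^ 6 * y ^ 2 * polyₚ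
numerator≡ = refl

-- Variables stand for the polynomials and the exponent, as Agda would
-- otherwise unfold them.
quotient : Quotient.QuotientForm seriesRing x y → ∀ {d m} →
  d ≡ Quotient.discriminant seriesRing x y → Quotient.numerator seriesRing x y ≡ m →
  ∀ n → n ≡ 11 → ∃ λ S → IsHalfPower d n S × IsQuotient P m S
quotient Q {d} {m} d≡ m≡ n n≡11 =
    -- Since s² is the polynomial `d` and `s` has constant term 1, the half-integral power is a
    -- plain power of `s`, and its inverse is the same power of `T`.
    s ^ n , (^-constant {s} n s≡1 , Q.square-power d≡ n) , T ^ n , Q.inverse-powers n
  , λ i j → trans (P≡walkCount i j) (Coefficients.Extraction.walkCount-quotient seriesRing x y
    (λ F → F) (λ F≈G → F≈G)
      (λ _ _ _ _ → refl) (λ _ _ → refl) (λ _ _ → refl) x*-zero x*-suc y*-zero y*-suc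
      Q {m} {T ^ n} {n} n≡11 m≡ (^-≡ T n) i j)
  where
  module Q = Quotient.QuotientForm Q
  s T : Series
  s = Q.s
  T = Q.T
  s≡1 : s 0 0 ≡ 1ℤ
  s≡1 = trans (Q.s≈1-xf 0 0) (cong (λ a → 1ℤ ℤ.+ ℤ.- a) (x*-zero Q.f 0))

-- `N` is u w / x². Writing u = x (y + x N) and w = x (1 + x N) puts a factor x before each `N`,
-- which makes its equation contractive. The three geometric series are 1/(1 - u - w), 1/(1 - w) and
-- 1/(1 - u).
solution : Quotient.QuotientForm seriesRing x y
solution =
  let N , N≈ = fixpoint (λ N → (1# + x * N) * (y + x * N)) λ {n} {F} {G} F≈G →
        ≈[]-* {1# + x * F} {1# + x * G} {y + x * F} {y + x * G}
          (≈[]-+ {1#} {1#} {x * F} {x * G} ≈[]-refl (≈[]-x* {F} {G} F≈G))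
          (≈[]-+ {y} {y} {x * F} {x * G} ≈[]-refl (≈[]-x* {F} {G} F≈G))
      T , T≈ = geometric ((y + x * N) + (1# + x * N))
      r , r≈ = geometric (1# + x * N)
      v , v≈ = geometric (y + x * N)
  in Parametrization.Solution.quotientForm seriesRing x y N T r v N≈ T≈ r≈ v≈

theorem9p3 : ∃ λ S → IsHalfPower D 11 S × IsQuotient P (x ^ 6 * y ^ 2 * polyₚ) S
theorem9p3 = quotient solution {D} {x ^ 6 * y ^ 2 * polyₚ} refl numerator≡ 11 refl
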